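{- Let $p$ be an MSOL-polynomial and let $(G_n)_{n\in\mathbb{N}}$ be a bi-iteratively constructible graph family. If $p$ is an MSOL${}_G$-polynomial, or $(G_n)_{n\in\mathbb{N}}$ is bounded, then the sequence $(p(G_n))_{n\in\mathbb{N}}$ is C${}^2$-finite.
   Context: Sequences. A sequence $(a_n)$ over a field $\mathbb{F}$ is C-finite if there exist $s\in\mathbb{N}$ and constants $c^{(0)},\ldots,c^{(s)}\in\mathbb{F}$, $c^{(s)}\neq0$, with $c^{(s)}a_{n+s}=c^{(s-1)}a_{n+s-1}+\cdots+c^{(0)}a_n$ for all $n\geq s$. It is C${}^2$-finite if there exist $s$ and C-finite sequences $c^{(0)}_n,\ldots,c^{(s)}_n$ with $c^{(s)}_n\neq0$ for all $n$ and $c^{(s)}_n a_{n+s}=c^{(s-1)}_n a_{n+s-1}+\cdots+c^{(0)}_n a_n$ for all $n\geq s$. Here the sequence $p(G_n)$ consists of polynomials in indeterminates $\bar X$, and C${}^2$-finiteness is understood over the field of rational functions in $\bar X$. $k$-graphs. A $k$-graph is $G=(V,E;R_1,\ldots,R_k)$ where $(V,E)$ is a finite simple graph and the labels $R_1,\ldots,R_k\subseteq V$ partition $V$. Basic operations on $k$-graphs: $Add_i$ (add a new vertex to $R_i$); $\rho_{i\to j}$ (move all vertices of $R_i$ into $R_j$, so $R_i$ becomes empty); $\eta_{i,j}$ (add all edges between vertices labeled $i$ and vertices labeled $j$); $\eta^b_{i,j}$ (equal to $\eta_{i,j}$ if $|R_i\cup R_j|\leq b$, otherwise the identity); $\delta_{i,j}$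 (remove all edges between vertices labeled $i$ and vertices labeled $j$). An elementary operation is a finite composition of basic operations. A family of $k$-graphs is a bi-iteration family if there are a $k$-graph $G_0$ and elementary operations $H,F,L$ with $G_{n+1}=H(F^n(L(G_n)))$ for all $n$, where $F^n$ is $n$-fold application of $F$. A family of graphs $(G_n)$ is bi-iteratively constructible if for some $k$ there is a bi-iteration family of $k$-graphs whose underlying graphs (labels ignored) are the $G_n$. A basic operation is bounded if it is not of the form $\eta_{i,j}$ (operations $\eta^b_{i,j}$ are bounded); a bi-iteratively constructible family is bounded if its construction uses only bounded basic operations. MSOL-polynomials. Graphs are ordered (a linear order $\leq$ on vertices is available). Monadic second order logic MSOL has vertex variables $x_i$, vertex-set variables $U_i$ and edge-set variables $B_i$; atomic formulas $x_i=x_j$, $(x_i,x_j)\in E$, $x_i\leq x_j$, $x_i\in U_j$, $(x_i,x_j)\in B_\ell$; closed under $\lor,\land,\neg,\to$ and quantification over all three kinds of variables. An MSOL-polynomial is a graph polynomial of the form \[ p(G)=\sum_{U_1,\ldots,U_\ell,B_1,\ldots,B_m:\ \Phi(\bar U,\bar B)} X_1^{|U_1|}\cdots X_{\ell'}^{|U_{\ell'}|}X_{\ell'+1}^{|B_1|}\cdots X_{\ell'+m'}^{|B_{m'}|}, \] where the sum ranges over vertex subsets $U_i$ and edge subsets $B_j$ of $G$ satisfying the MSOL formula $\Phi$, and $\ell'\leq\ell$, $m'\leq m$. It is an MSOL${}_G$-polynomial if $m=0$ and no edge-set variable occurs in $\Phi$. -}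

module Defs where

open import Data.Bool using (Bool; true; false; _∧_; _∨_; not; if_then_else_)
open import Data.Bool.Properties using (∨-comm; ∧-comm)
open import Data.Nat as ℕ using (ℕ; zero; suc; _≤_; _≤ᵇ_; _≡ᵇ_; _≤?_)
open import Data.Fin as Fin using (Fin; toℕ; fromℕ; inject₁; inject≤)
open import Data.Fin.Subset using (Subset; ∣_∣)
open import Data.Integer as ℤ using (ℤ)
open import Data.List as List using (List; []; _∷_; concatMap; allFin; foldr; length)
open import Data.Bool.ListAction using (any; all)
open import Data.Nat.ListAction using (sum)
import Data.Vec as Vec
import Data.Vec.Functional as VF
open import Data.Product using (Σ; _×_; _,_; proj₁; proj₂)
open import Data.Sum using (_⊎_)
open import Data.Empty using (⊥; ⊥-elim)
open import Data.Unit using (⊤)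
open import Function.Bundles using (_↔_; Inverse)
open import Relation.Nullary using (¬_; yes; no)
open import Relation.Nullary.Decidable using (⌊_⌋)
open import Relation.Binary.PropositionalEquality using (_≡_; refl; sym; cong; cong₂)

-- Finite simple graphs.  Vertex set is Fin N; the linear order on
-- vertices is the natural order on Fin N.

record Graph : Set where
  field
    N      : ℕ
    adj    : Fin N → Fin N → Bool
    adj-sym   : ∀ u v → adj u v ≡ adj v u
    adj-irrefl : ∀ u → adj u u ≡ false
open Graph public

Iso : Graph → Graph → Set
Iso G H = Σ (Fin (N G) ↔ Fin (N H)) λ f →
  ∀ u v → adj H (Inverse.to f u) (Inverse.to f v) ≡ adj G u v

-- k-graphs: a graph with a labelling (partition of V into R_1..R_k)
record KGraph (k : ℕ) : Set where
  field
    graph : Graph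
    label : Fin (N graph) → Fin k
open KGraph public

data BasicOp (k : ℕ) : Set where
  Add  : Fin k → BasicOp k
  ρ    : Fin k → Fin k → BasicOp k
  η    : Fin k → Fin k → BasicOp k
  ηᵇ   : ℕ → Fin k → Fin k → BasicOp k
  δ    : Fin k → Fin k → BasicOp k

BoundedOp : ∀ {k} → BasicOp k → Set
BoundedOp (η _ _) = ⊥
BoundedOp _       = ⊤

ElemOp : ℕ → Set
ElemOp k = List (BasicOp k)

BoundedElem : ∀ {k} → ElemOp k → Set
BoundedElem []       = ⊤
BoundedElem (o ∷ os) = BoundedOp o × BoundedElem os

private
  feq : ∀ {n} → Fin n → Fin n → Bool
  feq u v = ⌊ u Fin.≟ v ⌋

  feq-sym : ∀ {n} (u v : Fin n) → feq u v ≡ feq v u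
  feq-sym u v with u Fin.≟ v | v Fin.≟ u
  ... | yes _ | yes _ = refl
  ... | yes p | no q  = ⊥-elim (q (sym p))
  ... | no q  | yes p = ⊥-elim (q (sym p))
  ... | no _  | no _  = refl

  feq-refl : ∀ {n} (u : Fin n) → feq u u ≡ true
  feq-refl u with u Fin.≟ u
  ... | yes _ = refl
  ... | no q  = ⊥-elim (q refl)

pairLab : ∀ {k} (G : KGraph k) → Fin k → Fin k →
          Fin (N (graph G)) → Fin (N (graph G)) → Bool
pairLab G i j u v =
  (feq (label G u) i ∧ feq (label G v) j) ∨ (feq (label G u) j ∧ feq (label G v) i)

pairLab-sym : ∀ {k} (G : KGraph k) i j u v → pairLab G i j u v ≡ pairLab G i j v u
pairLab-sym G i j u v
  rewrite ∧-comm (feq (label G u) i) (feq (label G v) j)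
        | ∧-comm (feq (label G u) j) (feq (label G v) i)
  = ∨-comm (feq (label G v) j ∧ feq (label G u) i) (feq (label G v) i ∧ feq (label G u) j)

addVertex : ∀ {k} → Fin k → KGraph k → KGraph k
addVertex {k} i G = record { graph = g ; label = lab }
  where
  n = N (graph G)
  a : Fin (suc n) → Fin (suc n) → Bool
  a Fin.zero    _          = false
  a (Fin.suc u) Fin.zero   = false
  a (Fin.suc u) (Fin.suc v) = adj (graph G) u v
  as : ∀ u v → a u v ≡ a v u
  as Fin.zero Fin.zero = refl
  as Fin.zero (Fin.suc v) = refl
  as (Fin.suc u) Fin.zero = refl
  as (Fin.suc u) (Fin.suc v) = adj-sym (graph G) u v
  ai : ∀ u → a u u ≡ false
  ai Fin.zero = refl
  ai (Fin.suc u) = adj-irrefl (graph G) u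
  g : Graph
  g = record { N = suc n ; adj = a ; adj-sym = as ; adj-irrefl = ai }
  lab : Fin (suc n) → Fin k
  lab Fin.zero    = i
  lab (Fin.suc u) = label G u

relabel : ∀ {k} → Fin k → Fin k → KGraph k → KGraph k
relabel i j G = record
  { graph = graph G
  ; label = λ u → if feq (label G u) i then j else label G u }

addEdges : ∀ {k} → Fin k → Fin k → KGraph k → KGraph k
addEdges i j G = record { graph = g ; label = label G }
  where
  a : _ → _ → Bool
  a u v = adj (graph G) u v ∨ (pairLab G i j u v ∧ not (feq u v))
  g : Graph
  g = record
    { N = N (graph G)
    ; adj = a
    ; adj-sym = λ u v → cong₂ _∨_ (adj-sym (graph G) u v)
                          (cong₂ _∧_ (pairLab-sym G i j u v) (cong not (feq-sym u v)))
    ; adj-irrefl = λ u → helper u }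
    where
    helper : ∀ u → a u u ≡ false
    helper u rewrite adj-irrefl (graph G) u | feq-refl u with pairLab G i j u u
    ... | true = refl
    ... | false = refl

removeEdges : ∀ {k} → Fin k → Fin k → KGraph k → KGraph k
removeEdges i j G = record { graph = g ; label = label G }
  where
  g : Graph
  g = record
    { N = N (graph G)
    ; adj = λ u v → adj (graph G) u v ∧ not (pairLab G i j u v)
    ; adj-sym = λ u v → cong₂ _∧_ (adj-sym (graph G) u v) (cong not (pairLab-sym G i j u v))
    ; adj-irrefl = λ u → cong₂ (λ x y → x ∧ y) (adj-irrefl (graph G) u) refl }

countLab : ∀ {k} → KGraph k → Fin k → Fin k → ℕ
countLab G i j =
  sum (List.map (λ u → if feq (label G u) i ∨ feq (label G u) j then 1 else 0)
                     (allFin (N (graph G))))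

applyBasic : ∀ {k} → BasicOp k → KGraph k → KGraph k
applyBasic (Add i)    G = addVertex i G
applyBasic (ρ i j)    G = relabel i j G
applyBasic (η i j)    G = addEdges i j G
applyBasic (ηᵇ b i j) G = if countLab G i j ≤ᵇ b then addEdges i j G else G
applyBasic (δ i j)    G = removeEdges i j G

applyElem : ∀ {k} → ElemOp k → KGraph k → KGraph k
applyElem []       G = G
applyElem (o ∷ os) G = applyElem os (applyBasic o G)

iterElem : ∀ {k} → ℕ → ElemOp k → KGraph k → KGraph k
iterElem zero    F G = G
iterElem (suc n) F G = applyElem F (iterElem n F G)

record BiIteration : Set where
  field
    k  : ℕ
    G₀ : KGraph k
    H F L : ElemOp k

  family : ℕ → KGraph k
  family zero    = G₀
  family (suc n) = applyElem H (iterElem n F (applyElem L (family n)))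

  AllBounded : Set
  AllBounded = BoundedElem H × BoundedElem F × BoundedElem L
open BiIteration public

Realises : BiIteration → (ℕ → Graph) → Set
Realises B Gs = ∀ n → Iso (Gs n) (graph (family B n))

BiIterativelyConstructible : (ℕ → Graph) → Set
BiIterativelyConstructible Gs = Σ BiIteration λ B → Realises B Gs

BoundedBiIterativelyConstructible : (ℕ → Graph) → Set
BoundedBiIterativelyConstructible Gs = Σ BiIteration λ B → Realises B Gs × AllBounded B

-- MSOL on ordered graphs.  Form a b c: formulas with a free vertex
-- variables, b free vertex-set variables, c free edge-set variables.

data Form (a b c : ℕ) : Set where
  _≐_    : Fin a → Fin a → Form a b c
  edgeA  : Fin a → Fin a → Form a b c
  _≤ₓ_   : Fin a → Fin a → Form a b c
  _∈U_   : Fin a → Fin b → Form a b c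
  memB   : Fin a → Fin a → Fin c → Form a b c
  _∨ᶠ_ _∧ᶠ_ _⇒ᶠ_ : Form a b c → Form a b c → Form a b c
  ¬ᶠ_    : Form a b c → Form a b c
  ∃x ∀x  : Form (suc a) b c → Form a b c
  ∃U ∀U  : Form a (suc b) c → Form a b c
  ∃B ∀B  : Form a b (suc c) → Form a b c

EdgeFree : ∀ {a b c} → Form a b c → Set
EdgeFree (x ≐ y)     = ⊤
EdgeFree (edgeA x y) = ⊤
EdgeFree (x ≤ₓ y)    = ⊤
EdgeFree (x ∈U U)    = ⊤
EdgeFree (memB x y B) = ⊥
EdgeFree (φ ∨ᶠ ψ)    = EdgeFree φ × EdgeFree ψ
EdgeFree (φ ∧ᶠ ψ)    = EdgeFree φ × EdgeFree ψ
EdgeFree (φ ⇒ᶠ ψ)    = EdgeFree φ × EdgeFree ψ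
EdgeFree (¬ᶠ φ)      = EdgeFree φ
EdgeFree (∃x φ)      = EdgeFree φ
EdgeFree (∀x φ)      = EdgeFree φ
EdgeFree (∃U φ)      = EdgeFree φ
EdgeFree (∀U φ)      = EdgeFree φ
EdgeFree (∃B φ)      = ⊥
EdgeFree (∀B φ)      = ⊥

allSubsets : ∀ n → List (Subset n)
allSubsets zero    = Vec.[] ∷ []
allSubsets (suc n) = List.map (true Vec.∷_) (allSubsets n) List.++ List.map (false Vec.∷_) (allSubsets n)

allTuples : ∀ {A : Set} → List A → ∀ k → List (VF.Vector A k)
allTuples xs zero    = (λ ()) ∷ []
allTuples xs (suc k) = concatMap (λ x → List.map (x VF.∷_) (allTuples xs k)) xs

edges : (G : Graph) → List (Fin (N G) × Fin (N G))
edges G = List.filterᵇ (λ e → (suc (toℕ (proj₁ e)) ≤ᵇ toℕ (proj₂ e)) ∧ adj G (proj₁ e) (proj₂ e))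
                       (List.cartesianProduct (allFin (N G)) (allFin (N G)))

nEdges : Graph → ℕ
nEdges G = length (edges G)

edgeAt : (G : Graph) → Fin (nEdges G) → Fin (N G) × Fin (N G)
edgeAt G = List.lookup (edges G)

-- satisfaction (all quantifiers range over finite sets, so this is decidable)
sat : (G : Graph) → ∀ {a b c} → Form a b c →
      VF.Vector (Fin (N G)) a → VF.Vector (Subset (N G)) b →
      VF.Vector (Subset (nEdges G)) c → Bool
sat G (x ≐ y)      ρx ρU ρB = feq (ρx x) (ρx y)
sat G (edgeA x y)  ρx ρU ρB = adj G (ρx x) (ρx y)
sat G (x ≤ₓ y)     ρx ρU ρB = toℕ (ρx x) ≤ᵇ toℕ (ρx y)
sat G (x ∈U U)     ρx ρU ρB = Vec.lookup (ρU U) (ρx x)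
sat G (memB x y B) ρx ρU ρB =
  any (λ e → Vec.lookup (ρB B) e ∧
             ((feq (proj₁ (edgeAt G e)) (ρx x) ∧ feq (proj₂ (edgeAt G e)) (ρx y)) ∨
              (feq (proj₁ (edgeAt G e)) (ρx y) ∧ feq (proj₂ (edgeAt G e)) (ρx x))))
      (allFin (nEdges G))
sat G (φ ∨ᶠ ψ) ρx ρU ρB = sat G φ ρx ρU ρB ∨ sat G ψ ρx ρU ρB
sat G (φ ∧ᶠ ψ) ρx ρU ρB = sat G φ ρx ρU ρB ∧ sat G ψ ρx ρU ρB
sat G (φ ⇒ᶠ ψ) ρx ρU ρB = not (sat G φ ρx ρU ρB) ∨ sat G ψ ρx ρU ρB
sat G (¬ᶠ φ)   ρx ρU ρB = not (sat G φ ρx ρU ρB)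
sat G (∃x φ) ρx ρU ρB = any (λ v → sat G φ (v VF.∷ ρx) ρU ρB) (allFin (N G))
sat G (∀x φ) ρx ρU ρB = all (λ v → sat G φ (v VF.∷ ρx) ρU ρB) (allFin (N G))
sat G (∃U φ) ρx ρU ρB = any (λ S → sat G φ ρx (S VF.∷ ρU) ρB) (allSubsets (N G))
sat G (∀U φ) ρx ρU ρB = all (λ S → sat G φ ρx (S VF.∷ ρU) ρB) (allSubsets (N G))
sat G (∃B φ) ρx ρU ρB = any (λ S → sat G φ ρx ρU (S VF.∷ ρB)) (allSubsets (nEdges G))
sat G (∀B φ) ρx ρU ρB = all (λ S → sat G φ ρx ρU (S VF.∷ ρB)) (allSubsets (nEdges G))

-- Multivariate polynomials over ℤ in r indeterminates X_1..X_r: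
-- a finite list of terms (coefficient, exponent vector).

Mono : ℕ → Set
Mono r = Fin r → ℕ

Poly : ℕ → Set
Poly r = List (ℤ × Mono r)

monoEq : ∀ {r} → Mono r → Mono r → Bool
monoEq {r} e f = all (λ i → e i ≡ᵇ f i) (allFin r)

coeff : ∀ {r} → Poly r → Mono r → ℤ
coeff []            m = ℤ.0ℤ
coeff ((c , e) ∷ t) m = (if monoEq e m then c else ℤ.0ℤ) ℤ.+ coeff t m

_≈ᴾ_ : ∀ {r} → Poly r → Poly r → Set
P ≈ᴾ Q = ∀ m → coeff P m ≡ coeff Q m

_+ᴾ_ : ∀ {r} → Poly r → Poly r → Poly r
P +ᴾ Q = P List.++ Q

_*ᴾ_ : ∀ {r} → Poly r → Poly r → Poly r
P *ᴾ Q = concatMap (λ t → List.map (λ s → (proj₁ t ℤ.* proj₁ s , λ i → proj₂ t i ℕ.+ proj₂ s i)) Q) P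

0ᴾ 1ᴾ : ∀ {r} → Poly r
0ᴾ = []
1ᴾ = (ℤ.1ℤ , λ _ → 0) ∷ []

-- The field ℚ(X_1..X_r) of rational functions, as fractions num/den
-- (an element is a pair with den ≠ 0, see Valid), with the usual equality.

record Frac (r : ℕ) : Set where
  constructor _/_
  field num den : Poly r
open Frac public

Valid : ∀ {r} → Frac r → Set
Valid x = ¬ (den x ≈ᴾ 0ᴾ)

_≈_ : ∀ {r} → Frac r → Frac r → Set
x ≈ y = (num x *ᴾ den y) ≈ᴾ (num y *ᴾ den x)

_+ᶠ_ _*ᶠ_ : ∀ {r} → Frac r → Frac r → Frac r
x +ᶠ y = ((num x *ᴾ den y) +ᴾ (num y *ᴾ den x)) / (den x *ᴾ den y)
x *ᶠ y = (num x *ᴾ num y) / (den x *ᴾ den y)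

0ᶠ : ∀ {r} → Frac r
0ᶠ = 0ᴾ / 1ᴾ

fromPoly : ∀ {r} → Poly r → Frac r
fromPoly P = P / 1ᴾ

Σᶠ : ∀ {r} s → (Fin s → Frac r) → Frac r
Σᶠ zero    f = 0ᶠ
Σᶠ (suc s) f = f Fin.zero +ᶠ Σᶠ s (λ j → f (Fin.suc j))

CFinite : ∀ {r} → (ℕ → Frac r) → Set
CFinite {r} a =
  (∀ n → Valid (a n)) ×
  Σ ℕ λ s → Σ (Fin (suc s) → Frac r) λ c →
    (∀ j → Valid (c j)) ×
    ¬ (c (fromℕ s) ≈ 0ᶠ) ×
    (∀ n → s ≤ n →
      (c (fromℕ s) *ᶠ a (n ℕ.+ s)) ≈ Σᶠ s (λ j → c (inject₁ j) *ᶠ a (n ℕ.+ toℕ j)))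

C2Finite : ∀ {r} → (ℕ → Frac r) → Set
C2Finite {r} a =
  (∀ n → Valid (a n)) ×
  Σ ℕ λ s → Σ (Fin (suc s) → ℕ → Frac r) λ c →
    (∀ j → CFinite (c j)) ×
    (∀ n → ¬ (c (fromℕ s) n ≈ 0ᶠ)) ×
    (∀ n → s ≤ n →
      (c (fromℕ s) n *ᶠ a (n ℕ.+ s)) ≈ Σᶠ s (λ j → c (inject₁ j) n *ᶠ a (n ℕ.+ toℕ j)))

record MSOLPoly : Set where
  field
    ℓ m ℓ' m' : ℕ
    ℓ'≤ℓ : ℓ' ≤ ℓ
    m'≤m : m' ≤ m
    Φ    : Form 0 ℓ m

  nVars : ℕ
  nVars = ℓ' ℕ.+ m'

  eval : Graph → Poly nVars
  eval G =
    concatMap (λ U →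
      concatMap (λ B →
        if sat G Φ (λ ()) U B
        then (ℤ.1ℤ , ((λ i → ∣ U (inject≤ i ℓ'≤ℓ) ∣) VF.++ (λ i → ∣ B (inject≤ i m'≤m) ∣))) ∷ []
        else [])
      (allTuples (allSubsets (nEdges G)) m))
    (allTuples (allSubsets (N G)) ℓ)
open MSOLPoly public

-- p is a graph polynomial: invariant under isomorphism (in particular
-- independent of the vertex order used by ≤)
IsGraphPolynomial : MSOLPoly → Set
IsGraphPolynomial p = ∀ G H → Iso G H → eval p G ≈ᴾ eval p H

IsMSOLG : MSOLPoly → Set
IsMSOLG p = (m p ≡ 0) × EdgeFree (Φ p)

-- Each vertex of a k-graph is labelled by its class and by its capped ranks in all unions of classes. The type of a formula
-- on a graph with assigned variables is a bounded-depth record of atomic facts and of sets of types of subformulas; the type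
-- after an operation depends only on the type before it, on how the new vertex and the new edges are distributed over the
-- sets: either there are no edge sets, or the classes joined by a bounded operation are small and their vertices have distinct
-- labels, so that edges are added one at a time. Hence the generating polynomials of the finitely many types form a vector on which every operation acts by a matrix
-- over ℤ[X], and v_{n+1} = H Fⁿ L v_n.
--
-- Write a_{n+t} = y^t_n · v_n, where the rows y^t_n have C-finite entries. A C-finite sequence is either eventually zero or
-- nonzero somewhere in each window of some fixed length E, so zeros need not be located (no Skolem–Mahler–Lech theorem).
-- Elimination yields a C-finite pivot w that is not eventually zero and T such that w y^t lies in the span of the y^j with
-- j < T for all t from T to T + E, from some n on. Shifting by i < E gives relations for the same a_{n+T+E} with leading
-- coefficients w_{n+i}, and the sum of the squares of these never vanishes.

module Submission where

open import Defs hiding (_≈_; _/_)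
open import Algebra using (CommutativeMonoid)
open import Level using (0ℓ)
open import Data.Bool as Bool using (Bool; true; false; _∧_; _∨_; not; if_then_else_)
import Data.Bool.Properties as Boolₚ
open import Data.Bool.ListAction using (any; all; and)
open import Data.Nat as ℕ using (ℕ; zero; suc; _≤_; _<_; z≤n; s≤s; _≤ᵇ_; _≡ᵇ_)
import Data.Nat.ListAction as ℕSum
import Data.Nat.Properties as ℕₚ
open import Data.Integer as ℤ using (ℤ; +_)
import Data.Integer.Properties as ℤₚ
open import Data.Integer.Tactic.RingSolver using (solve-∀)
open import Data.Fin as Fin using (Fin; toℕ; inject≤)
import Data.Fin.Properties as Finₚ
open import Data.Fin.Subset using (Subset; ∣_∣)
open import Data.List as List using (List; []; _∷_; concatMap; allFin; length; cartesianProduct)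
import Data.List.Properties as Listₚ
open import Data.List.Membership.Propositional using (_∈_)
open import Data.List.Membership.Propositional.Properties
open import Data.List.Relation.Unary.All as All using (All; []; _∷_)
import Data.List.Relation.Unary.All.Properties as Allₚ
open import Data.List.Relation.Unary.AllPairs using ([]; _∷_)
open import Data.List.Relation.Unary.Any as Any using (here; there)
import Data.List.Relation.Unary.Any.Properties as Anyₚ
open import Data.List.Relation.Unary.Unique.Propositional using (Unique)
import Data.List.Relation.Unary.Unique.Propositional.Properties as Uniqueₚ
open import Data.Maybe as Maybe using (Maybe; just; nothing; maybe′)
open import Data.Vec as Vec using ()
import Data.Vec.Functional as VF
import Data.Vec.Functional.Properties as VFₚ
open import Data.Product using (Σ; _×_; _,_; proj₁; proj₂)
open import Data.Sum using (_⊎_; inj₁; inj₂; [_,_])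
open import Data.Unit using (⊤; tt)
open import Data.Empty using (⊥; ⊥-elim)
open import Function using (_∘_; id; case_of_)
open import Relation.Binary.Definitions using (Tri; tri<; tri≈; tri>)
open import Relation.Binary.PropositionalEquality hiding (setoid; [_])
open import Relation.Nullary using (¬_; Dec; yes; no)
open import Relation.Nullary.Decidable using (⌊_⌋)

-- Polynomials as functions on points

-- The matrices exist only because every assignment after an operation comes from exactly one
-- assignment before it together with one bit per variable: then the generating polynomials change
-- linearly, with coefficients computed from type codes alone. Two choices secure this uniqueness
-- for vertices. New vertices are put below the old ones, which the invariance of `p` under
-- isomorphism permits, and a vertex variable stays unassigned until its vertex exists.
--
-- The algebra is free of division. Polynomials are compared through their values at points with
-- natural coordinates, so that identities between them become identities in ℤ, and every
-- elimination is a cross-multiplication. A nested quantifier "for all large coordinates" ties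
-- values to coefficients and excludes zero divisors. The order of ℤ is what forbids cancellation in
-- a sum of squares. The length `E` governs how many rows have to be reduced: a relation shifted by
-- `i` uses row `T + E - i`.

Point : ℕ → Set
Point r = Fin r → ℕ

monoAt : ∀ {r} → Mono r → Point r → ℤ
monoAt {zero}  e x = ℤ.1ℤ
monoAt {suc r} e x = (+ x Fin.zero) ℤ.^ e Fin.zero ℤ.* monoAt (e ∘ Fin.suc) (x ∘ Fin.suc)

evalAt : ∀ {r} → Poly r → Point r → ℤ
evalAt []            x = ℤ.0ℤ
evalAt ((c , e) ∷ P) x = c ℤ.* monoAt e x ℤ.+ evalAt P x

monoAt-+ : ∀ {r} (e f : Mono r) x → monoAt (λ i → e i ℕ.+ f i) x ≡ monoAt e x ℤ.* monoAt f x
monoAt-+ {zero}  e f x = refl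
monoAt-+ {suc r} e f x
  rewrite monoAt-+ (e ∘ Fin.suc) (f ∘ Fin.suc) (x ∘ Fin.suc)
        | ℤₚ.^-distribˡ-+-* (+ x Fin.zero) (e Fin.zero) (f Fin.zero) =
  interchange ((+ x Fin.zero) ℤ.^ e Fin.zero) ((+ x Fin.zero) ℤ.^ f Fin.zero)
    (monoAt (e ∘ Fin.suc) (x ∘ Fin.suc)) (monoAt (f ∘ Fin.suc) (x ∘ Fin.suc))
  where
  interchange : ∀ a b c d → (a ℤ.* b) ℤ.* (c ℤ.* d) ≡ (a ℤ.* c) ℤ.* (b ℤ.* d)
  interchange = solve-∀

monoAt-cong : ∀ {r} {e f : Mono r} → e ≗ f → ∀ x → monoAt e x ≡ monoAt f x
monoAt-cong {zero}  eq x = refl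
monoAt-cong {suc r} eq x =
  cong₂ ℤ._*_ (cong ((+ x Fin.zero) ℤ.^_) (eq Fin.zero)) (monoAt-cong (eq ∘ Fin.suc) (x ∘ Fin.suc))

monoAt-0 : ∀ {r} (x : Point r) → monoAt (λ _ → 0) x ≡ ℤ.1ℤ
monoAt-0 {zero}  x = refl
monoAt-0 {suc r} x = trans (ℤₚ.*-identityˡ _) (monoAt-0 (x ∘ Fin.suc))

evalAt-++ : ∀ {r} (P Q : Poly r) x → evalAt (P List.++ Q) x ≡ evalAt P x ℤ.+ evalAt Q x
evalAt-++ []            Q x = sym (ℤₚ.+-identityˡ _)
evalAt-++ ((c , e) ∷ P) Q x rewrite evalAt-++ P Q x = sym (ℤₚ.+-assoc (c ℤ.* monoAt e x) _ _)

evalAt-*ᴾ : ∀ {r} (P Q : Poly r) x → evalAt (P *ᴾ Q) x ≡ evalAt P x ℤ.* evalAt Q x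
evalAt-*ᴾ []            Q x = refl
evalAt-*ᴾ {r} ((c , e) ∷ P) Q x = begin
  evalAt (scaled Q List.++ (P *ᴾ Q)) x
    ≡⟨ evalAt-++ (scaled Q) (P *ᴾ Q) x ⟩
  evalAt (scaled Q) x ℤ.+ evalAt (P *ᴾ Q) x
    ≡⟨ cong₂ ℤ._+_ (evalAt-scaled Q) (evalAt-*ᴾ P Q x) ⟩
  (c ℤ.* monoAt e x) ℤ.* evalAt Q x ℤ.+ evalAt P x ℤ.* evalAt Q x
    ≡⟨ ℤₚ.*-distribʳ-+ (evalAt Q x) (c ℤ.* monoAt e x) (evalAt P x) ⟨
  (c ℤ.* monoAt e x ℤ.+ evalAt P x) ℤ.* evalAt Q x ∎
  where
  open ≡-Reasoning
  scaled : Poly r → Poly r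
  scaled = List.map (λ s → (c ℤ.* proj₁ s , λ i → e i ℕ.+ proj₂ s i))
  distribute : ∀ a b p q z → (a ℤ.* b) ℤ.* (p ℤ.* q) ℤ.+ (a ℤ.* p) ℤ.* z ≡ (a ℤ.* p) ℤ.* (b ℤ.* q ℤ.+ z)
  distribute = solve-∀
  evalAt-scaled : ∀ Q → evalAt (scaled Q) x ≡ (c ℤ.* monoAt e x) ℤ.* evalAt Q x
  evalAt-scaled []            = sym (ℤₚ.*-zeroʳ (c ℤ.* monoAt e x))
  evalAt-scaled ((d , f) ∷ Q) rewrite evalAt-scaled Q | monoAt-+ e f x =
    distribute c d (monoAt e x) (monoAt f x) (evalAt Q x)

evalAt-1 : ∀ {r} (x : Point r) → evalAt 1ᴾ x ≡ ℤ.1ℤ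
evalAt-1 x rewrite monoAt-0 x = refl

negᴾ : ∀ {r} → Poly r → Poly r
negᴾ = List.map (λ t → ℤ.- proj₁ t , proj₂ t)

evalAt-neg : ∀ {r} (P : Poly r) x → evalAt (negᴾ P) x ≡ ℤ.- evalAt P x
evalAt-neg []            x = refl
evalAt-neg ((c , e) ∷ P) x rewrite evalAt-neg P x = neg-* c (monoAt e x) (evalAt P x)
  where
  neg-* : ∀ c m p → (ℤ.- c) ℤ.* m ℤ.+ (ℤ.- p) ≡ ℤ.- (c ℤ.* m ℤ.+ p)
  neg-* = solve-∀

coeff-++ : ∀ {r} (P Q : Poly r) m → coeff (P List.++ Q) m ≡ coeff P m ℤ.+ coeff Q m
coeff-++ []            Q m = sym (ℤₚ.+-identityˡ _)
coeff-++ ((c , e) ∷ P) Q m rewrite coeff-++ P Q m =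
  sym (ℤₚ.+-assoc (if monoEq e m then c else ℤ.0ℤ) _ _)

coeff-neg : ∀ {r} (P : Poly r) m → coeff (negᴾ P) m ≡ ℤ.- coeff P m
coeff-neg []            m = refl
coeff-neg ((c , e) ∷ P) m rewrite coeff-neg P m with monoEq e m
... | true  = sym (ℤₚ.neg-distrib-+ c (coeff P m))
... | false = sym (ℤₚ.neg-distrib-+ ℤ.0ℤ (coeff P m))

monoEq-suc : ∀ {r} (e f : Mono (suc r)) →
  monoEq e f ≡ (e Fin.zero ≡ᵇ f Fin.zero) ∧ monoEq (e ∘ Fin.suc) (f ∘ Fin.suc)
monoEq-suc e f = cong (λ bs → (e Fin.zero ≡ᵇ f Fin.zero) ∧ and bs)
  (trans (Listₚ.map-tabulate Fin.suc (λ i → e i ≡ᵇ f i))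
    (sym (Listₚ.map-tabulate id (λ i → e (Fin.suc i) ≡ᵇ f (Fin.suc i)))))

monoEq-congʳ : ∀ {r} (e : Mono r) {f g : Mono r} → f ≗ g → monoEq e f ≡ monoEq e g
monoEq-congʳ e eq = cong and (Listₚ.map-cong (λ i → cong (e i ≡ᵇ_) (eq i)) (allFin _))

coeff-cong : ∀ {r} (P : Poly r) {m m′ : Mono r} → m ≗ m′ → coeff P m ≡ coeff P m′
coeff-cong []            eq = refl
coeff-cong ((c , e) ∷ P) eq rewrite monoEq-congʳ e eq | coeff-cong P eq = refl

-- P = base P + X₀ · high P.
base : ∀ {r} → Poly (suc r) → Poly r
base []            = []
base ((c , e) ∷ P) with e Fin.zero
... | zero  = (c , e ∘ Fin.suc) ∷ base P
... | suc _ = base P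

high : ∀ {r} → Poly (suc r) → Poly (suc r)
high []            = []
high ((c , e) ∷ P) with e Fin.zero
... | zero  = high P
... | suc d = (c , d VF.∷ (e ∘ Fin.suc)) ∷ high P

evalAt-horner : ∀ {r} (P : Poly (suc r)) x →
  evalAt P x ≡ evalAt (base P) (x ∘ Fin.suc) ℤ.+ (+ x Fin.zero) ℤ.* evalAt (high P) x
evalAt-horner []            x = sym (trans (ℤₚ.+-identityˡ _) (ℤₚ.*-zeroʳ (+ x Fin.zero)))
evalAt-horner ((c , e) ∷ P) x with e Fin.zero
... | zero  rewrite evalAt-horner P x =
  rearrange c (monoAt (e ∘ Fin.suc) (x ∘ Fin.suc)) (evalAt (base P) (x ∘ Fin.suc)) (evalAt (high P) x) (+ x Fin.zero)
  where
  rearrange : ∀ c m b h t → c ℤ.* (ℤ.1ℤ ℤ.* m) ℤ.+ (b ℤ.+ t ℤ.* h) ≡ (c ℤ.* m ℤ.+ b) ℤ.+ t ℤ.* h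
  rearrange = solve-∀
... | suc d rewrite evalAt-horner P x =
  rearrange c (monoAt (e ∘ Fin.suc) (x ∘ Fin.suc)) (evalAt (base P) (x ∘ Fin.suc)) (evalAt (high P) x)
    (+ x Fin.zero) ((+ x Fin.zero) ℤ.^ d)
  where
  rearrange : ∀ c m b h t p → c ℤ.* ((t ℤ.* p) ℤ.* m) ℤ.+ (b ℤ.+ t ℤ.* h) ≡ b ℤ.+ t ℤ.* (c ℤ.* (p ℤ.* m) ℤ.+ h)
  rearrange = solve-∀

coeff-base : ∀ {r} (P : Poly (suc r)) (m : Mono r) → coeff P (0 VF.∷ m) ≡ coeff (base P) m
coeff-base []            m = refl
coeff-base ((c , e) ∷ P) m rewrite monoEq-suc e (0 VF.∷ m) | coeff-base P m with e Fin.zero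
... | zero  = refl
... | suc _ = ℤₚ.+-identityˡ _

coeff-high : ∀ {r} (P : Poly (suc r)) d (m : Mono r) → coeff P (suc d VF.∷ m) ≡ coeff (high P) (d VF.∷ m)
coeff-high []            d m = refl
coeff-high ((c , e) ∷ P) d m rewrite monoEq-suc e (suc d VF.∷ m) | coeff-high P d m with e Fin.zero
... | zero   = ℤₚ.+-identityˡ _
... | suc d′ rewrite monoEq-suc (d′ VF.∷ (e ∘ Fin.suc)) (d VF.∷ m) = refl

-- `high P` need not be a shorter list than `P`, so the recursion in `dichotomy` runs on a bound for
-- the exponents of the first variable.
DegreeBelow : ∀ {r} → ℕ → Poly (suc r) → Set
DegreeBelow D = All (λ t → proj₂ t Fin.zero < D)

degreeBelow-high : ∀ {r D} (P : Poly (suc r)) → DegreeBelow (suc D) P → DegreeBelow D (high P)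
degreeBelow-high []            []       = []
degreeBelow-high ((c , e) ∷ P) (lt ∷ h) with e Fin.zero | lt
... | zero  | _      = degreeBelow-high P h
... | suc d | s≤s lt′ = lt′ ∷ degreeBelow-high P h

degreeBound : ∀ {r} (P : Poly (suc r)) → Σ ℕ λ D → DegreeBelow D P
degreeBound []            = 0 , []
degreeBound ((c , e) ∷ P) with degreeBound P
... | D , h = suc (e Fin.zero) ℕ.⊔ D ,
  ℕₚ.m≤m⊔n _ D ∷ All.map (λ lt → ℕₚ.≤-trans lt (ℕₚ.m≤n⊔m (suc (e Fin.zero)) D)) h

-- "For all x_{r-1} large, for all x_{r-2} large enough depending on x_{r-1}, …": a filter
-- on points, so two nonzero polynomials are simultaneously nonzero somewhere.
Eventually : ∀ r → (Point r → Set) → Set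
Eventually zero    p = p (λ ())
Eventually (suc r) p = Eventually r (λ x → Σ ℕ λ B → ∀ t → B ≤ t → p (t VF.∷ x))

eventually-map : ∀ r {p q : Point r → Set} → (∀ x → p x → q x) → Eventually r p → Eventually r q
eventually-map zero    f h = f _ h
eventually-map (suc r) f h = eventually-map r (λ x → λ { (B , g) → B , λ t B≤t → f _ (g t B≤t) }) h

eventually-zip : ∀ r {p q s : Point r → Set} → (∀ x → p x → q x → s x) →
  Eventually r p → Eventually r q → Eventually r s
eventually-zip zero    f h h′ = f _ h h′
eventually-zip (suc r) f h h′ = eventually-zip r
  (λ x → λ { (B , g) (B′ , g′) → B ℕ.⊔ B′ , λ t le →
    f _ (g t (ℕₚ.m⊔n≤o⇒m≤o B B′ le)) (g′ t (ℕₚ.m⊔n≤o⇒n≤o B B′ le)) }) h h′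

eventually-point : ∀ r {p : Point r → Set} → Eventually r p → Σ (Point r) p
eventually-point zero    h = _ , h
eventually-point (suc r) h with eventually-point r h
... | x , B , g = _ , g B ℕₚ.≤-refl

-- Vanishing of coefficients and vanishing of values are settled together. The two components of
-- each case yield both implications between `≈ᴾ` and `≈ᴱ`, and the case distinction itself decides
-- whether a polynomial is zero.
data Dichotomy {r} (P : Poly r) : Set where
  vanishing    : (∀ m → coeff P m ≡ ℤ.0ℤ) → (∀ x → evalAt P x ≡ ℤ.0ℤ) → Dichotomy P
  nonvanishing : (m : Mono r) → coeff P m ≢ ℤ.0ℤ → Eventually r (λ x → evalAt P x ≢ ℤ.0ℤ) → Dichotomy P

-- A nonzero integer has absolute value at least 1, so `t * h` outweighs `c` as soon as `t` exceeds
-- the absolute value of `c`.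
horner-nonzero : ∀ (c h : ℤ) t → ℤ.∣ c ∣ < t → h ≢ ℤ.0ℤ → c ℤ.+ (+ t) ℤ.* h ≢ ℤ.0ℤ
horner-nonzero c h t lt h≢0 eq = ℕₚ.<⇒≱ lt (begin
  t                      ≡⟨ ℕₚ.*-identityʳ t ⟨
  t ℕ.* 1                ≤⟨ ℕₚ.*-monoʳ-≤ t (ℕₚ.n≢0⇒n>0 (h≢0 ∘ ℤₚ.∣i∣≡0⇒i≡0)) ⟩
  t ℕ.* ℤ.∣ h ∣          ≡⟨ ℤₚ.abs-* (+ t) h ⟨
  ℤ.∣ (+ t) ℤ.* h ∣      ≡⟨ ℤₚ.∣-i∣≡∣i∣ ((+ t) ℤ.* h) ⟨
  ℤ.∣ ℤ.- ((+ t) ℤ.* h) ∣ ≡⟨ cong ℤ.∣_∣ (isolate c ((+ t) ℤ.* h)) ⟨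
  ℤ.∣ c ℤ.- (c ℤ.+ (+ t) ℤ.* h) ∣ ≡⟨ cong (λ z → ℤ.∣ c ℤ.- z ∣) eq ⟩
  ℤ.∣ c ℤ.- ℤ.0ℤ ∣       ≡⟨ cong ℤ.∣_∣ (ℤₚ.+-identityʳ c) ⟩
  ℤ.∣ c ∣                ∎)
  where
  open ℕₚ.≤-Reasoning
  isolate : ∀ c z → c ℤ.- (c ℤ.+ z) ≡ ℤ.- z
  isolate = solve-∀

∷-η : ∀ {r} (m : Mono (suc r)) → m ≗ (m Fin.zero VF.∷ (m ∘ Fin.suc))
∷-η m Fin.zero    = refl
∷-η m (Fin.suc i) = refl

dichotomy-horner : ∀ {r} (P : Poly (suc r)) → Dichotomy (base P) → Dichotomy (high P) → Dichotomy P
dichotomy-horner {r} P db (nonvanishing m cm≢0 ev) =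
  nonvanishing (suc (m Fin.zero) VF.∷ (m ∘ Fin.suc))
    (λ eq → cm≢0 (trans (coeff-cong (high P) (∷-η m)) (trans (sym (coeff-high P _ _)) eq)))
    (eventually-map r (λ x → λ { (B , g) →
      -- The bound depends on the other coordinates through `base P`, which does not involve the
      -- first one. This dependence dictates the quantifier order in `Eventually`.
      suc ℤ.∣ evalAt (base P) x ∣ ℕ.⊔ B , λ t le eq →
        horner-nonzero (evalAt (base P) x) (evalAt (high P) (t VF.∷ x)) t
          (ℕₚ.m⊔n≤o⇒m≤o _ B le) (g t (ℕₚ.m⊔n≤o⇒n≤o (suc ℤ.∣ evalAt (base P) x ∣) B le))
          (trans (sym (evalAt-horner P (t VF.∷ x))) eq) }) ev)
dichotomy-horner {r} P db (vanishing hc he) = case db of λ where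
    (nonvanishing m cm≢0 ev) → nonvanishing (0 VF.∷ m) (λ eq → cm≢0 (trans (sym (coeff-base P m)) eq))
      (eventually-map r (λ x ≢0 → 0 , λ t _ eq → ≢0 (trans (sym (low (t VF.∷ x))) eq)) ev)
    (vanishing bc be) → vanishing
      (λ m → trans (coeff-cong P (∷-η m)) (zeroCoeff bc (m Fin.zero) (m ∘ Fin.suc)))
      (λ x → trans (low x) (be _))
  where
  low : ∀ x → evalAt P x ≡ evalAt (base P) (x ∘ Fin.suc)
  low x = trans (evalAt-horner P x)
    (trans (cong (λ z → evalAt (base P) (x ∘ Fin.suc) ℤ.+ (+ x Fin.zero) ℤ.* z) (he x))
      (trans (cong (λ z → evalAt (base P) (x ∘ Fin.suc) ℤ.+ z) (ℤₚ.*-zeroʳ (+ x Fin.zero))) (ℤₚ.+-identityʳ _)))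
  zeroCoeff : (∀ m → coeff (base P) m ≡ ℤ.0ℤ) → ∀ d m → coeff P (d VF.∷ m) ≡ ℤ.0ℤ
  zeroCoeff bc zero    m = trans (coeff-base P m) (bc m)
  zeroCoeff bc (suc d) m = trans (coeff-high P d m) (hc _)

dichotomy : ∀ {r} (P : Poly r) → Dichotomy P
dichotomy {zero} P = decide (evalAt P (λ ()) ℤ.≟ ℤ.0ℤ)
  where
  coeff≡evalAt : ∀ (P : Poly 0) m x → coeff P m ≡ evalAt P x
  coeff≡evalAt []            m x = refl
  coeff≡evalAt ((c , e) ∷ P) m x = cong₂ ℤ._+_ (sym (ℤₚ.*-identityʳ c)) (coeff≡evalAt P m x)
  decide : Dec (evalAt P (λ ()) ≡ ℤ.0ℤ) → Dichotomy P
  decide (yes eq) = vanishing (λ m → trans (coeff≡evalAt P m (λ ())) eq)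
    (λ x → trans (sym (coeff≡evalAt P (λ ()) x)) (trans (coeff≡evalAt P (λ ()) (λ ())) eq))
  decide (no ≢0) = nonvanishing (λ ()) (λ eq → ≢0 (trans (sym (coeff≡evalAt P (λ ()) (λ ()))) eq)) ≢0
dichotomy {suc r} P = bounded (proj₁ (degreeBound P)) P (proj₂ (degreeBound P))
  where
  bounded : ∀ D (P : Poly (suc r)) → DegreeBelow D P → Dichotomy P
  bounded zero    []      []        = vanishing (λ _ → refl) (λ _ → refl)
  bounded (suc D) P       h         =
    dichotomy-horner P (dichotomy (base P)) (bounded D (high P) (degreeBelow-high P h))

_≈ᴱ_ : ∀ {r} → Poly r → Poly r → Set
P ≈ᴱ Q = ∀ x → evalAt P x ≡ evalAt Q x

≈ᴱ0? : ∀ {r} (P : Poly r) → Dec (P ≈ᴱ 0ᴾ)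
≈ᴱ0? {r} P with dichotomy P
... | vanishing _ h       = yes h
... | nonvanishing _ _ ev with eventually-point r ev
...   | x , ≢0 = no (λ h → ≢0 (h x))

≈ᴱ0⇒≈ᴾ0 : ∀ {r} (P : Poly r) → P ≈ᴱ 0ᴾ → P ≈ᴾ 0ᴾ
≈ᴱ0⇒≈ᴾ0 {r} P h with dichotomy P
... | vanishing h′ _      = h′
... | nonvanishing _ _ ev with eventually-point r ev
...   | x , ≢0 = ⊥-elim (≢0 (h x))

≈ᴾ0⇒≈ᴱ0 : ∀ {r} (P : Poly r) → P ≈ᴾ 0ᴾ → P ≈ᴱ 0ᴾ
≈ᴾ0⇒≈ᴱ0 P h with dichotomy P
... | vanishing _ h′       = h′
... | nonvanishing m c≢0 _ = ⊥-elim (c≢0 (h m))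

≈ᴱ⇒≈ᴾ : ∀ {r} (P Q : Poly r) → P ≈ᴱ Q → P ≈ᴾ Q
≈ᴱ⇒≈ᴾ P Q h m = ℤₚ.i-j≡0⇒i≡j _ _ (trans
  (sym (trans (coeff-++ P (negᴾ Q) m) (cong (λ z → coeff P m ℤ.+ z) (coeff-neg Q m))))
  (≈ᴱ0⇒≈ᴾ0 (P List.++ negᴾ Q)
    (λ x → trans (evalAt-++ P (negᴾ Q) x)
      (trans (cong₂ ℤ._+_ (h x) (evalAt-neg Q x)) (ℤₚ.+-inverseʳ (evalAt Q x)))) m))

≈ᴾ⇒≈ᴱ : ∀ {r} (P Q : Poly r) → P ≈ᴾ Q → P ≈ᴱ Q
≈ᴾ⇒≈ᴱ P Q h x = ℤₚ.i-j≡0⇒i≡j _ _ (trans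
  (sym (trans (evalAt-++ P (negᴾ Q) x) (cong (λ z → evalAt P x ℤ.+ z) (evalAt-neg Q x))))
  (≈ᴾ0⇒≈ᴱ0 (P List.++ negᴾ Q)
    (λ m → trans (coeff-++ P (negᴾ Q) m)
      (trans (cong₂ ℤ._+_ (h m) (coeff-neg Q m)) (ℤₚ.+-inverseʳ (coeff Q m)))) x))

*ᴾ-nonzero : ∀ {r} (P Q : Poly r) → ¬ P ≈ᴱ 0ᴾ → ¬ Q ≈ᴱ 0ᴾ → ¬ (P *ᴾ Q) ≈ᴱ 0ᴾ
*ᴾ-nonzero {r} P Q P≉0 Q≉0 h with dichotomy P | dichotomy Q
... | vanishing _ P≈0      | _                     = P≉0 P≈0
... | nonvanishing _ _ _   | vanishing _ Q≈0       = Q≉0 Q≈0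
... | nonvanishing _ _ evP | nonvanishing _ _ evQ with eventually-point r (eventually-zip r (λ x → _,_) evP evQ)
...   | x , P≢0 , Q≢0 with ℤₚ.i*j≡0⇒i≡0∨j≡0 (evalAt P x) (trans (sym (evalAt-*ᴾ P Q x)) (h x))
...     | inj₁ eq = P≢0 eq
...     | inj₂ eq = Q≢0 eq

-- C-finite sequences

-- The monoid is left open because the same regrouping of assignments is applied twice: in ℤ under
-- addition for the generating polynomials, and in the Booleans under disjunction for the sets of
-- types.
module ListSum (M : CommutativeMonoid 0ℓ 0ℓ) where
  open CommutativeMonoid M renaming (refl to ≈-refl; sym to ≈-sym; trans to ≈-trans)
  open import Relation.Binary.Reasoning.Setoid setoid

  ∑ : {A : Set} → List A → (A → Carrier) → Carrier
  ∑ []       f = ε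
  ∑ (x ∷ xs) f = f x ∙ ∑ xs f

  module _ {A : Set} where

    ∑-cong-∈ : (xs : List A) {f g : A → Carrier} → (∀ {x} → x ∈ xs → f x ≈ g x) → ∑ xs f ≈ ∑ xs g
    ∑-cong-∈ []       eq = ≈-refl
    ∑-cong-∈ (x ∷ xs) eq = ∙-cong (eq (here refl)) (∑-cong-∈ xs (eq ∘ there))

    ∑-cong : (xs : List A) {f g : A → Carrier} → (∀ x → f x ≈ g x) → ∑ xs f ≈ ∑ xs g
    ∑-cong xs eq = ∑-cong-∈ xs (λ {x} _ → eq x)

    ∑-ε : (xs : List A) → ∑ xs (λ _ → ε) ≈ ε
    ∑-ε []       = ≈-refl
    ∑-ε (x ∷ xs) = ≈-trans (identityˡ _) (∑-ε xs)

    interchange : ∀ a b c d → (a ∙ b) ∙ (c ∙ d) ≈ (a ∙ c) ∙ (b ∙ d)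
    interchange a b c d = begin
      (a ∙ b) ∙ (c ∙ d) ≈⟨ assoc a b (c ∙ d) ⟩
      a ∙ (b ∙ (c ∙ d)) ≈⟨ ∙-congˡ (assoc b c d) ⟨
      a ∙ ((b ∙ c) ∙ d) ≈⟨ ∙-congˡ (∙-congʳ (comm b c)) ⟩
      a ∙ ((c ∙ b) ∙ d) ≈⟨ ∙-congˡ (assoc c b d) ⟩
      a ∙ (c ∙ (b ∙ d)) ≈⟨ assoc a c (b ∙ d) ⟨
      (a ∙ c) ∙ (b ∙ d) ∎

    ∑-∙ : (xs : List A) (f g : A → Carrier) → ∑ xs (λ x → f x ∙ g x) ≈ ∑ xs f ∙ ∑ xs g
    ∑-∙ []       f g = ≈-sym (identityˡ ε)
    ∑-∙ (x ∷ xs) f g = ≈-trans (∙-congˡ (∑-∙ xs f g)) (interchange (f x) (g x) (∑ xs f) (∑ xs g))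

    ∑-++ : (xs ys : List A) (f : A → Carrier) → ∑ (xs List.++ ys) f ≈ ∑ xs f ∙ ∑ ys f
    ∑-++ []       ys f = ≈-sym (identityˡ _)
    ∑-++ (x ∷ xs) ys f = ≈-trans (∙-congˡ (∑-++ xs ys f)) (≈-sym (assoc _ _ _))

  ∑-map : {A B : Set} (h : A → B) (xs : List A) (f : B → Carrier) → ∑ (List.map h xs) f ≡ ∑ xs (f ∘ h)
  ∑-map h []       f = refl
  ∑-map h (x ∷ xs) f = cong (f (h x) ∙_) (∑-map h xs f)

  ∑-concatMap : {A B : Set} (h : A → List B) (xs : List A) (f : B → Carrier) →
    ∑ (concatMap h xs) f ≈ ∑ xs (λ x → ∑ (h x) f)
  ∑-concatMap h []       f = ≈-refl
  ∑-concatMap h (x ∷ xs) f = ≈-trans (∑-++ (h x) (concatMap h xs) f) (∙-congˡ (∑-concatMap h xs f))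

  ∑-cartesianProduct : {A B : Set} (xs : List A) (ys : List B) (f : A × B → Carrier) →
    ∑ (cartesianProduct xs ys) f ≈ ∑ xs (λ x → ∑ ys (λ y → f (x , y)))
  ∑-cartesianProduct []       ys f = ≈-refl
  ∑-cartesianProduct (x ∷ xs) ys f = ≈-trans (∑-++ (List.map (x ,_) ys) _ f)
    (∙-cong (reflexive (∑-map (x ,_) ys f)) (∑-cartesianProduct xs ys f))

  ∑-swap : {A B : Set} (xs : List A) (ys : List B) (f : A → B → Carrier) →
    ∑ xs (λ x → ∑ ys (f x)) ≈ ∑ ys (λ y → ∑ xs (λ x → f x y))
  ∑-swap []       ys f = ≈-sym (∑-ε ys)
  ∑-swap (x ∷ xs) ys f = ≈-trans (∙-congˡ (∑-swap xs ys f)) (≈-sym (∑-∙ ys (f x) _))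

open ListSum ℤₚ.+-0-commutativeMonoid public

module _ {A : Set} where

  ∑-*ˡ : (c : ℤ) (xs : List A) (f : A → ℤ) → c ℤ.* ∑ xs f ≡ ∑ xs (λ x → c ℤ.* f x)
  ∑-*ˡ c []       f = ℤₚ.*-zeroʳ c
  ∑-*ˡ c (x ∷ xs) f = trans (ℤₚ.*-distribˡ-+ c (f x) _) (cong (λ z → c ℤ.* f x ℤ.+ z) (∑-*ˡ c xs f))

  ∑-*ʳ : (c : ℤ) (xs : List A) (f : A → ℤ) → ∑ xs f ℤ.* c ≡ ∑ xs (λ x → f x ℤ.* c)
  ∑-*ʳ c xs f = trans (ℤₚ.*-comm _ c) (trans (∑-*ˡ c xs f) (∑-cong xs (λ x → ℤₚ.*-comm c (f x))))

∑-product : {A B : Set} (xs : List A) (ys : List B) (f : A → ℤ) (g : B → ℤ) →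
  ∑ (cartesianProduct xs ys) (λ p → f (proj₁ p) ℤ.* g (proj₂ p)) ≡ ∑ xs f ℤ.* ∑ ys g
∑-product xs ys f g = trans (∑-cartesianProduct xs ys _)
  (trans (∑-cong xs (λ x → sym (∑-*ˡ (f x) ys g))) (sym (∑-*ʳ (∑ ys g) xs f)))

+-zeroʳ : ∀ a {b} → b ≡ ℤ.0ℤ → a ℤ.+ b ≡ a
+-zeroʳ a refl = ℤₚ.+-identityʳ a

+-zeroˡ : ∀ {a} b → a ≡ ℤ.0ℤ → a ℤ.+ b ≡ b
+-zeroˡ b refl = ℤₚ.+-identityˡ b

∑< : ℕ → (ℕ → ℤ) → ℤ
∑< zero    f = ℤ.0ℤ
∑< (suc n) f = ∑< n f ℤ.+ f n

∑<-cong : ∀ n {f g : ℕ → ℤ} → (∀ j → j < n → f j ≡ g j) → ∑< n f ≡ ∑< n g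
∑<-cong zero    eq = refl
∑<-cong (suc n) eq = cong₂ ℤ._+_ (∑<-cong n (λ j lt → eq j (ℕₚ.m<n⇒m<1+n lt))) (eq n ℕₚ.≤-refl)

∑<-0 : ∀ n {f : ℕ → ℤ} → (∀ j → j < n → f j ≡ ℤ.0ℤ) → ∑< n f ≡ ℤ.0ℤ
∑<-0 zero    eq = refl
∑<-0 (suc n) eq = cong₂ ℤ._+_ (∑<-0 n (λ j lt → eq j (ℕₚ.m<n⇒m<1+n lt))) (eq n ℕₚ.≤-refl)

∑<-front : ∀ n (f : ℕ → ℤ) → ∑< (suc n) f ≡ f 0 ℤ.+ ∑< n (f ∘ suc)
∑<-front zero    f = ℤₚ.+-comm ℤ.0ℤ (f 0)
∑<-front (suc n) f = trans (cong (λ z → z ℤ.+ f (suc n)) (∑<-front n f)) (ℤₚ.+-assoc (f 0) _ _)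

∑<-+ : ∀ n (f g : ℕ → ℤ) → ∑< n (λ j → f j ℤ.+ g j) ≡ ∑< n f ℤ.+ ∑< n g
∑<-+ zero    f g = refl
∑<-+ (suc n) f g rewrite ∑<-+ n f g = rearrange (∑< n f) (∑< n g) (f n) (g n)
  where
  rearrange : ∀ a b c d → (a ℤ.+ b) ℤ.+ (c ℤ.+ d) ≡ (a ℤ.+ c) ℤ.+ (b ℤ.+ d)
  rearrange = solve-∀

∑<-*ˡ : ∀ c n (f : ℕ → ℤ) → c ℤ.* ∑< n f ≡ ∑< n (λ j → c ℤ.* f j)
∑<-*ˡ c zero    f = ℤₚ.*-zeroʳ c
∑<-*ˡ c (suc n) f = trans (ℤₚ.*-distribˡ-+ c (∑< n f) (f n)) (cong (λ z → z ℤ.+ c ℤ.* f n) (∑<-*ˡ c n f))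

∑<-∑-swap : {A : Set} (n : ℕ) (xs : List A) (f : ℕ → A → ℤ) →
  ∑< n (λ j → ∑ xs (f j)) ≡ ∑ xs (λ x → ∑< n (λ j → f j x))
∑<-∑-swap zero    xs f = sym (∑-ε xs)
∑<-∑-swap (suc n) xs f = trans (cong (λ z → z ℤ.+ ∑ xs (f n)) (∑<-∑-swap n xs f))
  (sym (∑-∙ xs (λ x → ∑< n (λ j → f j x)) (f n)))

∑<-≤ : ∀ {m n} (f : ℕ → ℤ) → m ≤ n → (∀ j → m ≤ j → f j ≡ ℤ.0ℤ) → ∑< n f ≡ ∑< m f
∑<-≤ {m} {zero}  f z≤n zeros = refl
∑<-≤ {m} {suc n} f le  zeros with ℕₚ.m≤n⇒m<n∨m≡n le
... | inj₁ (s≤s m≤n) = trans (cong₂ ℤ._+_ (∑<-≤ f m≤n zeros) (zeros n m≤n)) (ℤₚ.+-identityʳ _)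
... | inj₂ refl      = refl

open import Algebra.Properties.CommutativeMonoid.Sum ℤₚ.+-0-commutativeMonoid using (sum; sum-remove; sum-cong-≗; ∑-distrib-+)

sum-*ˡ : ∀ {n} (c : ℤ) (f : Fin n → ℤ) → c ℤ.* sum f ≡ sum (λ i → c ℤ.* f i)
sum-*ˡ {zero}  c f = ℤₚ.*-zeroʳ c
sum-*ˡ {suc n} c f = trans (ℤₚ.*-distribˡ-+ c (f Fin.zero) _)
  (cong (λ z → c ℤ.* f Fin.zero ℤ.+ z) (sum-*ˡ c (f ∘ Fin.suc)))

sum-toℕ : ∀ n (f : ℕ → ℤ) → sum {n} (f ∘ toℕ) ≡ ∑< n f
sum-toℕ zero    f = refl
sum-toℕ (suc n) f = trans (cong (λ z → f 0 ℤ.+ z) (sum-toℕ n (f ∘ suc))) (sym (∑<-front n f))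

sum-0 : ∀ {n} (f : Fin n → ℤ) → (∀ i → f i ≡ ℤ.0ℤ) → sum f ≡ ℤ.0ℤ
sum-0 {zero}  f eq = refl
sum-0 {suc n} f eq = cong₂ ℤ._+_ (eq Fin.zero) (sum-0 (f ∘ Fin.suc) (eq ∘ Fin.suc))

module CFiniteSequences (r : ℕ) where

  D : Set
  D = Poly r

  ⟦_⟧ : D → Point r → ℤ
  ⟦_⟧ = evalAt

  Zero : D → Set
  Zero P = P ≈ᴱ 0ᴾ

  ∑ᴾ : {A : Set} → List A → (A → D) → D
  ∑ᴾ xs f = concatMap f xs

  ⟦∑ᴾ⟧ : {A : Set} (xs : List A) (f : A → D) → ∀ x → ⟦ ∑ᴾ xs f ⟧ x ≡ ∑ xs (λ i → ⟦ f i ⟧ x)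
  ⟦∑ᴾ⟧ []       f x = refl
  ⟦∑ᴾ⟧ (i ∷ is) f x = trans (evalAt-++ (f i) _ x) (cong (λ z → ⟦ f i ⟧ x ℤ.+ z) (⟦∑ᴾ⟧ is f x))

  ∑ᴾ< : ℕ → (ℕ → D) → D
  ∑ᴾ< zero    f = 0ᴾ
  ∑ᴾ< (suc n) f = ∑ᴾ< n f +ᴾ f n

  ⟦∑ᴾ<⟧ : ∀ n (f : ℕ → D) x → ⟦ ∑ᴾ< n f ⟧ x ≡ ∑< n (λ i → ⟦ f i ⟧ x)
  ⟦∑ᴾ<⟧ zero    f x = refl
  ⟦∑ᴾ<⟧ (suc n) f x = trans (evalAt-++ (∑ᴾ< n f) (f n) x) (cong (λ z → z ℤ.+ ⟦ f n ⟧ x) (⟦∑ᴾ<⟧ n f x))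

  Seq : Set
  Seq = ℕ → D

  -- C-finite sequences, presented by a linear system whose coordinates are indexed by the list is.
  record Recognisable (a : Seq) : Set₁ where
    field
      {I}    : Set
      is     : List I
      matrix : I → I → D
      out    : I → D
      state  : ℕ → I → D
      step   : ∀ n i x → ⟦ state (suc n) i ⟧ x ≡ ∑ is (λ j → ⟦ matrix i j ⟧ x ℤ.* ⟦ state n j ⟧ x)
      output : ∀ n x → ⟦ a n ⟧ x ≡ ∑ is (λ i → ⟦ out i ⟧ x ℤ.* ⟦ state n i ⟧ x)

  recognisable-≈ : ∀ {a b} → (∀ n → b n ≈ᴱ a n) → Recognisable a → Recognisable b
  recognisable-≈ eq R = record
    { is = is ; matrix = matrix ; out = out ; state = state ; step = step
    ; output = λ n x → trans (eq n x) (output n x) }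
    where open Recognisable R

  recognisable-const : ∀ P → Recognisable (λ _ → P)
  recognisable-const P = record
    { is = tt ∷ [] ; matrix = λ _ _ → 1ᴾ ; out = λ _ → P ; state = λ _ _ → 1ᴾ
    ; step = λ n i x → trans (evalAt-1 x) (sym (trans (ℤₚ.+-identityʳ _) (cong₂ ℤ._*_ (evalAt-1 x) (evalAt-1 x))))
    ; output = λ n x → sym (trans (ℤₚ.+-identityʳ _) (trans (cong (λ z → ⟦ P ⟧ x ℤ.* z) (evalAt-1 x)) (ℤₚ.*-identityʳ _))) }

  recognisable-shift : ∀ {a} → Recognisable a → Recognisable (a ∘ suc)
  recognisable-shift R = record
    { is = is ; matrix = matrix ; out = out ; state = state ∘ suc ; step = step ∘ suc
    ; output = output ∘ suc }
    where open Recognisable R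

  recognisable-shiftBy : ∀ k {a} → Recognisable a → Recognisable (λ n → a (k ℕ.+ n))
  recognisable-shiftBy zero    R = R
  recognisable-shiftBy (suc k) R = recognisable-shiftBy k (recognisable-shift R)

  recognisable-+ : ∀ {a b} → Recognisable a → Recognisable b → Recognisable (λ n → a n +ᴾ b n)
  recognisable-+ {a} {b} R S = record
    { I = R.I ⊎ S.I ; is = both ; matrix = mat ; out = [ R.out , S.out ]
    ; state = st ; step = stp
    ; output = λ n x → trans (evalAt-++ (a n) (b n) x) (trans (cong₂ ℤ._+_ (R.output n x) (S.output n x)) (sym (∑-both _))) }
    where
    module R = Recognisable R
    module S = Recognisable S
    both : List (R.I ⊎ S.I)
    both = List.map inj₁ R.is List.++ List.map inj₂ S.is
    mat : R.I ⊎ S.I → R.I ⊎ S.I → D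
    mat (inj₁ i) (inj₁ j) = R.matrix i j
    mat (inj₂ i) (inj₂ j) = S.matrix i j
    mat _        _        = 0ᴾ
    st : ℕ → R.I ⊎ S.I → D
    st n = [ R.state n , S.state n ]
    ∑-both : (f : R.I ⊎ S.I → ℤ) → ∑ both f ≡ ∑ R.is (f ∘ inj₁) ℤ.+ ∑ S.is (f ∘ inj₂)
    ∑-both f = trans (∑-++ (List.map inj₁ R.is) _ f) (cong₂ ℤ._+_ (∑-map inj₁ R.is f) (∑-map inj₂ S.is f))
    stp : ∀ n i x → ⟦ st (suc n) i ⟧ x ≡ ∑ both (λ j → ⟦ mat i j ⟧ x ℤ.* ⟦ st n j ⟧ x)
    stp n (inj₁ i) x = trans (R.step n i x) (sym (trans (∑-both _) (+-zeroʳ _ (∑-ε S.is))))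
    stp n (inj₂ i) x = trans (S.step n i x) (sym (trans (∑-both _) (+-zeroˡ _ (∑-ε R.is))))

  private
    *-interchange : ∀ a b c d → (a ℤ.* b) ℤ.* (c ℤ.* d) ≡ (a ℤ.* c) ℤ.* (b ℤ.* d)
    *-interchange = solve-∀

  -- Tensor product of the two systems: states are products of states, and the matrix is the
  -- Kronecker product.
  recognisable-* : ∀ {a b} → Recognisable a → Recognisable b → Recognisable (λ n → a n *ᴾ b n)
  recognisable-* {a} {b} R S = record
    { is = cartesianProduct R.is S.is
    ; matrix = λ i j → R.matrix (proj₁ i) (proj₁ j) *ᴾ S.matrix (proj₂ i) (proj₂ j)
    ; out = λ i → R.out (proj₁ i) *ᴾ S.out (proj₂ i)
    ; state = λ n i → R.state n (proj₁ i) *ᴾ S.state n (proj₂ i)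
    ; step = λ n i x → trans (evalAt-*ᴾ (R.state (suc n) (proj₁ i)) (S.state (suc n) (proj₂ i)) x)
        (trans (cong₂ ℤ._*_ (R.step n (proj₁ i) x) (S.step n (proj₂ i) x))
          (tensor (R.matrix (proj₁ i)) (S.matrix (proj₂ i)) (R.state n) (S.state n) x))
    ; output = λ n x → trans (evalAt-*ᴾ (a n) (b n) x)
        (trans (cong₂ ℤ._*_ (R.output n x) (S.output n x)) (tensor R.out S.out (R.state n) (S.state n) x)) }
    where
    module R = Recognisable R
    module S = Recognisable S
    tensor : (f : R.I → D) (g : S.I → D) (u : R.I → D) (v : S.I → D) → ∀ x →
      ∑ R.is (λ i → ⟦ f i ⟧ x ℤ.* ⟦ u i ⟧ x) ℤ.* ∑ S.is (λ i → ⟦ g i ⟧ x ℤ.* ⟦ v i ⟧ x) ≡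
      ∑ (cartesianProduct R.is S.is)
        (λ p → ⟦ f (proj₁ p) *ᴾ g (proj₂ p) ⟧ x ℤ.* ⟦ u (proj₁ p) *ᴾ v (proj₂ p) ⟧ x)
    tensor f g u v x = sym (trans
      (∑-cong (cartesianProduct R.is S.is) (λ p → trans
        (cong₂ ℤ._*_ (evalAt-*ᴾ (f (proj₁ p)) (g (proj₂ p)) x) (evalAt-*ᴾ (u (proj₁ p)) (v (proj₂ p)) x))
        (*-interchange (⟦ f (proj₁ p) ⟧ x) (⟦ g (proj₂ p) ⟧ x) (⟦ u (proj₁ p) ⟧ x) (⟦ v (proj₂ p) ⟧ x))))
      (∑-product R.is S.is (λ i → ⟦ f i ⟧ x ℤ.* ⟦ u i ⟧ x) (λ i → ⟦ g i ⟧ x ℤ.* ⟦ v i ⟧ x)))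

  recognisable-neg : ∀ {a} → Recognisable a → Recognisable (λ n → negᴾ (a n))
  recognisable-neg {a} R = recognisable-≈ eq (recognisable-* (recognisable-const (negᴾ 1ᴾ)) R)
    where
    eq : ∀ n → negᴾ (a n) ≈ᴱ (negᴾ 1ᴾ *ᴾ a n)
    eq n x = trans (evalAt-neg (a n) x) (sym (trans (evalAt-*ᴾ (negᴾ 1ᴾ) (a n) x)
      (trans (cong (λ z → z ℤ.* ⟦ a n ⟧ x) (trans (evalAt-neg 1ᴾ x) (cong ℤ.-_ (evalAt-1 x)))) (ℤₚ.-1*i≡-i (⟦ a n ⟧ x)))))

  recognisable-∑ : {A : Set} (xs : List A) {a : A → Seq} → (∀ i → Recognisable (a i)) →
    Recognisable (λ n → ∑ᴾ xs (λ i → a i n))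
  recognisable-∑ []       R = recognisable-const 0ᴾ
  recognisable-∑ (i ∷ is) R = recognisable-+ (R i) (recognisable-∑ is R)

  recognisable-∑< : ∀ k {a : ℕ → Seq} → (∀ i → Recognisable (a i)) → Recognisable (λ n → ∑ᴾ< k (λ i → a i n))
  recognisable-∑< zero    R = recognisable-const 0ᴾ
  recognisable-∑< (suc k) R = recognisable-+ (recognisable-∑< k R) (R k)

  1≉0 : ¬ Zero 1ᴾ
  1≉0 h = case trans (sym (evalAt-1 {r} (λ _ → 0))) (h (λ _ → 0)) of λ ()

  ⟦neg-*⟧ : ∀ P Q x → ⟦ negᴾ (P *ᴾ Q) ⟧ x ≡ ℤ.- (⟦ P ⟧ x ℤ.* ⟦ Q ⟧ x)
  ⟦neg-*⟧ P Q x = trans (evalAt-neg (P *ᴾ Q) x) (cong ℤ.-_ (evalAt-*ᴾ P Q x))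

  nonzero-product : ∀ P Q → Zero (P *ᴾ Q) → ¬ Zero P → Zero Q
  nonzero-product P Q PQ≈0 P≉0 with ≈ᴱ0? Q
  ... | yes Q≈0 = Q≈0
  ... | no  Q≉0 = ⊥-elim (*ᴾ-nonzero P Q P≉0 Q≉0 PQ≈0)

  -- Linear dependence over ℤ[X] and annihilating recurrences

  record Dependence {I : Set} (is : List I) {n} (g : Fin n → I → D) : Set where
    constructor dependence
    field
      c        : Fin n → D
      index    : Fin n
      nonzero  : ¬ Zero (c index)
      relation : ∀ {i} → i ∈ is → ∀ x → sum (λ j → ⟦ c j ⟧ x ℤ.* ⟦ g j i ⟧ x) ≡ ℤ.0ℤ

  -- Fraction-free Gaussian elimination, one coordinate at a time. A vector whose entry in
  -- coordinate `i` is nonzero clears that coordinate from the others by cross-multiplication,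
  -- leaving one vector and one coordinate fewer. Coefficients are wanted only up to a common
  -- factor, so no quotient arises.
  linearDependence : {I : Set} (is : List I) (g : Fin (suc (length is)) → I → D) → Dependence is g
  linearDependence []       g = dependence (λ _ → 1ᴾ) Fin.zero 1≉0 λ ()
  linearDependence {I} (i ∷ is) g with Finₚ.all? (λ j → ≈ᴱ0? (g j i))
  ... | yes zeros = dependence c (Fin.suc index) nonzero rel
    where
    open Dependence (linearDependence is (g ∘ Fin.suc)) renaming (c to c₀)
    -- Coordinate `i` imposes no condition, so a dependence among all vectors but the first suffices
    -- and the first gets coefficient zero.
    c : Fin (suc (suc (length is))) → D
    c = 0ᴾ VF.∷ c₀
    rel : ∀ {k} → k ∈ i ∷ is → ∀ x → sum (λ j → ⟦ c j ⟧ x ℤ.* ⟦ g j k ⟧ x) ≡ ℤ.0ℤ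
    rel (here refl) x = sum-0 _ (λ j → trans (cong (λ z → ⟦ c j ⟧ x ℤ.* z) (zeros j x)) (ℤₚ.*-zeroʳ (⟦ c j ⟧ x)))
    rel (there k∈)  x = trans (ℤₚ.+-identityˡ _) (relation k∈ x)
  ... | no ¬zeros with Finₚ.¬∀⟶∃¬ _ (λ j → Zero (g j i)) (λ j → ≈ᴱ0? (g j i)) ¬zeros
  ...   | p , gp≉0 = dependence c (Fin.punchIn p index)
          (λ z → nonzero (nonzero-product (g p i) (c₀ index) (subst Zero (c-other index) z) gp≉0)) rel
    where
    others : Fin (suc (length is)) → I → D
    others j = g (Fin.punchIn p j)
    reduced : Fin (suc (length is)) → I → D
    reduced j k = (g p i *ᴾ others j k) +ᴾ negᴾ (others j i *ᴾ g p k)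
    open Dependence (linearDependence is reduced) renaming (c to c₀)
    size : ℕ
    size = suc (length is)
    -- Substituting the definition of `reduced` into the relation with coefficients `c₀` collects
    -- this factor at the pivot vector and `g p i *ᴾ c₀ j` at the others.
    cp : D
    cp = ∑ᴾ (allFin size) (λ j → negᴾ (c₀ j *ᴾ others j i))
    c : Fin (suc size) → D
    c = VF.insertAt (λ j → g p i *ᴾ c₀ j) p cp
    c-pivot : c p ≡ cp
    c-pivot = VFₚ.insertAt-lookup (λ j → g p i *ᴾ c₀ j) p cp
    c-other : ∀ j → c (Fin.punchIn p j) ≡ g p i *ᴾ c₀ j
    c-other = VFₚ.insertAt-punchIn (λ j → g p i *ᴾ c₀ j) p cp
    ∑-allFin : ∀ n (f : Fin n → ℤ) → ∑ (allFin n) f ≡ sum f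
    ∑-allFin n f = go n id
      where
      go : ∀ k (h : Fin k → Fin n) → ∑ (List.tabulate h) f ≡ sum (f ∘ h)
      go zero    h = refl
      go (suc k) h = cong (λ z → f (h Fin.zero) ℤ.+ z) (go k (h ∘ Fin.suc))
    expand : ∀ k x → sum (λ j → ⟦ c j ⟧ x ℤ.* ⟦ g j k ⟧ x) ≡
      sum (λ j → ⟦ c₀ j ⟧ x ℤ.* (⟦ g p i ⟧ x ℤ.* ⟦ others j k ⟧ x ℤ.+ ℤ.- (⟦ others j i ⟧ x ℤ.* ⟦ g p k ⟧ x)))
    expand k x = begin
      sum (λ j → ⟦ c j ⟧ x ℤ.* ⟦ g j k ⟧ x)
        ≡⟨ sum-remove {i = p} (λ j → ⟦ c j ⟧ x ℤ.* ⟦ g j k ⟧ x) ⟩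
      ⟦ c p ⟧ x ℤ.* ⟦ g p k ⟧ x ℤ.+ sum (λ j → ⟦ c (Fin.punchIn p j) ⟧ x ℤ.* ⟦ others j k ⟧ x)
        ≡⟨ cong₂ ℤ._+_ pivotTerm (sum-cong-≗ (λ j → trans
             (cong (λ z → ⟦ z ⟧ x ℤ.* ⟦ others j k ⟧ x) (c-other j))
             (cong (λ z → z ℤ.* ⟦ others j k ⟧ x) (evalAt-*ᴾ (g p i) (c₀ j) x)))) ⟩
      sum (λ j → ⟦ g p k ⟧ x ℤ.* ℤ.- (⟦ c₀ j ⟧ x ℤ.* ⟦ others j i ⟧ x)) ℤ.+
        sum (λ j → (⟦ g p i ⟧ x ℤ.* ⟦ c₀ j ⟧ x) ℤ.* ⟦ others j k ⟧ x)
        ≡⟨ ∑-distrib-+ (λ j → ⟦ g p k ⟧ x ℤ.* ℤ.- (⟦ c₀ j ⟧ x ℤ.* ⟦ others j i ⟧ x))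
             (λ j → (⟦ g p i ⟧ x ℤ.* ⟦ c₀ j ⟧ x) ℤ.* ⟦ others j k ⟧ x) ⟨
      sum (λ j → ⟦ g p k ⟧ x ℤ.* ℤ.- (⟦ c₀ j ⟧ x ℤ.* ⟦ others j i ⟧ x) ℤ.+
                 (⟦ g p i ⟧ x ℤ.* ⟦ c₀ j ⟧ x) ℤ.* ⟦ others j k ⟧ x)
        ≡⟨ sum-cong-≗ (λ j → rearrange (⟦ g p k ⟧ x) (⟦ c₀ j ⟧ x) (⟦ others j i ⟧ x) (⟦ g p i ⟧ x) (⟦ others j k ⟧ x)) ⟩
      _ ∎
      where
      open ≡-Reasoning
      rearrange : ∀ a c o b q → a ℤ.* ℤ.- (c ℤ.* o) ℤ.+ (b ℤ.* c) ℤ.* q ≡ c ℤ.* (b ℤ.* q ℤ.+ ℤ.- (o ℤ.* a))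
      rearrange = solve-∀
      pivotTerm : ⟦ c p ⟧ x ℤ.* ⟦ g p k ⟧ x ≡ sum (λ j → ⟦ g p k ⟧ x ℤ.* ℤ.- (⟦ c₀ j ⟧ x ℤ.* ⟦ others j i ⟧ x))
      pivotTerm = begin
        ⟦ c p ⟧ x ℤ.* ⟦ g p k ⟧ x  ≡⟨ cong (λ z → ⟦ z ⟧ x ℤ.* ⟦ g p k ⟧ x) c-pivot ⟩
        ⟦ cp ⟧ x ℤ.* ⟦ g p k ⟧ x   ≡⟨ ℤₚ.*-comm (⟦ cp ⟧ x) _ ⟩
        ⟦ g p k ⟧ x ℤ.* ⟦ cp ⟧ x   ≡⟨ cong (λ z → ⟦ g p k ⟧ x ℤ.* z)
          (trans (⟦∑ᴾ⟧ (allFin size) (λ j → negᴾ (c₀ j *ᴾ others j i)) x)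
            (trans (∑-allFin size (λ j → ⟦ negᴾ (c₀ j *ᴾ others j i) ⟧ x))
              (sum-cong-≗ (λ j → ⟦neg-*⟧ (c₀ j) (others j i) x)))) ⟩
        ⟦ g p k ⟧ x ℤ.* sum (λ j → ℤ.- (⟦ c₀ j ⟧ x ℤ.* ⟦ others j i ⟧ x)) ≡⟨ sum-*ˡ (⟦ g p k ⟧ x) (λ j → ℤ.- (⟦ c₀ j ⟧ x ℤ.* ⟦ others j i ⟧ x)) ⟩
        _ ∎
    rel : ∀ {k} → k ∈ i ∷ is → ∀ x → sum (λ j → ⟦ c j ⟧ x ℤ.* ⟦ g j k ⟧ x) ≡ ℤ.0ℤ
    -- In coordinate `i` each reduced vector is identically zero.
    rel (here refl) x = trans (expand i x) (sum-0 _ (λ j → cancel (⟦ c₀ j ⟧ x) (⟦ g p i ⟧ x) (⟦ others j i ⟧ x)))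
      where
      cancel : ∀ c b o → c ℤ.* (b ℤ.* o ℤ.+ ℤ.- (o ℤ.* b)) ≡ ℤ.0ℤ
      cancel = solve-∀
    rel {k} (there k∈)  x = trans (expand k x) (trans (sum-cong-≗ (λ j → cong (λ z → ⟦ c₀ j ⟧ x ℤ.* z)
      (sym (trans (evalAt-++ (g p i *ᴾ others j k) (negᴾ (others j i *ᴾ g p k)) x)
        (cong₂ ℤ._+_ (evalAt-*ᴾ (g p i) (others j k) x) (⟦neg-*⟧ (others j i) (g p k) x)))))) (relation k∈ x))

  extend : ∀ {n} → (Fin n → D) → ℕ → D
  extend {zero}  c j       = 0ᴾ
  extend {suc n} c zero    = c Fin.zero
  extend {suc n} c (suc j) = extend (c ∘ Fin.suc) j

  extend-toℕ : ∀ {n} (c : Fin n → D) i → extend c (toℕ i) ≡ c i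
  extend-toℕ c Fin.zero    = refl
  extend-toℕ c (Fin.suc i) = extend-toℕ (c ∘ Fin.suc) i

  Annihilates : Seq → ℕ → (ℕ → D) → Set
  Annihilates a s c = ∀ n x → ∑< (suc s) (λ j → ⟦ c j ⟧ x ℤ.* ⟦ a (n ℕ.+ j) ⟧ x) ≡ ℤ.0ℤ

  -- The row `out` times the `j`-th power of `matrix` expresses `a (n + j)` through the state at
  -- `n`. There is one more such row than there are coordinates, so the rows for `j` up to
  -- `length is` are dependent, and a dependence annihilates `a`. Its top coefficient may be zero;
  -- hence the position of a nonzero one is returned and trimming follows.
  recognisable-annihilated : ∀ {a} → Recognisable a →
    Σ ℕ λ s → Σ (ℕ → D) λ c → Σ ℕ λ j → j ≤ s × ¬ Zero (c j) × Annihilates a s c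
  recognisable-annihilated {a} R =
    length is , extend c , toℕ index , Finₚ.toℕ≤pred[n] index ,
    subst (¬_ ∘ Zero) (sym (extend-toℕ c index)) nonzero , annihilates
    where
    open Recognisable R
    row : ℕ → I → D
    row zero    = out
    row (suc j) = λ i → ∑ᴾ is (λ k → row j k *ᴾ matrix k i)
    row-output : ∀ j n x → ⟦ a (n ℕ.+ j) ⟧ x ≡ ∑ is (λ i → ⟦ row j i ⟧ x ℤ.* ⟦ state n i ⟧ x)
    row-output zero    n x rewrite ℕₚ.+-identityʳ n = output n x
    row-output (suc j) n x rewrite ℕₚ.+-suc n j = trans (row-output j (suc n) x) (begin
      ∑ is (λ k → ⟦ row j k ⟧ x ℤ.* ⟦ state (suc n) k ⟧ x)
        ≡⟨ ∑-cong is (λ k → trans (cong (λ z → ⟦ row j k ⟧ x ℤ.* z) (step n k x)) (∑-*ˡ (⟦ row j k ⟧ x) is _)) ⟩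
      ∑ is (λ k → ∑ is (λ i → ⟦ row j k ⟧ x ℤ.* (⟦ matrix k i ⟧ x ℤ.* ⟦ state n i ⟧ x)))
        ≡⟨ ∑-swap is is _ ⟩
      ∑ is (λ i → ∑ is (λ k → ⟦ row j k ⟧ x ℤ.* (⟦ matrix k i ⟧ x ℤ.* ⟦ state n i ⟧ x)))
        ≡⟨ ∑-cong is (λ i → trans (∑-cong is (λ k → trans
             (sym (ℤₚ.*-assoc (⟦ row j k ⟧ x) (⟦ matrix k i ⟧ x) _))
             (cong (λ z → z ℤ.* ⟦ state n i ⟧ x) (sym (evalAt-*ᴾ (row j k) (matrix k i) x)))))
           (trans (sym (∑-*ʳ (⟦ state n i ⟧ x) is _)) (cong (λ z → z ℤ.* ⟦ state n i ⟧ x) (sym (⟦∑ᴾ⟧ is _ x))))) ⟩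
      ∑ is (λ i → ⟦ row (suc j) i ⟧ x ℤ.* ⟦ state n i ⟧ x) ∎)
      where open ≡-Reasoning
    open Dependence (linearDependence is (row ∘ toℕ))
    annihilates : Annihilates a (length is) (extend c)
    annihilates n x = begin
      ∑< (suc (length is)) (λ j → ⟦ extend c j ⟧ x ℤ.* ⟦ a (n ℕ.+ j) ⟧ x)
        ≡⟨ ∑<-cong (suc (length is)) (λ j _ → trans (cong (λ z → ⟦ extend c j ⟧ x ℤ.* z) (row-output j n x))
             (trans (∑-*ˡ (⟦ extend c j ⟧ x) is _) (∑-cong is (λ i → sym (ℤₚ.*-assoc (⟦ extend c j ⟧ x) (⟦ row j i ⟧ x) _))))) ⟩
      ∑< (suc (length is)) (λ j → ∑ is (λ i → (⟦ extend c j ⟧ x ℤ.* ⟦ row j i ⟧ x) ℤ.* ⟦ state n i ⟧ x))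
        ≡⟨ ∑<-∑-swap (suc (length is)) is _ ⟩
      ∑ is (λ i → ∑< (suc (length is)) (λ j → (⟦ extend c j ⟧ x ℤ.* ⟦ row j i ⟧ x) ℤ.* ⟦ state n i ⟧ x))
        ≡⟨ ∑-cong-∈ is (λ {i} i∈ → trans (∑<-cong (suc (length is)) (λ j _ → ℤₚ.*-comm _ (⟦ state n i ⟧ x)))
             (trans (sym (∑<-*ˡ (⟦ state n i ⟧ x) (suc (length is)) _))
             (trans (cong (λ z → ⟦ state n i ⟧ x ℤ.* z) (vanish i∈)) (ℤₚ.*-zeroʳ (⟦ state n i ⟧ x))))) ⟩
      ∑ is (λ _ → ℤ.0ℤ) ≡⟨ ∑-ε is ⟩
      ℤ.0ℤ ∎
      where
      open ≡-Reasoning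
      vanish : ∀ {i} → i ∈ is → ∑< (suc (length is)) (λ j → ⟦ extend c j ⟧ x ℤ.* ⟦ row j i ⟧ x) ≡ ℤ.0ℤ
      vanish {i} i∈ = trans (sym (sum-toℕ (suc (length is)) (λ j → ⟦ extend c j ⟧ x ℤ.* ⟦ row j i ⟧ x)))
        (trans (sum-cong-≗ (λ j → cong (λ z → ⟦ z ⟧ x ℤ.* ⟦ row (toℕ j) i ⟧ x) (extend-toℕ c j))) (relation i∈ x))

  -- Zeros of a sequence annihilated with nonzero leading and trailing coefficients propagate in both directions.
  record Reversible (a : Seq) : Set where
    field
      offset order : ℕ
      c            : ℕ → D
      leading      : ¬ Zero (c order)
      trailing     : ¬ Zero (c 0)
      annihilates  : Annihilates (λ n → a (offset ℕ.+ n)) order c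

  trimTop : ∀ {a} s c j → j ≤ s → ¬ Zero (c j) → Annihilates a s c →
    Σ ℕ λ s′ → j ≤ s′ × ¬ Zero (c s′) × Annihilates a s′ c
  trimTop {a} s c j j≤s cj≉0 ann with ≈ᴱ0? (c s)
  ... | no cs≉0 = s , j≤s , cs≉0 , ann
  trimTop {a} zero c .zero z≤n cj≉0 ann | yes cs≈0 = ⊥-elim (cj≉0 cs≈0)
  trimTop {a} (suc s) c j j≤s cj≉0 ann | yes cs≈0 with ℕₚ.m≤n⇒m<n∨m≡n j≤s
  ... | inj₂ refl = ⊥-elim (cj≉0 cs≈0)
  ... | inj₁ (s≤s j≤s′) = trimTop {a} s c j j≤s′ cj≉0 (λ n x → trans
    (sym (+-zeroʳ (∑< (suc s) (λ j → ⟦ c j ⟧ x ℤ.* ⟦ a (n ℕ.+ j) ⟧ x)) (cong (λ z → z ℤ.* ⟦ a (n ℕ.+ suc s) ⟧ x) (cs≈0 x)))) (ann n x))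

  -- A zero coefficient at the bottom is removed by passing to the tail `a ∘ suc`; the number of
  -- such passages is the `offset` in `Reversible`.
  trimBottom : ∀ {a} s c → ¬ Zero (c s) → Annihilates a s c → Reversible a
  trimBottom {a} s c cs≉0 ann with ≈ᴱ0? (c 0)
  ... | no c0≉0 = record { offset = 0 ; order = s ; c = c ; leading = cs≉0 ; trailing = c0≉0 ; annihilates = ann }
  trimBottom {a} zero    c cs≉0 ann | yes c0≈0 = ⊥-elim (cs≉0 c0≈0)
  trimBottom {a} (suc s) c cs≉0 ann | yes c0≈0 = record
    { offset = suc offset ; order = order ; c = Reversible.c rest ; leading = leading ; trailing = trailing
    ; annihilates = annihilates }
    where
    rest : Reversible (a ∘ suc)
    rest = trimBottom {a ∘ suc} s (c ∘ suc) cs≉0 (λ n x → trans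
      (∑<-cong (suc s) (λ j _ → cong (λ z → ⟦ c (suc j) ⟧ x ℤ.* ⟦ a z ⟧ x) (sym (ℕₚ.+-suc n j))))
      (trans (sym (+-zeroˡ _ (cong (λ z → z ℤ.* ⟦ a (n ℕ.+ 0) ⟧ x) (c0≈0 x))))
        (trans (sym (∑<-front (suc s) (λ j → ⟦ c j ⟧ x ℤ.* ⟦ a (n ℕ.+ j) ⟧ x))) (ann n x))))
    open Reversible rest

  recognisable-reversible : ∀ {a} → Recognisable a → Reversible a
  recognisable-reversible {a} R with recognisable-annihilated R
  ... | s , c , j , j≤s , cj≉0 , ann with trimTop {a} s c j j≤s cj≉0 ann
  ...   | s′ , _ , cs≉0 , ann′ = trimBottom {a} s′ c cs≉0 ann′

  EventuallyZeroFrom : Seq → ℕ → Set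
  EventuallyZeroFrom a N = ∀ n → N ≤ n → Zero (a n)

  Frequent : Seq → ℕ → Set
  Frequent a E = ∀ n → Σ ℕ λ i → i < E × ¬ Zero (a (n ℕ.+ i))

  WindowZero : Seq → ℕ → ℕ → Set
  WindowZero a E n = ∀ i → i < E → Zero (a (n ℕ.+ i))

  windowZero? : ∀ a E n → WindowZero a E n ⊎ Σ ℕ λ i → i < E × ¬ Zero (a (n ℕ.+ i))
  windowZero? a zero    n = inj₁ (λ i ())
  windowZero? a (suc E) n with windowZero? a E n | ≈ᴱ0? (a (n ℕ.+ E))
  ... | inj₂ (i , i<E , ≉0) | _      = inj₂ (i , ℕₚ.m<n⇒m<1+n i<E , ≉0)
  ... | inj₁ _              | no ≉0  = inj₂ (E , ℕₚ.≤-refl , ≉0)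
  ... | inj₁ zeros          | yes ≈0 = inj₁ λ i i<1+E → case ℕₚ.m≤n⇒m<n∨m≡n (ℕₚ.≤-pred i<1+E) of λ where
    (inj₁ i<E)  → zeros i i<E
    (inj₂ refl) → ≈0

  module Windows (a : Seq) (s : ℕ) (c : ℕ → D) (leading : ¬ Zero (c s)) (trailing : ¬ Zero (c 0))
                 (ann : Annihilates a s c) where

    private
      zeroTerm : ∀ P Q x → Zero Q → ⟦ P ⟧ x ℤ.* ⟦ Q ⟧ x ≡ ℤ.0ℤ
      zeroTerm P Q x z = trans (cong (λ w → ⟦ P ⟧ x ℤ.* w) (z x)) (ℤₚ.*-zeroʳ (⟦ P ⟧ x))

    next : ∀ n → WindowZero a s n → Zero (a (n ℕ.+ s))
    next n z = nonzero-product (c s) (a (n ℕ.+ s)) (λ x → trans (evalAt-*ᴾ (c s) (a (n ℕ.+ s)) x)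
      (trans (sym (+-zeroˡ _ (∑<-0 s (λ j lt → zeroTerm (c j) (a (n ℕ.+ j)) x (z j lt))))) (ann n x))) leading

    previous : ∀ n → WindowZero a s (suc n) → Zero (a n)
    previous n z = subst (Zero ∘ a) (ℕₚ.+-identityʳ n)
      (nonzero-product (c 0) (a (n ℕ.+ 0)) (λ x → trans (evalAt-*ᴾ (c 0) (a (n ℕ.+ 0)) x)
        (trans (sym (+-zeroʳ _ (∑<-0 s (λ j lt → zeroTerm (c (suc j)) (a (n ℕ.+ suc j)) x
            (subst (Zero ∘ a) (sym (ℕₚ.+-suc n j)) (z j lt))))))
          (trans (sym (∑<-front s (λ j → ⟦ c j ⟧ x ℤ.* ⟦ a (n ℕ.+ j) ⟧ x))) (ann n x)))) trailing)

    forward : ∀ n → WindowZero a s n → WindowZero a s (suc n)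
    forward n z i i<s with ℕₚ.m≤n⇒m<n∨m≡n i<s
    ... | inj₁ 1+i<s = subst (Zero ∘ a) (ℕₚ.+-suc n i) (z (suc i) 1+i<s)
    ... | inj₂ refl  = subst (Zero ∘ a) (ℕₚ.+-suc n i) (next n z)

    backward : ∀ n → WindowZero a s (suc n) → WindowZero a s n
    backward n z zero    _   = subst (Zero ∘ a) (sym (ℕₚ.+-identityʳ n)) (previous n z)
    backward n z (suc i) lt  = subst (Zero ∘ a) (sym (ℕₚ.+-suc n i)) (z i (ℕₚ.<-trans (ℕₚ.n<1+n i) lt))

    allZero : WindowZero a s 0 → ∀ n → Zero (a n)
    allZero z n = subst (Zero ∘ a) (ℕₚ.+-identityʳ n) (everywhere n)
      where
      windows : ∀ n → WindowZero a s n
      windows zero    = z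
      windows (suc n) = forward n (windows n)
      everywhere : ∀ n → Zero (a (n ℕ.+ 0))
      everywhere n with 0 ℕ.<? s
      ... | yes 0<s = windows n 0 0<s
      -- For order 0 windows are empty, and the relation itself forces every term to be zero.
      ... | no  0≮s = subst (λ t → Zero (a (n ℕ.+ t))) (ℕₚ.n≤0⇒n≡0 (ℕₚ.≮⇒≥ 0≮s)) (next n (windows n))

    rewind : ∀ n → WindowZero a s n → WindowZero a s 0
    rewind zero    z = z
    rewind (suc n) z = rewind n (backward n z)

  -- A single window decides. If the first `order` terms after `offset` vanish, the recurrence
  -- carries the zeros forward for ever. If not, no later window of that length vanishes, since its
  -- zeros would be carried back to the first.
  zero-or-frequent : ∀ {a} → Recognisable a → Σ ℕ (EventuallyZeroFrom a) ⊎ Σ ℕ (Frequent a)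
  zero-or-frequent {a} R = decide (windowZero? tail order 0)
    where
    open Reversible (recognisable-reversible R)
    tail : Seq
    tail n = a (offset ℕ.+ n)
    open Windows tail order c leading trailing annihilates
    decide : WindowZero tail order 0 ⊎ (Σ ℕ λ i → i < order × ¬ Zero (tail i)) →
      Σ ℕ (EventuallyZeroFrom a) ⊎ Σ ℕ (Frequent a)
    decide (inj₁ z) = inj₁ (offset , λ n le → subst (Zero ∘ a) (ℕₚ.m+[n∸m]≡n le) (allZero z (n ℕ.∸ offset)))
    -- A stretch of length `offset + order` starting at `n` contains the window of the tail that
    -- starts at `n`.
    decide (inj₂ (i , i<s , ≉0)) = inj₂ (offset ℕ.+ order , λ n → case windowZero? tail order n of λ where
      (inj₁ z) → ⊥-elim (≉0 (rewind n z i i<s))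
      (inj₂ (k , k<s , ≉0′)) → offset ℕ.+ k , ℕₚ.+-monoʳ-< offset k<s ,
        subst (λ t → ¬ Zero (a t)) (reorder n k) ≉0′)
      where
      reorder : ∀ n k → offset ℕ.+ (n ℕ.+ k) ≡ n ℕ.+ (offset ℕ.+ k)
      reorder n k = trans (sym (ℕₚ.+-assoc offset n k)) (trans (cong (ℕ._+ k) (ℕₚ.+-comm offset n)) (ℕₚ.+-assoc n offset k))

  -- Spans with C-finite coefficients

  record InSpan {X : Set} (y : ℕ → ℕ → X → D) (T : ℕ) (f : ℕ → X → D) : Set₁ where
    constructor inSpan
    field
      c    : ℕ → Seq
      rec  : ∀ j → Recognisable (c j)
      comb : ∀ n q x → ⟦ f n q ⟧ x ≡ ∑< T (λ j → ⟦ c j n ⟧ x ℤ.* ⟦ y j n q ⟧ x)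

  ∑<-δ : ∀ T (f : ℕ → ℤ) t → t < T → (∀ j → j ≢ t → f j ≡ ℤ.0ℤ) → ∑< T f ≡ f t
  ∑<-δ (suc T) f t t<T others with ℕₚ.m≤n⇒m<n∨m≡n (ℕₚ.≤-pred t<T)
  ... | inj₁ t<T′ = trans (+-zeroʳ _ (others T (ℕₚ.<⇒≢ t<T′ ∘ sym))) (∑<-δ T f t t<T′ others)
  ... | inj₂ refl = +-zeroˡ (f T) (∑<-0 T (λ j j<T → others j (ℕₚ.<⇒≢ j<T)))

  module _ {X : Set} {y : ℕ → ℕ → X → D} where

    span-gen : ∀ {T} t → t < T → InSpan y T (y t)
    span-gen {T} t t<T = inSpan c rec λ n q x → sym (trans
      (∑<-δ T _ t t<T (λ j j≢t → cong (λ z → z ℤ.* ⟦ y j n q ⟧ x) (off j n x j≢t)))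
      (trans (cong (λ z → z ℤ.* ⟦ y t n q ⟧ x) (on n x)) (ℤₚ.*-identityˡ _)))
      where
      c : ℕ → Seq
      c j n with j ℕ.≟ t
      ... | yes _ = 1ᴾ
      ... | no  _ = 0ᴾ
      rec : ∀ j → Recognisable (c j)
      rec j with j ℕ.≟ t
      ... | yes _ = recognisable-const 1ᴾ
      ... | no  _ = recognisable-const 0ᴾ
      on : ∀ n x → ⟦ c t n ⟧ x ≡ ℤ.1ℤ
      on n x with t ℕ.≟ t
      ... | yes _  = evalAt-1 x
      ... | no t≢t = ⊥-elim (t≢t refl)
      off : ∀ j n x → j ≢ t → ⟦ c j n ⟧ x ≡ ℤ.0ℤ
      off j n x j≢t with j ℕ.≟ t
      ... | yes j≡t = ⊥-elim (j≢t j≡t)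
      ... | no  _   = refl

    span-weaken : ∀ {T T′ f} → T ≤ T′ → InSpan y T f → InSpan y T′ f
    span-weaken {T} {T′} {f} T≤T′ S = inSpan c′ rec′ λ n q x → trans (comb n q x) (sym (trans
      (∑<-≤ _ T≤T′ (λ j T≤j → cong (λ z → z ℤ.* ⟦ y j n q ⟧ x) (outside j n x T≤j)))
      (∑<-cong T (λ j j<T → cong (λ z → ⟦ z ⟧ x ℤ.* ⟦ y j n q ⟧ x) (inside j n j<T)))))
      where
      open InSpan S
      c′ : ℕ → Seq
      c′ j n with j ℕ.<? T
      ... | yes _ = c j n
      ... | no  _ = 0ᴾ
      rec′ : ∀ j → Recognisable (c′ j)
      rec′ j with j ℕ.<? T
      ... | yes _ = rec j
      ... | no  _ = recognisable-const 0ᴾ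
      inside : ∀ j n → j < T → c′ j n ≡ c j n
      inside j n j<T with j ℕ.<? T
      ... | yes _  = refl
      ... | no j≮T = ⊥-elim (j≮T j<T)
      outside : ∀ j n x → T ≤ j → ⟦ c′ j n ⟧ x ≡ ℤ.0ℤ
      outside j n x T≤j with j ℕ.<? T
      ... | yes j<T = ⊥-elim (ℕₚ.<⇒≱ j<T T≤j)
      ... | no  _   = refl

    span-0 : ∀ {T} → InSpan y T (λ _ _ → 0ᴾ)
    span-0 {T} = inSpan (λ _ _ → 0ᴾ) (λ _ → recognisable-const 0ᴾ) λ n q x → sym (∑<-0 T (λ _ _ → refl))

    span-+ : ∀ {T f g} → InSpan y T f → InSpan y T g → InSpan y T (λ n q → f n q +ᴾ g n q)
    span-+ {T} {f} {g} S S′ = inSpan (λ j n → S.c j n +ᴾ S′.c j n) (λ j → recognisable-+ (S.rec j) (S′.rec j))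
      λ n q x → trans (evalAt-++ (f n q) (g n q) x) (trans (cong₂ ℤ._+_ (S.comb n q x) (S′.comb n q x))
        (trans (sym (∑<-+ T _ _)) (∑<-cong T (λ j _ → trans
          (sym (ℤₚ.*-distribʳ-+ (⟦ y j n q ⟧ x) (⟦ S.c j n ⟧ x) (⟦ S′.c j n ⟧ x)))
          (cong (λ z → z ℤ.* ⟦ y j n q ⟧ x) (sym (evalAt-++ (S.c j n) (S′.c j n) x)))))))
      where
      module S  = InSpan S
      module S′ = InSpan S′

    span-scale : ∀ {T f s} → Recognisable s → InSpan y T f → InSpan y T (λ n q → s n *ᴾ f n q)
    span-scale {T} {f} {s} R S = inSpan (λ j n → s n *ᴾ c j n) (λ j → recognisable-* R (rec j))
      λ n q x → trans (evalAt-*ᴾ (s n) (f n q) x) (trans (cong (λ z → ⟦ s n ⟧ x ℤ.* z) (comb n q x))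
        (trans (∑<-*ˡ (⟦ s n ⟧ x) T _) (∑<-cong T (λ j _ → trans
          (sym (ℤₚ.*-assoc (⟦ s n ⟧ x) (⟦ c j n ⟧ x) _))
          (cong (λ z → z ℤ.* ⟦ y j n q ⟧ x) (sym (evalAt-*ᴾ (s n) (c j n) x)))))))
      where open InSpan S

    span-≈ : ∀ {T f g} → (∀ n q → g n q ≈ᴱ f n q) → InSpan y T f → InSpan y T g
    span-≈ eq S = inSpan c rec λ n q x → trans (eq n q x) (comb n q x)
      where open InSpan S

    span-neg : ∀ {T f} → InSpan y T f → InSpan y T (λ n q → negᴾ (f n q))
    span-neg {f = f} S = span-≈ (λ n q x → trans (evalAt-neg (f n q) x) (sym (trans
      (evalAt-*ᴾ (negᴾ 1ᴾ) (f n q) x)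
      (trans (cong (λ z → z ℤ.* ⟦ f n q ⟧ x) (trans (evalAt-neg 1ᴾ x) (cong ℤ.-_ (evalAt-1 x)))) (ℤₚ.-1*i≡-i (⟦ f n q ⟧ x))))))
      (span-scale (recognisable-const (negᴾ 1ᴾ)) S)

    span-∑< : ∀ {T} k {f : ℕ → ℕ → X → D} → (∀ i → i < k → InSpan y T (f i)) →
      InSpan y T (λ n q → ∑ᴾ< k (λ i → f i n q))
    span-∑< zero    S = span-0
    span-∑< (suc k) S = span-+ (span-∑< k (λ i i<k → S i (ℕₚ.m<n⇒m<1+n i<k))) (S k ℕₚ.≤-refl)

    span-recognisable : ∀ {T f} → (∀ t q → Recognisable (λ n → y t n q)) → InSpan y T f →
      ∀ q → Recognisable (λ n → f n q)
    span-recognisable {T} {f} R S q = recognisable-≈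
      (λ n x → trans (comb n q x) (sym (trans (⟦∑ᴾ<⟧ T _ x)
        (∑<-cong T (λ j _ → evalAt-*ᴾ (c j n) (y j n q) x)))))
      (recognisable-∑< T (λ j → recognisable-* (rec j) (R j q)))
      where open InSpan S

  remove : {A : Set} {z : A} {xs : List A} → z ∈ xs →
    Σ (List A) λ ys → length xs ≡ suc (length ys) × (∀ {w} → w ∈ xs → w ∈ ys ⊎ w ≡ z)
  remove {xs = _ ∷ xs} (here refl) = xs , refl , λ { (here eq) → inj₂ eq ; (there h) → inj₁ h }
  remove {xs = x ∷ xs} (there z∈) with remove z∈
  ... | ys , len , split = x ∷ ys , cong suc len ,
    λ { (here eq) → inj₁ (here eq) ; (there h) → [ inj₁ ∘ there , inj₂ ] (split h) }

  searchList : {A : Set} {P : A → ℕ → Set} {Q : A → Set} → (∀ {z m n} → m ≤ n → P z m → P z n) →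
    (∀ z → Σ ℕ (P z) ⊎ Q z) → (xs : List A) →
    (Σ ℕ λ N → ∀ {z} → z ∈ xs → P z N) ⊎ (Σ A λ z → z ∈ xs × Q z)
  searchList mono dec []       = inj₁ (0 , λ ())
  searchList mono dec (z ∷ xs) with dec z | searchList mono dec xs
  ... | inj₂ q       | _                  = inj₂ (z , here refl , q)
  ... | inj₁ _       | inj₂ (z′ , z∈ , q) = inj₂ (z′ , there z∈ , q)
  ... | inj₁ (m , p) | inj₁ (n , ps)      = inj₁ (m ℕ.⊔ n ,
    λ { (here refl) → mono (ℕₚ.m≤m⊔n m n) p ; (there z∈) → mono (ℕₚ.m≤n⊔m m n) (ps z∈) })

  frequent-square : ∀ {w E} → Frequent w E → Frequent (λ n → w n *ᴾ w n) E
  frequent-square {w} freq n with freq n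
  ... | i , i<E , ≉0 = i , i<E , *ᴾ-nonzero (w (n ℕ.+ i)) (w (n ℕ.+ i)) ≉0 ≉0

  -- Elimination with C-finite pivots

  module Elimination {Q : Set} (qs : List Q) (y : ℕ → ℕ → Q → D)
                     (y-rec : ∀ t q → Recognisable (λ n → y t n q)) where

    -- Rows y t with t ≥ T agree, after multiplication by the pivot w, with combinations g t of the
    -- rows y j, j < T, except in the columns still alive.
    record Partial (alive : List Q) : Set₁ where
      field
        T E   : ℕ
        w     : Seq
        w-rec : Recognisable w
        freq  : Frequent w E
        g     : ℕ → ℕ → Q → D
        span  : ∀ t → InSpan y T (g t)
        dead  : ∀ t n {q} → q ∈ qs → q ∈ alive ⊎ (∀ x → ⟦ w n ⟧ x ℤ.* ⟦ y t n q ⟧ x ≡ ⟦ g t n q ⟧ x)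

    -- The rows from `T` to `T + E` are finitely many, so one `start` serves all of them. That there
    -- are this many is what the shifts by `i < E` consume later.
    record Complete : Set₁ where
      field
        T E start : ℕ
        w     : Seq
        w-rec : Recognisable w
        freq  : Frequent w E
        g     : ℕ → ℕ → Q → D
        span  : ∀ t → InSpan y T (g t)
        agree : ∀ t → T ≤ t → t ≤ T ℕ.+ E → ∀ n → start ≤ n → ∀ {q} → q ∈ qs →
          ∀ x → ⟦ w n ⟧ x ℤ.* ⟦ y t n q ⟧ x ≡ ⟦ g t n q ⟧ x

    module Step {alive : List Q} (P : Partial alive) where
      open Partial P

      residue : ℕ → Q → Seq
      residue t q n = (w n *ᴾ y t n q) +ᴾ negᴾ (g t n q)

      residue-rec : ∀ t q → Recognisable (residue t q)
      residue-rec t q = recognisable-+ (recognisable-* w-rec (y-rec t q))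
        (recognisable-neg (span-recognisable y-rec (span t) q))

      ⟦residue⟧ : ∀ t q n x → ⟦ residue t q n ⟧ x ≡ ⟦ w n ⟧ x ℤ.* ⟦ y t n q ⟧ x ℤ.+ ℤ.- ⟦ g t n q ⟧ x
      ⟦residue⟧ t q n x = trans (evalAt-++ (w n *ᴾ y t n q) (negᴾ (g t n q)) x)
        (cong₂ ℤ._+_ (evalAt-*ᴾ (w n) (y t n q) x) (evalAt-neg (g t n q) x))

      -- In the next round `w y = g + residue` is multiplied by a pivot residue, so the multiplier
      -- of the rows becomes `w` times that residue. Testing this product makes the sequence found
      -- frequent the very one that serves as the next `w`.
      pivot : ℕ → Q → Seq
      pivot t q n = w n *ᴾ residue t q n

      pivot-rec : ∀ t q → Recognisable (pivot t q)
      pivot-rec t q = recognisable-* w-rec (residue-rec t q)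

      candidates : List (ℕ × Q)
      candidates = cartesianProduct (List.applyUpTo (T ℕ.+_) (suc E)) alive

      finish : (Σ ℕ λ N → ∀ {z} → z ∈ candidates → EventuallyZeroFrom (pivot (proj₁ z) (proj₂ z)) N) → Complete
      finish (N , zeros) = record
        -- The candidates being eventually zero says that `w` times the residue vanishes; the
        -- relation is therefore obtained with one further factor `w` on both sides.
        { T = T ; E = E ; start = N ; w = λ n → w n *ᴾ w n ; w-rec = recognisable-* w-rec w-rec
        ; freq = frequent-square {w} freq
        ; g = λ t n q → w n *ᴾ g t n q ; span = λ t → span-scale w-rec (span t) ; agree = agree }
        where
        agree : ∀ t → T ≤ t → t ≤ T ℕ.+ E → ∀ n → N ≤ n → ∀ {q} → q ∈ qs →
          ∀ x → ⟦ w n *ᴾ w n ⟧ x ℤ.* ⟦ y t n q ⟧ x ≡ ⟦ w n *ᴾ g t n q ⟧ x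
        agree t T≤t t≤T+E n N≤n {q} q∈ x = begin
          ⟦ w n *ᴾ w n ⟧ x ℤ.* ⟦ y t n q ⟧ x      ≡⟨ cong (λ z → z ℤ.* ⟦ y t n q ⟧ x) (evalAt-*ᴾ (w n) (w n) x) ⟩
          (⟦ w n ⟧ x ℤ.* ⟦ w n ⟧ x) ℤ.* ⟦ y t n q ⟧ x ≡⟨ ℤₚ.*-assoc (⟦ w n ⟧ x) _ _ ⟩
          ⟦ w n ⟧ x ℤ.* (⟦ w n ⟧ x ℤ.* ⟦ y t n q ⟧ x) ≡⟨ core (dead t n q∈) ⟩
          ⟦ w n ⟧ x ℤ.* ⟦ g t n q ⟧ x             ≡⟨ evalAt-*ᴾ (w n) (g t n q) x ⟨
          ⟦ w n *ᴾ g t n q ⟧ x                    ∎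
          where
          open ≡-Reasoning
          expand : ∀ w a b → w ℤ.* a ≡ w ℤ.* (a ℤ.+ ℤ.- b) ℤ.+ w ℤ.* b
          expand = solve-∀
          t∈ : t ∈ List.applyUpTo (T ℕ.+_) (suc E)
          t∈ = subst (_∈ List.applyUpTo (T ℕ.+_) (suc E)) (ℕₚ.m+[n∸m]≡n T≤t)
            (∈-applyUpTo⁺ (T ℕ.+_) (s≤s (ℕₚ.+-cancelˡ-≤ T _ _ (subst (_≤ T ℕ.+ E) (sym (ℕₚ.m+[n∸m]≡n T≤t)) t≤T+E))))
          core : q ∈ alive ⊎ (∀ x → ⟦ w n ⟧ x ℤ.* ⟦ y t n q ⟧ x ≡ ⟦ g t n q ⟧ x) →
            ⟦ w n ⟧ x ℤ.* (⟦ w n ⟧ x ℤ.* ⟦ y t n q ⟧ x) ≡ ⟦ w n ⟧ x ℤ.* ⟦ g t n q ⟧ x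
          core (inj₂ eq) = cong (λ z → ⟦ w n ⟧ x ℤ.* z) (eq x)
          core (inj₁ q∈alive) = trans (expand (⟦ w n ⟧ x) (⟦ w n ⟧ x ℤ.* ⟦ y t n q ⟧ x) (⟦ g t n q ⟧ x))
            (+-zeroˡ _ (trans (cong (λ z → ⟦ w n ⟧ x ℤ.* z) (sym (⟦residue⟧ t q n x)))
              (trans (sym (evalAt-*ᴾ (w n) (residue t q n) x))
                (zeros (∈-cartesianProduct⁺ t∈ q∈alive) n N≤n x))))

      -- The new residue of row `t` is `residue t* q*` times the old one minus `residue t q*` times
      -- the residue of row `t*`. The two products agree in column `q*`, and both vanish in a column
      -- that was dead before. The part involving row `t*` is absorbed into `g′`.
      reduce : ∀ t* q* E′ → t* ≤ T ℕ.+ E → Frequent (pivot t* q*) E′ → (alive′ : List Q) →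
        (∀ {q} → q ∈ alive → q ∈ alive′ ⊎ q ≡ q*) → Partial alive′
      reduce t* q* E′ t*≤ freq′ alive′ split = record
        { T = T′ ; E = E′ ; w = pivot t* q* ; w-rec = pivot-rec t* q* ; freq = freq′
        ; g = g′ ; span = span′ ; dead = dead′ }
        where
        -- `g′` involves the row `y t*` itself, with `t*` at most `T + E`, so the span must reach
        -- beyond `T + E`.
        T′ : ℕ
        T′ = suc (T ℕ.+ E)
        T≤T′ : T ≤ T′
        T≤T′ = ℕₚ.≤-trans (ℕₚ.m≤m+n T E) (ℕₚ.n≤1+n _)
        g′ : ℕ → ℕ → Q → D
        g′ t n q = (residue t* q* n *ᴾ g t n q) +ᴾ (residue t q* n *ᴾ residue t* q n)
        span′ : ∀ t → InSpan y T′ (g′ t)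
        span′ t = span-+ (span-scale (residue-rec t* q*) (span-weaken T≤T′ (span t)))
          (span-scale (residue-rec t q*) (span-+ (span-scale w-rec (span-gen t* (s≤s t*≤)))
            (span-neg (span-weaken T≤T′ (span t*)))))
        ⟦g′⟧ : ∀ t n q x → ⟦ g′ t n q ⟧ x ≡
          ⟦ residue t* q* n ⟧ x ℤ.* ⟦ g t n q ⟧ x ℤ.+
          ⟦ residue t q* n ⟧ x ℤ.* (⟦ w n ⟧ x ℤ.* ⟦ y t* n q ⟧ x ℤ.+ ℤ.- ⟦ g t* n q ⟧ x)
        ⟦g′⟧ t n q x = trans (evalAt-++ (residue t* q* n *ᴾ g t n q) _ x)
          (cong₂ ℤ._+_ (evalAt-*ᴾ (residue t* q* n) (g t n q) x)
            (trans (evalAt-*ᴾ (residue t q* n) (residue t* q n) x)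
              (cong (λ z → ⟦ residue t q* n ⟧ x ℤ.* z) (⟦residue⟧ t* q n x))))
        deadColumn : ∀ w z a → (w ℤ.* z) ℤ.* a ≡ z ℤ.* (w ℤ.* a)
        deadColumn = solve-∀
        cancel : ∀ u z g → z ℤ.* g ℤ.+ u ℤ.* (g ℤ.+ ℤ.- g) ≡ z ℤ.* g
        cancel = solve-∀
        pivotColumn : ∀ w a g a* g* → (w ℤ.* (w ℤ.* a* ℤ.+ ℤ.- g*)) ℤ.* a ≡
          (w ℤ.* a* ℤ.+ ℤ.- g*) ℤ.* g ℤ.+ (w ℤ.* a ℤ.+ ℤ.- g) ℤ.* (w ℤ.* a* ℤ.+ ℤ.- g*)
        pivotColumn = solve-∀
        column : ∀ t n {q} → q ∈ alive′ ⊎ q ≡ q* → q ∈ alive′ ⊎ (∀ x → ⟦ pivot t* q* n ⟧ x ℤ.* ⟦ y t n q ⟧ x ≡ ⟦ g′ t n q ⟧ x)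
        column t n (inj₁ h)    = inj₁ h
        column t n {q} (inj₂ refl) = inj₂ λ x → trans
          (cong (λ z → z ℤ.* ⟦ y t n q ⟧ x) (trans (evalAt-*ᴾ (w n) (residue t* q n) x)
            (cong (λ z → ⟦ w n ⟧ x ℤ.* z) (⟦residue⟧ t* q n x))))
          (trans (pivotColumn (⟦ w n ⟧ x) (⟦ y t n q ⟧ x) (⟦ g t n q ⟧ x) (⟦ y t* n q ⟧ x) (⟦ g t* n q ⟧ x))
            (sym (trans (⟦g′⟧ t n q x) (cong₂ (λ z z′ → z ℤ.* ⟦ g t n q ⟧ x ℤ.+
              z′ ℤ.* (⟦ w n ⟧ x ℤ.* ⟦ y t* n q ⟧ x ℤ.+ ℤ.- ⟦ g t* n q ⟧ x)) (⟦residue⟧ t* q n x) (⟦residue⟧ t q n x)))))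
        dead′ : ∀ t n {q} → q ∈ qs → q ∈ alive′ ⊎ (∀ x → ⟦ pivot t* q* n ⟧ x ℤ.* ⟦ y t n q ⟧ x ≡ ⟦ g′ t n q ⟧ x)
        dead′ t n {q} q∈ with dead t n q∈ | dead t* n q∈
        ... | inj₂ eq | inj₂ eq* = inj₂ λ x → begin
          ⟦ pivot t* q* n ⟧ x ℤ.* ⟦ y t n q ⟧ x
            ≡⟨ cong (λ z → z ℤ.* ⟦ y t n q ⟧ x) (evalAt-*ᴾ (w n) (residue t* q* n) x) ⟩
          (⟦ w n ⟧ x ℤ.* ⟦ residue t* q* n ⟧ x) ℤ.* ⟦ y t n q ⟧ x
            ≡⟨ deadColumn (⟦ w n ⟧ x) (⟦ residue t* q* n ⟧ x) (⟦ y t n q ⟧ x) ⟩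
          ⟦ residue t* q* n ⟧ x ℤ.* (⟦ w n ⟧ x ℤ.* ⟦ y t n q ⟧ x)
            ≡⟨ cong (λ z → ⟦ residue t* q* n ⟧ x ℤ.* z) (eq x) ⟩
          ⟦ residue t* q* n ⟧ x ℤ.* ⟦ g t n q ⟧ x
            ≡⟨ sym (+-zeroʳ _ (trans (cong (λ z → ⟦ residue t q* n ⟧ x ℤ.* z)
                 (trans (cong (λ z → z ℤ.+ ℤ.- ⟦ g t* n q ⟧ x) (eq* x)) (ℤₚ.+-inverseʳ (⟦ g t* n q ⟧ x))))
                 (ℤₚ.*-zeroʳ (⟦ residue t q* n ⟧ x)))) ⟩
          _ ≡⟨ ⟦g′⟧ t n q x ⟨
          ⟦ g′ t n q ⟧ x ∎
          where open ≡-Reasoning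
        ... | inj₁ q∈alive | _           = column t n (split q∈alive)
        ... | inj₂ _       | inj₁ q∈alive = column t n (split q∈alive)

    -- Each round kills a live column, so there are at most `length qs` rounds. The process stops
    -- when every candidate pivot, in the live columns and the rows `T` to `T + E`, is eventually
    -- zero; in particular when no column is alive.
    eliminate : ∀ k alive → length alive ≡ k → Partial alive → Complete
    eliminate k alive len P = decide (searchList
        (λ {z} {m} {n} m≤n zeros i n≤i → zeros i (ℕₚ.≤-trans m≤n n≤i))
        (λ z → zero-or-frequent (Step.pivot-rec P (proj₁ z) (proj₂ z))) (Step.candidates P))
      where
      next : ∀ k → length alive ≡ k → ∀ {t q} → (t , q) ∈ Step.candidates P →
        Σ ℕ (Frequent (Step.pivot P t q)) → Complete
      next k len {t} {q} z∈ (E′ , freq) with ∈-cartesianProduct⁻ (List.applyUpTo (Partial.T P ℕ.+_) (suc (Partial.E P))) alive z∈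
      ... | t∈ , q∈ with remove q∈ | ∈-applyUpTo⁻ (Partial.T P ℕ.+_) t∈
      next zero    len z∈ (E′ , freq) | t∈ , q∈ | alive′ , len′ , split | i , i<1+E , refl =
        case trans (sym len) len′ of λ ()
      next (suc k) len {t} {q} z∈ (E′ , freq) | t∈ , q∈ | alive′ , len′ , split | i , i<1+E , refl =
        eliminate k alive′ (ℕₚ.suc-injective (trans (sym len′) len))
          (Step.reduce P t q E′ (ℕₚ.+-monoʳ-≤ (Partial.T P) (ℕₚ.≤-pred i<1+E)) freq alive′ split)
      decide : (Σ ℕ λ N → ∀ {z} → z ∈ Step.candidates P → EventuallyZeroFrom (Step.pivot P (proj₁ z) (proj₂ z)) N)
        ⊎ (Σ (ℕ × Q) λ z → z ∈ Step.candidates P × Σ ℕ (Frequent (Step.pivot P (proj₁ z) (proj₂ z)))) → Complete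
      decide (inj₁ h)                = Step.finish P h
      decide (inj₂ ((t , q) , z∈ , f)) = next k len z∈ f

    complete : Complete
    complete = eliminate (length qs) qs refl record
      -- At the outset nothing is claimed: all columns are alive, the span of no rows is zero, and
      -- the constant 1 is nonzero in every window of length 1.
      { T = 0 ; E = 1 ; w = λ _ → 1ᴾ ; w-rec = recognisable-const 1ᴾ
      ; freq = λ n → 0 , s≤s z≤n , 1≉0
      ; g = λ _ _ _ → 0ᴾ ; span = λ _ → span-0 ; dead = λ t n q∈ → inj₁ q∈ }

  -- The shifts of one sequence form a family of rows with a single column, so the span lemmas made
  -- for the elimination also handle recurrences.
  shifted : Seq → ℕ → ℕ → ⊤ → D
  shifted a j n _ = a (n ℕ.+ j)

  span-shift : ∀ {a T f} i → InSpan (shifted a) T f → InSpan (shifted a) (i ℕ.+ T) (λ n → f (i ℕ.+ n))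
  span-shift {a} {T} {f} i S = span-≈
    (λ n q x → trans (comb (i ℕ.+ n) q x) (sym (trans (⟦∑ᴾ<⟧ T _ x) (∑<-cong T (λ j _ → trans
      (evalAt-*ᴾ (c j (i ℕ.+ n)) (a (n ℕ.+ (i ℕ.+ j))) x)
      (cong (λ z → ⟦ c j (i ℕ.+ n) ⟧ x ℤ.* ⟦ a z ⟧ x) (reorder n j)))))))
    (span-∑< T (λ j j<T → span-scale (recognisable-shiftBy i (rec j)) (span-gen (i ℕ.+ j) (ℕₚ.+-monoʳ-< i j<T))))
    where
    open InSpan S
    reorder : ∀ n j → n ℕ.+ (i ℕ.+ j) ≡ i ℕ.+ n ℕ.+ j
    reorder n j = trans (sym (ℕₚ.+-assoc n i j)) (cong (ℕ._+ j) (ℕₚ.+-comm n i))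

  -- Here the order of ℤ is used: a sum of nonnegative integers is zero only if each of them is.
  -- Applied at every point, it turns a vanishing sum of squared polynomials into vanishing
  -- polynomials.
  sumOfSquares-zero : ∀ n (f : ℕ → ℤ) → ∑< n (λ i → f i ℤ.* f i) ≡ ℤ.0ℤ → ∀ i → i < n → f i ≡ ℤ.0ℤ
  sumOfSquares-zero n f eq i i<n = go n (trans (sym (∑-abs n)) eq) i<n
    where
    square : ∀ z → z ℤ.* z ≡ + (ℤ.∣ z ∣ ℕ.* ℤ.∣ z ∣)
    square (+ zero)    = refl
    square (+ suc n)   = refl
    square ℤ.-[1+ n ]  = refl
    total : ℕ → ℕ
    total zero    = 0
    total (suc n) = total n ℕ.+ ℤ.∣ f n ∣ ℕ.* ℤ.∣ f n ∣
    ∑-abs : ∀ n → ∑< n (λ i → f i ℤ.* f i) ≡ + total n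
    ∑-abs zero    = refl
    ∑-abs (suc n) = cong₂ ℤ._+_ (∑-abs n) (square (f n))
    go : ∀ n → + total n ≡ ℤ.0ℤ → i < n → f i ≡ ℤ.0ℤ
    go (suc n) eq i<1+n with ℕₚ.m≤n⇒m<n∨m≡n (ℕₚ.≤-pred i<1+n)
    ... | inj₁ i<n  = go n (cong +_ (ℕₚ.m+n≡0⇒m≡0 (total n) (ℤₚ.+-injective eq))) i<n
    ... | inj₂ refl = ℤₚ.∣i∣≡0⇒i≡0 ([ id , id ] (ℕₚ.m*n≡0⇒m≡0∨n≡0 ℤ.∣ f n ∣
      (ℕₚ.m+n≡0⇒n≡0 (total n) (ℤₚ.+-injective eq))))

  -- From the elimination to a recurrence with nowhere vanishing leading coefficient

  record RecognisableRecurrence (a : Seq) : Set₁ where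
    field
      order   : ℕ
      lead    : Seq
      leadRec : Recognisable lead
      nonzero : ∀ n → ¬ Zero (lead n)
      c       : ℕ → Seq
      rec     : ∀ j → Recognisable (c j)
      holds   : ∀ n x → ⟦ lead n ⟧ x ℤ.* ⟦ a (n ℕ.+ order) ⟧ x ≡
                        ∑< order (λ j → ⟦ c j n ⟧ x ℤ.* ⟦ a (n ℕ.+ j) ⟧ x)

  -- With S = T + E, each shift i < E yields a relation for a_{n+S} with leading coefficient w_{n+i};
  -- one of these is nonzero, hence so is the sum of their squares.
  complete⇒recurrence : ∀ {Q : Set} (qs : List Q) (y : ℕ → ℕ → Q → D)
    (y-rec : ∀ t q → Recognisable (λ n → y t n q)) → Elimination.Complete qs y y-rec →
    (a : Seq) (v : ℕ → Q → D) →
    (∀ t n x → ⟦ a (n ℕ.+ t) ⟧ x ≡ ∑ qs (λ q → ⟦ y t n q ⟧ x ℤ.* ⟦ v n q ⟧ x)) →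
    RecognisableRecurrence a
  complete⇒recurrence {Q} qs y y-rec complete a v rows = record
    -- The relations are known from `start` on. Shifting them by `start` makes them hold for all
    -- `n`, at the price of a larger order.
    { order = start ℕ.+ S ; lead = λ n → G (start ℕ.+ n) ; leadRec = recognisable-shiftBy start G-rec
    ; nonzero = λ n → G-nonzero (start ℕ.+ n)
    ; c = InSpan.c total′ ; rec = InSpan.rec total′
    ; holds = λ n x → trans (cong (λ z → ⟦ G (start ℕ.+ n) ⟧ x ℤ.* ⟦ a z ⟧ x) (reorder n))
        (trans (relation (start ℕ.+ n) (ℕₚ.m≤m+n start n) x) (InSpan.comb total′ n tt x)) }
    where
    open Elimination.Complete complete
    S : ℕ
    S = T ℕ.+ E
    reorder : ∀ n → n ℕ.+ (start ℕ.+ S) ≡ start ℕ.+ n ℕ.+ S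
    reorder n = trans (sym (ℕₚ.+-assoc n start S)) (cong (ℕ._+ S) (ℕₚ.+-comm n start))
    -- The combination `g t` of rows paired with the vector `v n`: each row becomes a term of `a`,
    -- and the vector disappears from the relation.
    h : ℕ → ℕ → ⊤ → D
    h t n _ = ∑ᴾ< T (λ j → InSpan.c (span t) j n *ᴾ a (n ℕ.+ j))
    h-span : ∀ t → InSpan (shifted a) T (h t)
    h-span t = span-∑< T (λ j j<T → span-scale (InSpan.rec (span t) j) (span-gen j j<T))
    h-value : ∀ t → T ≤ t → t ≤ T ℕ.+ E → ∀ n → start ≤ n → ∀ x →
      ⟦ w n ⟧ x ℤ.* ⟦ a (n ℕ.+ t) ⟧ x ≡ ⟦ h t n tt ⟧ x
    h-value t T≤t t≤ n N≤n x = begin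
      ⟦ w n ⟧ x ℤ.* ⟦ a (n ℕ.+ t) ⟧ x
        ≡⟨ cong (λ z → ⟦ w n ⟧ x ℤ.* z) (rows t n x) ⟩
      ⟦ w n ⟧ x ℤ.* ∑ qs (λ q → Y t q ℤ.* V q)
        ≡⟨ ∑-*ˡ (⟦ w n ⟧ x) qs (λ q → Y t q ℤ.* V q) ⟩
      ∑ qs (λ q → ⟦ w n ⟧ x ℤ.* (Y t q ℤ.* V q))
        ≡⟨ ∑-cong-∈ qs column ⟩
      ∑ qs (λ q → ∑< T (λ j → V q ℤ.* (C j ℤ.* Y j q)))
        ≡⟨ ∑<-∑-swap T qs (λ j q → V q ℤ.* (C j ℤ.* Y j q)) ⟨
      ∑< T (λ j → ∑ qs (λ q → V q ℤ.* (C j ℤ.* Y j q)))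
        ≡⟨ ∑<-cong T (λ j _ → row j) ⟩
      ∑< T (λ j → ⟦ InSpan.c (span t) j n *ᴾ a (n ℕ.+ j) ⟧ x)
        ≡⟨ ⟦∑ᴾ<⟧ T (λ j → InSpan.c (span t) j n *ᴾ a (n ℕ.+ j)) x ⟨
      ⟦ h t n tt ⟧ x ∎
      where
      open ≡-Reasoning
      C : ℕ → ℤ
      C j = ⟦ InSpan.c (span t) j n ⟧ x
      Y : ℕ → Q → ℤ
      Y j q = ⟦ y j n q ⟧ x
      V : Q → ℤ
      V q = ⟦ v n q ⟧ x
      column : ∀ {q} → q ∈ qs → ⟦ w n ⟧ x ℤ.* (Y t q ℤ.* V q) ≡ ∑< T (λ j → V q ℤ.* (C j ℤ.* Y j q))
      column {q} q∈ = begin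
        ⟦ w n ⟧ x ℤ.* (Y t q ℤ.* V q)       ≡⟨ ℤₚ.*-assoc (⟦ w n ⟧ x) (Y t q) (V q) ⟨
        (⟦ w n ⟧ x ℤ.* Y t q) ℤ.* V q       ≡⟨ cong (λ z → z ℤ.* V q)
          (trans (agree t T≤t t≤ n N≤n q∈ x) (InSpan.comb (span t) n q x)) ⟩
        ∑< T (λ j → C j ℤ.* Y j q) ℤ.* V q  ≡⟨ ℤₚ.*-comm (∑< T (λ j → C j ℤ.* Y j q)) (V q) ⟩
        V q ℤ.* ∑< T (λ j → C j ℤ.* Y j q)  ≡⟨ ∑<-*ˡ (V q) T (λ j → C j ℤ.* Y j q) ⟩
        ∑< T (λ j → V q ℤ.* (C j ℤ.* Y j q)) ∎
      rotate : ∀ v c y → v ℤ.* (c ℤ.* y) ≡ c ℤ.* (y ℤ.* v)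
      rotate = solve-∀
      row : ∀ j → ∑ qs (λ q → V q ℤ.* (C j ℤ.* Y j q)) ≡ ⟦ InSpan.c (span t) j n *ᴾ a (n ℕ.+ j) ⟧ x
      row j = begin
        ∑ qs (λ q → V q ℤ.* (C j ℤ.* Y j q)) ≡⟨ ∑-cong qs (λ q → rotate (V q) (C j) (Y j q)) ⟩
        ∑ qs (λ q → C j ℤ.* (Y j q ℤ.* V q)) ≡⟨ ∑-*ˡ (C j) qs (λ q → Y j q ℤ.* V q) ⟨
        C j ℤ.* ∑ qs (λ q → Y j q ℤ.* V q)   ≡⟨ cong (λ z → C j ℤ.* z) (rows j n x) ⟨
        C j ℤ.* ⟦ a (n ℕ.+ j) ⟧ x            ≡⟨ evalAt-*ᴾ (InSpan.c (span t) j n) (a (n ℕ.+ j)) x ⟨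
        ⟦ InSpan.c (span t) j n *ᴾ a (n ℕ.+ j) ⟧ x ∎
    G : Seq
    G n = ∑ᴾ< E (λ i → w (i ℕ.+ n) *ᴾ w (i ℕ.+ n))
    G-rec : Recognisable G
    G-rec = recognisable-∑< E (λ i → recognisable-* (recognisable-shiftBy i w-rec) (recognisable-shiftBy i w-rec))
    ⟦G⟧ : ∀ n x → ⟦ G n ⟧ x ≡ ∑< E (λ i → ⟦ w (i ℕ.+ n) ⟧ x ℤ.* ⟦ w (i ℕ.+ n) ⟧ x)
    ⟦G⟧ n x = trans (⟦∑ᴾ<⟧ E (λ i → w (i ℕ.+ n) *ᴾ w (i ℕ.+ n)) x)
      (∑<-cong E (λ i _ → evalAt-*ᴾ (w (i ℕ.+ n)) (w (i ℕ.+ n)) x))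
    G-nonzero : ∀ n → ¬ Zero (G n)
    G-nonzero n z with freq n
    ... | i , i<E , ≉0 = ≉0 (λ x → trans (cong (λ k → ⟦ w k ⟧ x) (ℕₚ.+-comm n i))
      (sumOfSquares-zero E (λ i → ⟦ w (i ℕ.+ n) ⟧ x) (trans (sym (⟦G⟧ n x)) (z x)) i i<E))
    -- The `i`-th relation is taken at `i + n` with row `S ∸ i`, so that all of them express
    -- `a (n + S)`. Multiplied by `w (i + n)`, it gets a square as leading coefficient.
    total : ℕ → ⊤ → D
    total n q = ∑ᴾ< E (λ i → w (i ℕ.+ n) *ᴾ h (S ℕ.∸ i) (i ℕ.+ n) q)
    -- After a shift by `i < E` the right-hand side involves only terms before `a (n + i + T)`,
    -- hence terms before `a (n + S)`.
    total-span : InSpan (shifted a) S total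
    total-span = span-∑< E (λ i i<E → span-scale (recognisable-shiftBy i w-rec)
      (span-weaken (subst (i ℕ.+ T ≤_) (ℕₚ.+-comm E T) (ℕₚ.+-monoˡ-≤ T (ℕₚ.<⇒≤ i<E)))
        (span-shift {a} i (h-span (S ℕ.∸ i)))))
    total′ : InSpan (shifted a) (start ℕ.+ S) (λ n → total (start ℕ.+ n))
    total′ = span-shift {a} start total-span
    relation : ∀ n → start ≤ n → ∀ x → ⟦ G n ⟧ x ℤ.* ⟦ a (n ℕ.+ S) ⟧ x ≡ ⟦ total n tt ⟧ x
    relation n N≤n x = begin
      ⟦ G n ⟧ x ℤ.* A
        ≡⟨ cong (λ z → z ℤ.* A) (⟦G⟧ n x) ⟩
      ∑< E (λ i → W i ℤ.* W i) ℤ.* A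
        ≡⟨ ℤₚ.*-comm (∑< E (λ i → W i ℤ.* W i)) A ⟩
      A ℤ.* ∑< E (λ i → W i ℤ.* W i)
        ≡⟨ ∑<-*ˡ A E (λ i → W i ℤ.* W i) ⟩
      ∑< E (λ i → A ℤ.* (W i ℤ.* W i))
        ≡⟨ ∑<-cong E term ⟩
      ∑< E (λ i → ⟦ w (i ℕ.+ n) *ᴾ h (S ℕ.∸ i) (i ℕ.+ n) tt ⟧ x)
        ≡⟨ ⟦∑ᴾ<⟧ E (λ i → w (i ℕ.+ n) *ᴾ h (S ℕ.∸ i) (i ℕ.+ n) tt) x ⟨
      ⟦ total n tt ⟧ x ∎
      where
      open ≡-Reasoning
      A : ℤ
      A = ⟦ a (n ℕ.+ S) ⟧ x
      W : ℕ → ℤ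
      W i = ⟦ w (i ℕ.+ n) ⟧ x
      rotate : ∀ a w → a ℤ.* (w ℤ.* w) ≡ w ℤ.* (w ℤ.* a)
      rotate = solve-∀
      i≤S : ∀ i → i < E → i ≤ S
      i≤S i i<E = ℕₚ.≤-trans (ℕₚ.<⇒≤ i<E) (ℕₚ.m≤n+m E T)
      index : ∀ i → i < E → n ℕ.+ S ≡ i ℕ.+ n ℕ.+ (S ℕ.∸ i)
      index i i<E = sym (trans (cong (ℕ._+ (S ℕ.∸ i)) (ℕₚ.+-comm i n))
        (trans (ℕₚ.+-assoc n i (S ℕ.∸ i)) (cong (n ℕ.+_) (ℕₚ.m+[n∸m]≡n (i≤S i i<E)))))
      T≤S∸i : ∀ i → i < E → T ≤ S ℕ.∸ i
      T≤S∸i i i<E = subst (_≤ S ℕ.∸ i) (ℕₚ.m+n∸n≡m T i) (ℕₚ.∸-monoˡ-≤ i (ℕₚ.+-monoʳ-≤ T (ℕₚ.<⇒≤ i<E)))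
      term : ∀ i → i < E → A ℤ.* (W i ℤ.* W i) ≡ ⟦ w (i ℕ.+ n) *ᴾ h (S ℕ.∸ i) (i ℕ.+ n) tt ⟧ x
      term i i<E = begin
        A ℤ.* (W i ℤ.* W i)  ≡⟨ rotate A (W i) ⟩
        W i ℤ.* (W i ℤ.* A)  ≡⟨ cong (λ k → W i ℤ.* (W i ℤ.* ⟦ a k ⟧ x)) (index i i<E) ⟩
        W i ℤ.* (W i ℤ.* ⟦ a (i ℕ.+ n ℕ.+ (S ℕ.∸ i)) ⟧ x)
          ≡⟨ cong (λ z → W i ℤ.* z) (h-value (S ℕ.∸ i) (T≤S∸i i i<E) (ℕₚ.m∸n≤m S i)
               (i ℕ.+ n) (ℕₚ.≤-trans N≤n (ℕₚ.m≤n+m n i)) x) ⟩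
        W i ℤ.* ⟦ h (S ℕ.∸ i) (i ℕ.+ n) tt ⟧ x
          ≡⟨ evalAt-*ᴾ (w (i ℕ.+ n)) (h (S ℕ.∸ i) (i ℕ.+ n) tt) x ⟨
        ⟦ w (i ℕ.+ n) *ᴾ h (S ℕ.∸ i) (i ℕ.+ n) tt ⟧ x ∎

  recurrence : ∀ {Q : Set} (qs : List Q) (y : ℕ → ℕ → Q → D) → (∀ t q → Recognisable (λ n → y t n q)) →
    (a : Seq) (v : ℕ → Q → D) →
    (∀ t n x → ⟦ a (n ℕ.+ t) ⟧ x ≡ ∑ qs (λ q → ⟦ y t n q ⟧ x ℤ.* ⟦ v n q ⟧ x)) →
    RecognisableRecurrence a
  recurrence qs y y-rec = complete⇒recurrence qs y y-rec (Elimination.complete qs y y-rec)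

  -- Passage to rational functions

  1ᴾ-valid : ¬ (1ᴾ {r} ≈ᴾ 0ᴾ)
  1ᴾ-valid h = 1≉0 (≈ᴾ⇒≈ᴱ 1ᴾ 0ᴾ h)

  fromPoly-nonzero : ∀ {P : D} → ¬ Zero P → ¬ (fromPoly P Defs.≈ 0ᶠ)
  fromPoly-nonzero {P} P≉0 h = P≉0 λ x → trans (sym (trans (evalAt-*ᴾ P 1ᴾ x)
    (trans (cong (λ z → ⟦ P ⟧ x ℤ.* z) (evalAt-1 x)) (ℤₚ.*-identityʳ _)))) (≈ᴾ⇒≈ᴱ (P *ᴾ 1ᴾ) (0ᴾ *ᴾ 1ᴾ) h x)

  *-oneʳ : ∀ a {b} → b ≡ ℤ.1ℤ → a ℤ.* b ≡ a
  *-oneʳ a refl = ℤₚ.*-identityʳ a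

  -- The denominators are iterated products of `1ᴾ`, so they take the value 1 everywhere and the
  -- fractions behave like their numerators.
  num-Σᶠ : ∀ s (f : Fin s → D) (g : Fin s → D) x →
    (⟦ den (Σᶠ s (λ j → fromPoly (f j) *ᶠ fromPoly (g j))) ⟧ x ≡ ℤ.1ℤ) ×
    (⟦ num (Σᶠ s (λ j → fromPoly (f j) *ᶠ fromPoly (g j))) ⟧ x ≡ sum (λ j → ⟦ f j ⟧ x ℤ.* ⟦ g j ⟧ x))
  num-Σᶠ zero    f g x = evalAt-1 x , refl
  num-Σᶠ (suc s) f g x with num-Σᶠ s (f ∘ Fin.suc) (g ∘ Fin.suc) x
  ... | den≡1 , num≡ = trans (evalAt-*ᴾ (1ᴾ *ᴾ 1ᴾ) (den rest) x) (cong₂ ℤ._*_ 11≡1 den≡1) ,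
    trans (evalAt-++ ((f Fin.zero *ᴾ g Fin.zero) *ᴾ den rest) (num rest *ᴾ (1ᴾ *ᴾ 1ᴾ)) x)
      (cong₂ ℤ._+_
        (trans (evalAt-*ᴾ (f Fin.zero *ᴾ g Fin.zero) (den rest) x)
          (trans (*-oneʳ (⟦ f Fin.zero *ᴾ g Fin.zero ⟧ x) den≡1) (evalAt-*ᴾ (f Fin.zero) (g Fin.zero) x)))
        (trans (evalAt-*ᴾ (num rest) (1ᴾ *ᴾ 1ᴾ) x) (trans (*-oneʳ (⟦ num rest ⟧ x) 11≡1) num≡)))
    where
    rest : Frac r
    rest = Σᶠ s (λ j → fromPoly (f (Fin.suc j)) *ᶠ fromPoly (g (Fin.suc j)))
    11≡1 : ⟦ 1ᴾ *ᴾ 1ᴾ ⟧ x ≡ ℤ.1ℤ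
    11≡1 = trans (evalAt-*ᴾ 1ᴾ 1ᴾ x) (cong₂ ℤ._*_ (evalAt-1 x) (evalAt-1 x))

  fromPoly-recurrence : ∀ s (c : ℕ → D) (lead : D) (a : ℕ → D) →
    (∀ x → ⟦ lead ⟧ x ℤ.* ⟦ a s ⟧ x ≡ ∑< s (λ j → ⟦ c j ⟧ x ℤ.* ⟦ a j ⟧ x)) →
    (fromPoly lead *ᶠ fromPoly (a s)) Defs.≈ Σᶠ s (λ j → fromPoly (c (toℕ j)) *ᶠ fromPoly (a (toℕ j)))
  fromPoly-recurrence s c lead a rel = ≈ᴱ⇒≈ᴾ ((lead *ᴾ a s) *ᴾ den rhs) (num rhs *ᴾ (1ᴾ *ᴾ 1ᴾ)) λ x → begin
    ⟦ (lead *ᴾ a s) *ᴾ den rhs ⟧ x            ≡⟨ evalAt-*ᴾ (lead *ᴾ a s) (den rhs) x ⟩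
    ⟦ lead *ᴾ a s ⟧ x ℤ.* ⟦ den rhs ⟧ x       ≡⟨ cong₂ ℤ._*_ (evalAt-*ᴾ lead (a s) x) (proj₁ (parts x)) ⟩
    (⟦ lead ⟧ x ℤ.* ⟦ a s ⟧ x) ℤ.* ℤ.1ℤ       ≡⟨ cong (λ z → z ℤ.* ℤ.1ℤ) (trans (rel x)
      (trans (sym (sum-toℕ s (λ j → ⟦ c j ⟧ x ℤ.* ⟦ a j ⟧ x))) (sym (proj₂ (parts x))))) ⟩
    ⟦ num rhs ⟧ x ℤ.* ℤ.1ℤ                    ≡⟨ cong (λ z → ⟦ num rhs ⟧ x ℤ.* z)
      (trans (evalAt-*ᴾ 1ᴾ 1ᴾ x) (cong₂ ℤ._*_ (evalAt-1 x) (evalAt-1 x))) ⟨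
    ⟦ num rhs ⟧ x ℤ.* ⟦ 1ᴾ *ᴾ 1ᴾ ⟧ x          ≡⟨ evalAt-*ᴾ (num rhs) (1ᴾ *ᴾ 1ᴾ) x ⟨
    ⟦ num rhs *ᴾ (1ᴾ *ᴾ 1ᴾ) ⟧ x               ∎
    where
    open ≡-Reasoning
    rhs : Frac r
    rhs = Σᶠ s (λ j → fromPoly (c (toℕ j)) *ᶠ fromPoly (a (toℕ j)))
    parts : ∀ x → (⟦ den rhs ⟧ x ≡ ℤ.1ℤ) × (⟦ num rhs ⟧ x ≡ sum {s} (λ j → ⟦ c (toℕ j) ⟧ x ℤ.* ⟦ a (toℕ j) ⟧ x))
    parts = num-Σᶠ s (λ j → c (toℕ j)) (λ j → a (toℕ j))

  -- `CFinite` and `C2Finite` hold the leading coefficient as the last member of the family of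
  -- coefficients, while the recurrences so far keep it apart.
  snoc : {A : Set} → ℕ → (ℕ → A) → A → ℕ → A
  snoc zero    c lead _       = lead
  snoc (suc s) c lead zero    = c 0
  snoc (suc s) c lead (suc j) = snoc s (c ∘ suc) lead j

  snoc-last : {A : Set} → ∀ s (c : ℕ → A) lead → snoc s c lead (toℕ (Fin.fromℕ s)) ≡ lead
  snoc-last zero    c lead = refl
  snoc-last (suc s) c lead = snoc-last s (c ∘ suc) lead

  snoc-init : {A : Set} → ∀ s (c : ℕ → A) lead (j : Fin s) → snoc s c lead (toℕ (Fin.inject₁ j)) ≡ c (toℕ j)
  snoc-init (suc s) c lead Fin.zero    = refl
  snoc-init (suc s) c lead (Fin.suc j) = snoc-init s (c ∘ suc) lead j

  snoc-all : {A : Set} (P : A → Set₁) → ∀ s (c : ℕ → A) lead → (∀ j → P (c j)) → P lead → ∀ j → P (snoc s c lead j)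
  snoc-all P zero    c lead h hl j       = hl
  snoc-all P (suc s) c lead h hl zero    = h 0
  snoc-all P (suc s) c lead h hl (suc j) = snoc-all P s (c ∘ suc) lead (h ∘ suc) hl j

  Σᶠ-cong : ∀ s {f g : Fin s → Frac r} → (∀ j → f j ≡ g j) → Σᶠ s f ≡ Σᶠ s g
  Σᶠ-cong zero    eq = refl
  Σᶠ-cong (suc s) eq = cong₂ _+ᶠ_ (eq Fin.zero) (Σᶠ-cong s (eq ∘ Fin.suc))

  snoc-recurrence : ∀ s (c : ℕ → D) (lead : D) (a : ℕ → D) →
    (∀ x → ⟦ lead ⟧ x ℤ.* ⟦ a s ⟧ x ≡ ∑< s (λ j → ⟦ c j ⟧ x ℤ.* ⟦ a j ⟧ x)) →
    (fromPoly (snoc s c lead (toℕ (Fin.fromℕ s))) *ᶠ fromPoly (a s)) Defs.≈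
    Σᶠ s (λ j → fromPoly (snoc s c lead (toℕ (Fin.inject₁ j))) *ᶠ fromPoly (a (toℕ j)))
  snoc-recurrence s c lead a rel = subst₂ Defs._≈_
    (cong (λ z → fromPoly z *ᶠ fromPoly (a s)) (sym (snoc-last s c lead)))
    (Σᶠ-cong s (λ j → cong (λ z → fromPoly z *ᶠ fromPoly (a (toℕ j))) (sym (snoc-init s c lead j))))
    (fromPoly-recurrence s c lead a rel)

  recognisable⇒CFinite : ∀ {a} → Recognisable a → CFinite (λ n → fromPoly (a n))
  recognisable⇒CFinite {a} R with recognisable-annihilated R
  ... | s₀ , c₀ , j , j≤s₀ , cj≉0 , ann₀ with trimTop {a} s₀ c₀ j j≤s₀ cj≉0 ann₀
  ...   | s , _ , cs≉0 , ann = (λ _ → 1ᴾ-valid) , s , (λ i → fromPoly (snoc s c (c₀ s) (toℕ i))) , (λ _ → 1ᴾ-valid) ,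
          subst (λ z → ¬ (fromPoly z Defs.≈ 0ᶠ)) (sym (snoc-last s c (c₀ s))) (fromPoly-nonzero {c₀ s} cs≉0) ,
          λ n _ → snoc-recurrence s c (c₀ s) (λ j → a (n ℕ.+ j)) (solved n)
    where
    c : ℕ → D
    c j = negᴾ (c₀ j)
    isolate : ∀ p q → q ≡ ℤ.- p ℤ.+ (p ℤ.+ q)
    isolate = solve-∀
    solved : ∀ n x → ⟦ c₀ s ⟧ x ℤ.* ⟦ a (n ℕ.+ s) ⟧ x ≡ ∑< s (λ j → ⟦ c j ⟧ x ℤ.* ⟦ a (n ℕ.+ j) ⟧ x)
    solved n x = trans (isolate (∑< s (λ j → ⟦ c₀ j ⟧ x ℤ.* ⟦ a (n ℕ.+ j) ⟧ x)) (⟦ c₀ s ⟧ x ℤ.* ⟦ a (n ℕ.+ s) ⟧ x))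
      (trans (+-zeroʳ _ (ann n x)) (trans (sym (ℤₚ.-1*i≡-i _)) (trans (∑<-*ˡ ℤ.-1ℤ s _)
        (∑<-cong s (λ j _ → trans (sym (ℤₚ.*-assoc ℤ.-1ℤ (⟦ c₀ j ⟧ x) _))
          (cong (λ z → z ℤ.* ⟦ a (n ℕ.+ j) ⟧ x) (trans (ℤₚ.-1*i≡-i (⟦ c₀ j ⟧ x)) (sym (evalAt-neg (c₀ j) x)))))))))

  recurrence⇒C2Finite : ∀ {a : Seq} → RecognisableRecurrence a → C2Finite (λ n → fromPoly (a n))
  recurrence⇒C2Finite {a} R = (λ _ → 1ᴾ-valid) , order ,
    (λ i n → fromPoly (snoc order c lead (toℕ i) n)) ,
    (λ i → recognisable⇒CFinite (snoc-all Recognisable order c lead rec leadRec (toℕ i))) ,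
    (λ n → subst (λ z → ¬ (fromPoly (z n) Defs.≈ 0ᶠ)) (sym (snoc-last order c lead)) (fromPoly-nonzero {lead n} (nonzero n))) ,
    λ n _ → subst₂ Defs._≈_
      (cong (λ z → fromPoly z *ᶠ fromPoly (a (n ℕ.+ order))) (trans (snoc-last order _ (lead n)) (sym (cong (λ z → z n) (snoc-last order c lead)))))
      (Σᶠ-cong order (λ j → cong (λ z → fromPoly z *ᶠ fromPoly (a (n ℕ.+ toℕ j)))
        (trans (snoc-init order _ (lead n) j) (sym (cong (λ z → z n) (snoc-init order c lead j))))))
      (snoc-recurrence order (λ j → c j n) (lead n) (λ j → a (n ℕ.+ j)) (holds n))
    where open RecognisableRecurrence R

  -- Vectors driven by matrices with C-finite entries

  module MatrixRecurrence {Q : Set} (qs : List Q) where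

    Matrix : Set
    Matrix = Q → Q → D

    infixr 7 _·_
    _·_ : Matrix → Matrix → Matrix
    (A · B) p q = ∑ᴾ qs (λ k → A p k *ᴾ B k q)

    apply : (Q → D) → (Q → Q → D) → Q → D
    apply u A q = ∑ᴾ qs (λ p → u p *ᴾ A p q)

    Maps : Matrix → (Q → D) → (Q → D) → Set
    Maps A v v′ = ∀ p x → ⟦ v′ p ⟧ x ≡ ∑ qs (λ q → ⟦ A p q ⟧ x ℤ.* ⟦ v q ⟧ x)

    ⟦∑ᴾ*⟧ : (f g : Q → D) → ∀ x → ⟦ ∑ᴾ qs (λ k → f k *ᴾ g k) ⟧ x ≡ ∑ qs (λ k → ⟦ f k ⟧ x ℤ.* ⟦ g k ⟧ x)
    ⟦∑ᴾ*⟧ f g x = trans (⟦∑ᴾ⟧ qs (λ k → f k *ᴾ g k) x) (∑-cong qs (λ k → evalAt-*ᴾ (f k) (g k) x))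

    reassociate : ∀ (f : Q → D) (B : Matrix) (v : Q → D) x →
      ∑ qs (λ k → ⟦ f k ⟧ x ℤ.* ∑ qs (λ q → ⟦ B k q ⟧ x ℤ.* ⟦ v q ⟧ x)) ≡
      ∑ qs (λ q → ⟦ ∑ᴾ qs (λ k → f k *ᴾ B k q) ⟧ x ℤ.* ⟦ v q ⟧ x)
    reassociate f B v x = begin
      ∑ qs (λ k → f′ k ℤ.* ∑ qs (λ q → B′ k q ℤ.* v′ q))
        ≡⟨ ∑-cong qs (λ k → trans (∑-*ˡ (f′ k) qs (λ q → B′ k q ℤ.* v′ q))
             (∑-cong qs (λ q → sym (ℤₚ.*-assoc (f′ k) (B′ k q) (v′ q))))) ⟩
      ∑ qs (λ k → ∑ qs (λ q → (f′ k ℤ.* B′ k q) ℤ.* v′ q))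
        ≡⟨ ∑-swap qs qs (λ k q → (f′ k ℤ.* B′ k q) ℤ.* v′ q) ⟩
      ∑ qs (λ q → ∑ qs (λ k → (f′ k ℤ.* B′ k q) ℤ.* v′ q))
        ≡⟨ ∑-cong qs (λ q → trans (sym (∑-*ʳ (v′ q) qs (λ k → f′ k ℤ.* B′ k q)))
             (cong (λ z → z ℤ.* v′ q) (sym (⟦∑ᴾ*⟧ f (λ k → B k q) x)))) ⟩
      ∑ qs (λ q → ⟦ ∑ᴾ qs (λ k → f k *ᴾ B k q) ⟧ x ℤ.* v′ q) ∎
      where
      open ≡-Reasoning
      f′ : Q → ℤ
      f′ k = ⟦ f k ⟧ x
      B′ : Q → Q → ℤ
      B′ k q = ⟦ B k q ⟧ x
      v′ : Q → ℤ
      v′ q = ⟦ v q ⟧ x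

    maps-· : ∀ {A B v v′ v″} → Maps B v v′ → Maps A v′ v″ → Maps (A · B) v v″
    maps-· {A} {B} {v} mB mA p x = trans (mA p x)
      (trans (∑-cong qs (λ k → cong (λ z → ⟦ A p k ⟧ x ℤ.* z) (mB k x))) (reassociate (A p) B v x))

    iterate : Matrix → Matrix → ℕ → Matrix
    iterate F L zero    = L
    iterate F L (suc n) = F · iterate F L n

    -- For fixed `q`, the column `q` of the matrices `iterate F L n` is itself the state of a linear
    -- system with matrix `F`.
    recognisable-iterate : ∀ A F L p q → Recognisable (λ n → (A · iterate F L n) p q)
    recognisable-iterate A F L p q = record
      { is = qs ; matrix = F ; out = A p ; state = λ n k → iterate F L n k q
      ; step = λ n k x → ⟦∑ᴾ*⟧ (F k) (λ j → iterate F L n j q) x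
      ; output = λ n x → ⟦∑ᴾ*⟧ (A p) (λ j → iterate F L n j q) x }

    -- The row in front of `v n` is `u` times the product of `M` at `n + t - 1` down to `n`. For
    -- fixed `t` this is a fixed number of shifted factors, so its entries are built from
    -- recognisable sequences by sums and products.
    matrixRecurrence⇒C2Finite : (M : ℕ → Matrix) → (∀ p q → Recognisable (λ n → M n p q)) →
      (v : ℕ → Q → D) → (∀ n → Maps (M n) (v n) (v (suc n))) →
      (u : Q → D) (a : Seq) → (∀ n x → ⟦ a n ⟧ x ≡ ∑ qs (λ q → ⟦ u q ⟧ x ℤ.* ⟦ v n q ⟧ x)) →
      C2Finite (λ n → fromPoly (a n))
    matrixRecurrence⇒C2Finite M M-rec v maps u a out =
      recurrence⇒C2Finite {a} (recurrence qs row row-rec a v rows)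
      where
      row : ℕ → ℕ → Q → D
      row zero    n = u
      row (suc t) n = apply (row t (suc n)) (M n)
      row-rec : ∀ t q → Recognisable (λ n → row t n q)
      row-rec zero    q = recognisable-const (u q)
      row-rec (suc t) q = recognisable-∑ qs (λ p → recognisable-* (recognisable-shift (row-rec t p)) (M-rec p q))
      rows : ∀ t n x → ⟦ a (n ℕ.+ t) ⟧ x ≡ ∑ qs (λ q → ⟦ row t n q ⟧ x ℤ.* ⟦ v n q ⟧ x)
      rows zero    n x = trans (cong (λ k → ⟦ a k ⟧ x) (ℕₚ.+-identityʳ n)) (out n x)
      rows (suc t) n x = trans (cong (λ k → ⟦ a k ⟧ x) (ℕₚ.+-suc n t)) (trans (rows t (suc n) x)
        (trans (∑-cong qs (λ k → cong (λ z → ⟦ row t (suc n) k ⟧ x ℤ.* z) (maps n k x)))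
          (reassociate (row t (suc n)) (M n) (v n) x)))

-- Types of formulas over labelled graphs

-- Unfolds to the same term as the private `feq`, so `sat` and `pairLab` reduce to expressions in
-- it.
_≟ᵇ_ : ∀ {n} → Fin n → Fin n → Bool
u ≟ᵇ v = ⌊ u Fin.≟ v ⌋

≟ᵇ⇒≡ : ∀ {n} (u v : Fin n) → (u ≟ᵇ v) ≡ true → u ≡ v
≟ᵇ⇒≡ u v eq with u Fin.≟ v
≟ᵇ⇒≡ u v eq | yes u≡v = u≡v
≟ᵇ⇒≡ u v () | no _

≟ᵇ-refl : ∀ {n} (u : Fin n) → (u ≟ᵇ u) ≡ true
≟ᵇ-refl u with u Fin.≟ u
... | yes _  = refl
... | no u≢u = ⊥-elim (u≢u refl)

≡⇒≟ᵇ : ∀ {n} {u v : Fin n} → u ≡ v → (u ≟ᵇ v) ≡ true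
≡⇒≟ᵇ refl = ≟ᵇ-refl _

≢⇒≟ᵇ : ∀ {n} (u v : Fin n) → u ≢ v → (u ≟ᵇ v) ≡ false
≢⇒≟ᵇ u v u≢v with u Fin.≟ v
... | yes u≡v = ⊥-elim (u≢v u≡v)
... | no _    = refl

≟ᵇ-suc : ∀ {n} (u v : Fin n) → (Fin.suc u ≟ᵇ Fin.suc v) ≡ (u ≟ᵇ v)
≟ᵇ-suc u v with u Fin.≟ v
... | yes _ = refl
... | no _  = refl

bool-ext : ∀ {a b} → (a ≡ true → b ≡ true) → (b ≡ true → a ≡ true) → a ≡ b
bool-ext {true}  {true}  f g = refl
bool-ext {true}  {false} f g = sym (f refl)
bool-ext {false} {true}  f g = g refl
bool-ext {false} {false} f g = refl

∧-intro : ∀ {a b} → a ≡ true → b ≡ true → a ∧ b ≡ true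
∧-intro refl refl = refl

∧-elim : ∀ {a b} → a ∧ b ≡ true → a ≡ true × b ≡ true
∧-elim {true} {true} refl = refl , refl

∨-introˡ : ∀ {a b} → a ≡ true → a ∨ b ≡ true
∨-introˡ refl = refl

∨-introʳ : ∀ {a b} → b ≡ true → a ∨ b ≡ true
∨-introʳ {true}  refl = refl
∨-introʳ {false} refl = refl

∨-elim : ∀ {a b} → a ∨ b ≡ true → a ≡ true ⊎ b ≡ true
∨-elim {true}  eq = inj₁ refl
∨-elim {false} eq = inj₂ eq

not-true : ∀ {a} → not a ≡ true → a ≡ false
not-true {false} refl = refl

not-intro : ∀ {a} → (a ≡ true → ⊥) → not a ≡ true
not-intro {true}  h = ⊥-elim (h refl)
not-intro {false} h = refl

true≢false : ∀ {a} → a ≡ true → a ≡ false → ⊥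
true≢false refl ()

module _ {A : Set} {f : A → Bool} where

  any-intro : ∀ {xs x} → x ∈ xs → f x ≡ true → any f xs ≡ true
  any-intro (here refl) eq = ∨-introˡ eq
  any-intro (there x∈)  eq = ∨-introʳ (any-intro x∈ eq)

  any-elim : ∀ xs → any f xs ≡ true → Σ A λ x → x ∈ xs × f x ≡ true
  any-elim (x ∷ xs) eq with ∨-elim {f x} eq
  ... | inj₁ fx = x , here refl , fx
  ... | inj₂ h with any-elim xs h
  ...   | y , y∈ , fy = y , there y∈ , fy

any-cong : {A : Set} {f g : A → Bool} → (∀ x → f x ≡ g x) → ∀ xs → any f xs ≡ any g xs
any-cong eq []       = refl
any-cong eq (x ∷ xs) = cong₂ _∨_ (eq x) (any-cong eq xs)

all≡not-any : {A : Set} (f : A → Bool) → ∀ xs → all f xs ≡ not (any (not ∘ f) xs)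
all≡not-any f []       = refl
all≡not-any f (x ∷ xs) with f x
... | true  = all≡not-any f xs
... | false = refl

anyFin : ∀ {n} → (Fin n → Bool) → Bool
anyFin {n} f = any f (allFin n)

anyFin-intro : ∀ {n} {f : Fin n → Bool} i → f i ≡ true → anyFin f ≡ true
anyFin-intro {f = f} i eq = any-intro {f = f} (∈-allFin i) eq

anyFin-elim : ∀ {n} {f : Fin n → Bool} → anyFin f ≡ true → Σ (Fin n) λ i → f i ≡ true
anyFin-elim {n} {f} eq with any-elim {f = f} (allFin n) eq
... | i , _ , fi = i , fi

anyFin-cong : ∀ {n} {f g : Fin n → Bool} → (∀ i → f i ≡ g i) → anyFin f ≡ anyFin g
anyFin-cong {n} eq = any-cong eq (allFin n)

module ∨Sum = ListSum Boolₚ.∨-commutativeMonoid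

any≡∑ : {A : Set} (f : A → Bool) → ∀ xs → any f xs ≡ ∨Sum.∑ xs f
any≡∑ f []       = refl
any≡∑ f (x ∷ xs) = cong (f x ∨_) (any≡∑ f xs)

bit : Bool → Fin 2
bit false = Fin.zero
bit true  = Fin.suc Fin.zero

unbit : Fin 2 → Bool
unbit Fin.zero    = false
unbit (Fin.suc _) = true

unbit-bit : ∀ b → unbit (bit b) ≡ b
unbit-bit false = refl
unbit-bit true  = refl

funToFin-cong : ∀ {m n} {f g : Fin m → Fin n} → f ≗ g → Fin.funToFin f ≡ Fin.funToFin g
funToFin-cong {zero}  eq = refl
funToFin-cong {suc m} eq = cong₂ Fin.combine (eq Fin.zero) (funToFin-cong (eq ∘ Fin.suc))

-- Subsets and pairs of types are coded as elements of `Fin`, which makes the set of types finite by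
-- construction. Afterwards they are handled only through the round-trip equations and congruence.
opaque
  powerSize : ℕ → ℕ
  powerSize n = 2 ℕ.^ n

  tabulateᵇ : ∀ {n} → (Fin n → Bool) → Fin (powerSize n)
  tabulateᵇ χ = Fin.funToFin (bit ∘ χ)

  readᵇ : ∀ {n} → Fin (powerSize n) → Fin n → Bool
  readᵇ s i = unbit (Fin.finToFun s i)

  readᵇ-tabulateᵇ : ∀ {n} (χ : Fin n → Bool) i → readᵇ (tabulateᵇ χ) i ≡ χ i
  readᵇ-tabulateᵇ χ i = trans (cong unbit (Finₚ.finToFun-funToFin (bit ∘ χ) i)) (unbit-bit (χ i))

  tabulateᵇ-cong : ∀ {n} {χ χ′ : Fin n → Bool} → χ ≗ χ′ → tabulateᵇ χ ≡ tabulateᵇ χ′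
  tabulateᵇ-cong eq = funToFin-cong (cong bit ∘ eq)

  pairSize : ℕ → ℕ → ℕ
  pairSize m n = m ℕ.* n

  pair : ∀ {m n} → Fin m → Fin n → Fin (pairSize m n)
  pair = Fin.combine

  first : ∀ {m n} → Fin (pairSize m n) → Fin m
  first {m} {n} s = proj₁ (Fin.remQuot {m} n s)

  second : ∀ {m n} → Fin (pairSize m n) → Fin n
  second {m} {n} s = proj₂ (Fin.remQuot {m} n s)

  first-pair : ∀ {m n} (i : Fin m) (j : Fin n) → first (pair i j) ≡ i
  first-pair i j = cong proj₁ (Finₚ.remQuot-combine i j)

  second-pair : ∀ {m n} (i : Fin m) (j : Fin n) → second (pair i j) ≡ j
  second-pair i j = cong proj₂ (Finₚ.remQuot-combine i j)

record Labelled (K n : ℕ) : Set where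
  field
    edge     : Fin n → Fin n → Bool
    edge-sym : ∀ u v → edge u v ≡ edge v u
    edge-irr : ∀ u → edge u u ≡ false
    lab      : Fin n → Fin K

  underlying : Graph
  underlying = record { N = n ; adj = edge ; adj-sym = edge-sym ; adj-irrefl = edge-irr }

  edgeCount : ℕ
  edgeCount = nEdges underlying
open Labelled public

incident : ∀ {n} → Fin n × Fin n → Fin n → Fin n → Bool
incident e u v = ((proj₁ e ≟ᵇ u) ∧ (proj₂ e ≟ᵇ v)) ∨ ((proj₁ e ≟ᵇ v) ∧ (proj₂ e ≟ᵇ u))

incident-sym : ∀ {n} (e : Fin n × Fin n) u v → incident e u v ≡ incident e v u
incident-sym e u v = Boolₚ.∨-comm ((proj₁ e ≟ᵇ u) ∧ (proj₂ e ≟ᵇ v)) _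

-- Stated for an arbitrary list of pairs so that induction on the list is possible. For the list of
-- edges of a graph it unfolds to the membership test that `sat` performs at `memB`.
chosen : ∀ {n} (es : List (Fin n × Fin n)) → Subset (length es) → Fin n → Fin n → Bool
chosen es S u v = any (λ i → Vec.lookup S i ∧ incident (List.lookup es i) u v) (allFin (length es))

chosen-sym : ∀ {n} (es : List (Fin n × Fin n)) S u v → chosen es S u v ≡ chosen es S v u
chosen-sym es S u v = any-cong (λ i → cong (Vec.lookup S i ∧_) (incident-sym (List.lookup es i) u v)) (allFin (length es))

edgeSet : ∀ {K n} (g : Labelled K n) → Subset (edgeCount g) → Fin n → Fin n → Bool
edgeSet g = chosen (edges (underlying g))

-- What a state records about a graph with assigned variables. Relation 0 is adjacency, relation i + 1
-- is the i-th edge set; labels are indexed by Fin K.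
data Query (K a b c : ℕ) : Set where
  labelled    : Fin a → Fin K → Query K a b c
  equal below : Fin a → Fin a → Query K a b c
  member      : Fin a → Fin b → Query K a b c
  related     : Fin (suc c) → Fin a → Fin a → Query K a b c
  joined      : Fin (suc c) → Fin K → Fin K → Query K a b c
  present     : Fin K → Query K a b c

allQueries : ∀ K a b c → List (Query K a b c)
allQueries K a b c =
  concatMap (λ x → List.map (labelled x) (allFin K)) (allFin a) List.++
  concatMap (λ x → List.map (equal x) (allFin a)) (allFin a) List.++
  concatMap (λ x → List.map (below x) (allFin a)) (allFin a) List.++
  concatMap (λ x → List.map (member x) (allFin b)) (allFin a) List.++
  concatMap (λ r → concatMap (λ x → List.map (related r x) (allFin a)) (allFin a)) (allFin (suc c)) List.++
  concatMap (λ r → concatMap (λ p → List.map (joined r p) (allFin K)) (allFin K)) (allFin (suc c)) List.++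
  List.map present (allFin K)

private
  ∈-concatMap-Fin : ∀ {A : Set} {n} {f : Fin n → List A} {z} i → z ∈ f i → z ∈ concatMap f (allFin n)
  ∈-concatMap-Fin {f = f} i z∈ = ∈-concatMap⁺ f (Any.map (λ { refl → z∈ }) (∈-allFin i))

  ∈-map-Fin : ∀ {A : Set} {n} (f : Fin n → A) i → f i ∈ List.map f (allFin n)
  ∈-map-Fin f i = ∈-map⁺ f (∈-allFin i)

∈-allQueries : ∀ {K a b c} (q : Query K a b c) → q ∈ allQueries K a b c
∈-allQueries {K} {a} {b} {c} = member∈
  where
  l₁ = concatMap (λ x → List.map (labelled {K} {a} {b} {c} x) (allFin K)) (allFin a)
  l₂ = concatMap (λ x → List.map (equal {K} {a} {b} {c} x) (allFin a)) (allFin a)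
  l₃ = concatMap (λ x → List.map (below {K} {a} {b} {c} x) (allFin a)) (allFin a)
  l₄ = concatMap (λ x → List.map (member {K} {a} {b} {c} x) (allFin b)) (allFin a)
  l₅ = concatMap (λ r → concatMap (λ x → List.map (related {K} {a} {b} {c} r x) (allFin a)) (allFin a)) (allFin (suc c))
  l₆ = concatMap (λ r → concatMap (λ p → List.map (joined {K} {a} {b} {c} r p) (allFin K)) (allFin K)) (allFin (suc c))
  member∈ : ∀ q → q ∈ allQueries K a b c
  member∈ (labelled x p)  = ∈-++⁺ˡ (∈-concatMap-Fin x (∈-map-Fin (labelled x) p))
  member∈ (equal x y)     = ∈-++⁺ʳ l₁ (∈-++⁺ˡ (∈-concatMap-Fin x (∈-map-Fin (equal x) y)))
  member∈ (below x y)     = ∈-++⁺ʳ l₁ (∈-++⁺ʳ l₂ (∈-++⁺ˡ (∈-concatMap-Fin x (∈-map-Fin (below x) y))))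
  member∈ (member x U)    = ∈-++⁺ʳ l₁ (∈-++⁺ʳ l₂ (∈-++⁺ʳ l₃ (∈-++⁺ˡ (∈-concatMap-Fin x (∈-map-Fin (member x) U)))))
  member∈ (related r x y) = ∈-++⁺ʳ l₁ (∈-++⁺ʳ l₂ (∈-++⁺ʳ l₃ (∈-++⁺ʳ l₄ (∈-++⁺ˡ
    (∈-concatMap-Fin {f = λ r → concatMap (λ x → List.map (related r x) (allFin a)) (allFin a)} r
      (∈-concatMap-Fin {f = λ x → List.map (related r x) (allFin a)} x (∈-map-Fin (related r x) y)))))))
  member∈ (joined r p q)  = ∈-++⁺ʳ l₁ (∈-++⁺ʳ l₂ (∈-++⁺ʳ l₃ (∈-++⁺ʳ l₄ (∈-++⁺ʳ l₅ (∈-++⁺ˡ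
    (∈-concatMap-Fin {f = λ r → concatMap (λ p → List.map (joined r p) (allFin K)) (allFin K)} r
      (∈-concatMap-Fin {f = λ p → List.map (joined r p) (allFin K)} p (∈-map-Fin (joined r p) q))))))))
  member∈ (present p)     = ∈-++⁺ʳ l₁ (∈-++⁺ʳ l₂ (∈-++⁺ʳ l₃ (∈-++⁺ʳ l₄ (∈-++⁺ʳ l₅ (∈-++⁺ʳ l₆ (∈-map-Fin present p))))))

Answers : ℕ → ℕ → ℕ → ℕ → Set
Answers K a b c = Query K a b c → Bool

opaque
  tableSize : ℕ → ℕ → ℕ → ℕ → ℕ
  tableSize K a b c = powerSize (length (allQueries K a b c))

  encode : ∀ {K a b c} → Answers K a b c → Fin (tableSize K a b c)
  encode {K} {a} {b} {c} χ = tabulateᵇ (χ ∘ List.lookup (allQueries K a b c))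

  decode : ∀ {K a b c} → Fin (tableSize K a b c) → Answers K a b c
  decode s q = readᵇ s (Any.index (∈-allQueries q))

  decode-encode : ∀ {K a b c} (χ : Answers K a b c) q → decode (encode χ) q ≡ χ q
  decode-encode {K} {a} {b} {c} χ q = trans
    (readᵇ-tabulateᵇ (χ ∘ List.lookup (allQueries K a b c)) (Any.index (∈-allQueries q)))
    (cong χ (sym (Anyₚ.lookup-index (∈-allQueries q))))

  encode-cong : ∀ {K a b c} {χ χ′ : Answers K a b c} → χ ≗ χ′ → encode χ ≡ encode χ′
  encode-cong {K} {a} {b} {c} eq = tabulateᵇ-cong (eq ∘ List.lookup (allQueries K a b c))

Table : ℕ → ℕ → ℕ → ℕ → Set
Table K a b c = Fin (tableSize K a b c)

-- Vertex variables may be unassigned: the vertex may not have been created yet.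
vertexValues : ∀ n → List (Maybe (Fin n))
vertexValues n = nothing ∷ List.map just (allFin n)

onBoth : ∀ {n} → (Fin n → Fin n → Bool) → Maybe (Fin n) → Maybe (Fin n) → Bool
onBoth R (just u) (just v) = R u v
onBoth R _        _        = false

module _ (em : Bool) {K n : ℕ} (g : Labelled K n) where

  relation : ∀ {c} → (Fin c → Subset (edgeCount g)) → Fin (suc c) → Fin n → Fin n → Bool
  relation ρB Fin.zero    = edge g
  relation ρB (Fin.suc i) = edgeSet g (ρB i)

  answer : ∀ {a b c} → (Fin a → Maybe (Fin n)) → (Fin b → Subset n) → (Fin c → Subset (edgeCount g)) →
    Answers K a b c
  answer ρx ρU ρB (labelled x p)  = maybe′ (λ u → lab g u ≟ᵇ p) false (ρx x)
  answer ρx ρU ρB (equal x y)     = onBoth _≟ᵇ_ (ρx x) (ρx y)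
  answer ρx ρU ρB (below x y)     = onBoth (λ u v → toℕ u ≤ᵇ toℕ v) (ρx x) (ρx y)
  answer ρx ρU ρB (member x U)    = maybe′ (Vec.lookup (ρU U)) false (ρx x)
  answer ρx ρU ρB (related r x y) = onBoth (relation ρB r) (ρx x) (ρx y)
  -- The flag `em` is set in the bounded case, where edge sets may occur. With the flag off this
  -- answer is constantly false, so that `Link` can leave it unchanged.
  answer ρx ρU ρB (joined r p q)  =
    em ∧ anyFin λ u → anyFin λ v → relation ρB r u v ∧ ((lab g u ≟ᵇ p) ∧ (lab g v ≟ᵇ q))
  answer ρx ρU ρB (present p)     = anyFin λ u → lab g u ≟ᵇ p

-- Formulas brought to the shape on which types are defined: a universal quantifier becomes a
-- negated existential one, a connective is any Boolean function, and the labels are available to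
-- atoms.
data Sentence (K a b c : ℕ) : Set where
  atom     : Query K a b c → Sentence K a b c
  binary   : (Bool → Bool → Bool) → Sentence K a b c → Sentence K a b c → Sentence K a b c
  negation : Sentence K a b c → Sentence K a b c
  existsX  : Sentence K (suc a) b c → Sentence K a b c
  existsU  : Sentence K a (suc b) c → Sentence K a b c
  existsB  : Sentence K a b (suc c) → Sentence K a b c

-- A quantifier contributes a table and a set of types of its body. The table is repeated at each
-- quantifier so that `info` can answer queries about all variables assigned so far; the admissible
-- bits depend on these answers.
card : ∀ {K a b c} → Sentence K a b c → ℕ
card {K} {a} {b} {c} (atom q) = tableSize K a b c
card (binary f φ ψ)           = pairSize (card φ) (card ψ)
card (negation φ)             = card φ
card {K} {a} {b} {c} (existsX φ) = pairSize (tableSize K a b c) (powerSize (card φ))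
card {K} {a} {b} {c} (existsU φ) = pairSize (tableSize K a b c) (powerSize (card φ))
card {K} {a} {b} {c} (existsB φ) = pairSize (tableSize K a b c) (powerSize (card φ))

info : ∀ {K a b c} (φ : Sentence K a b c) → Fin (card φ) → Table K a b c
info (atom q)       s = s
info (binary f φ ψ) s = info φ (first s)
info (negation φ)   s = info φ s
info (existsX φ)    s = first s
info (existsU φ)    s = first s
info (existsB φ)    s = first s

-- An assigned vertex always has a label and an unassigned variable never does, so assignment can be
-- read from the label queries.
placed : ∀ {K a b c} → Fin a → Answers K a b c → Bool
placed x χ = anyFin λ p → χ (labelled x p)

accepts : ∀ {K a b c} (φ : Sentence K a b c) → Fin (card φ) → Bool
accepts (atom q)       s = decode s q
accepts (binary f φ ψ) s = f (accepts φ (first s)) (accepts ψ (second s))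
accepts (negation φ)   s = not (accepts φ s)
-- The recorded set also contains the type for the unassigned value, which must not count as a
-- witness.
accepts (existsX φ)    s = anyFin λ q → readᵇ (second s) q ∧
  (placed Fin.zero (decode (info φ q)) ∧ accepts φ q)
accepts (existsU φ)    s = anyFin λ q → readᵇ (second s) q ∧ accepts φ q
accepts (existsB φ)    s = anyFin λ q → readᵇ (second s) q ∧ accepts φ q

typeOf : (em : Bool) → ∀ {K n a b c} (φ : Sentence K a b c) (g : Labelled K n) →
  (Fin a → Maybe (Fin n)) → (Fin b → Subset n) → (Fin c → Subset (edgeCount g)) → Fin (card φ)
typeOf em (atom q)       g ρx ρU ρB = encode (answer em g ρx ρU ρB)
typeOf em (binary f φ ψ) g ρx ρU ρB = pair (typeOf em φ g ρx ρU ρB) (typeOf em ψ g ρx ρU ρB)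
typeOf em (negation φ)   g ρx ρU ρB = typeOf em φ g ρx ρU ρB
typeOf em {n = n} (existsX φ) g ρx ρU ρB = pair (encode (answer em g ρx ρU ρB))
  (tabulateᵇ λ q → any (λ v → typeOf em φ g (v VF.∷ ρx) ρU ρB ≟ᵇ q) (vertexValues n))
typeOf em {n = n} (existsU φ) g ρx ρU ρB = pair (encode (answer em g ρx ρU ρB))
  (tabulateᵇ λ q → any (λ S → typeOf em φ g ρx (S VF.∷ ρU) ρB ≟ᵇ q) (allSubsets n))
typeOf em (existsB φ) g ρx ρU ρB = pair (encode (answer em g ρx ρU ρB))
  (tabulateᵇ λ q → any (λ S → typeOf em φ g ρx ρU (S VF.∷ ρB) ≟ᵇ q) (allSubsets (edgeCount g)))

info-typeOf : ∀ em {K n a b c} (φ : Sentence K a b c) (g : Labelled K n) ρx ρU ρB →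
  info φ (typeOf em φ g ρx ρU ρB) ≡ encode (answer em g ρx ρU ρB)
info-typeOf em (atom q)       g ρx ρU ρB = refl
info-typeOf em (binary f φ ψ) g ρx ρU ρB =
  trans (cong (info φ) (first-pair (typeOf em φ g ρx ρU ρB) (typeOf em ψ g ρx ρU ρB)))
    (info-typeOf em φ g ρx ρU ρB)
info-typeOf em (negation φ)   g ρx ρU ρB = info-typeOf em φ g ρx ρU ρB
info-typeOf em (existsX φ)    g ρx ρU ρB = first-pair (encode (answer em g ρx ρU ρB)) _
info-typeOf em (existsU φ)    g ρx ρU ρB = first-pair (encode (answer em g ρx ρU ρB)) _
info-typeOf em (existsB φ)    g ρx ρU ρB = first-pair (encode (answer em g ρx ρU ρB)) _

decode-info : ∀ em {K n a b c} (φ : Sentence K a b c) (g : Labelled K n) ρx ρU ρB q →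
  decode (info φ (typeOf em φ g ρx ρU ρB)) q ≡ answer em g ρx ρU ρB q
decode-info em φ g ρx ρU ρB q =
  trans (cong (λ s → decode s q) (info-typeOf em φ g ρx ρU ρB)) (decode-encode (answer em g ρx ρU ρB) q)

any-fibres : ∀ {A : Set} {n} (t : A → Fin n) (h : Fin n → Bool) (xs : List A) →
  anyFin (λ q → any (λ v → t v ≟ᵇ q) xs ∧ h q) ≡ any (h ∘ t) xs
any-fibres {A} {n} t h xs = bool-ext to from
  where
  to : anyFin (λ q → any (λ v → t v ≟ᵇ q) xs ∧ h q) ≡ true → any (h ∘ t) xs ≡ true
  to eq with anyFin-elim {f = λ q → any (λ v → t v ≟ᵇ q) xs ∧ h q} eq
  ... | q , eq′ with any-elim {f = λ v → t v ≟ᵇ q} xs (proj₁ (∧-elim eq′))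
  ...   | v , v∈ , tv = any-intro {f = h ∘ t} v∈ (trans (cong h (≟ᵇ⇒≡ (t v) q tv)) (proj₂ (∧-elim {any (λ v → t v ≟ᵇ q) xs} eq′)))
  from : any (h ∘ t) xs ≡ true → anyFin (λ q → any (λ v → t v ≟ᵇ q) xs ∧ h q) ≡ true
  from eq with any-elim {f = h ∘ t} xs eq
  ... | v , v∈ , hv = anyFin-intro {f = λ q → any (λ v → t v ≟ᵇ q) xs ∧ h q} (t v)
    (∧-intro (any-intro {f = λ v′ → t v′ ≟ᵇ t v} v∈ (≟ᵇ-refl (t v))) hv)

read-typeSet : ∀ {A : Set} {m n} (i : Fin m) (t : A → Fin n) (xs : List A) q →
  readᵇ (second (pair i (tabulateᵇ λ q → any (λ v → t v ≟ᵇ q) xs))) q ≡ any (λ v → t v ≟ᵇ q) xs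
read-typeSet i t xs q = trans (cong (λ s → readᵇ s q) (second-pair i (tabulateᵇ λ q → any (λ v → t v ≟ᵇ q) xs)))
  (readᵇ-tabulateᵇ (λ q → any (λ v → t v ≟ᵇ q) xs) q)

placed-answer : ∀ em {K n a b c} (g : Labelled K n) (ρx : Fin a → Maybe (Fin n)) (ρU : Fin b → Subset n)
  (ρB : Fin c → Subset (edgeCount g)) x (χ : Answers K a b c) → χ ≗ answer em g ρx ρU ρB →
  placed x χ ≡ maybe′ (λ _ → true) false (ρx x)
placed-answer em g ρx ρU ρB x χ eq with ρx x in eqx
... | just u  = anyFin-intro {f = λ p → χ (labelled x p)} (lab g u)
  (trans (eq (labelled x (lab g u))) (trans (cong (maybe′ _ false) eqx) (≟ᵇ-refl (lab g u))))
... | nothing = bool-ext (λ h → ⊥-elim (unplaced (anyFin-elim {f = λ p → χ (labelled x p)} h))) (λ ())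
  where
  unplaced : Σ _ (λ p → χ (labelled x p) ≡ true) → ⊥
  unplaced (p , h) = true≢false h (trans (eq (labelled x p)) (cong (maybe′ _ false) eqx))

translate : ∀ {K a b c} → Form a b c → Sentence K a b c
translate (x ≐ y)      = atom (equal x y)
translate (edgeA x y)  = atom (related Fin.zero x y)
translate (x ≤ₓ y)     = atom (below x y)
translate (x ∈U U)     = atom (member x U)
translate (memB x y B) = atom (related (Fin.suc B) x y)
translate (φ ∨ᶠ ψ)     = binary _∨_ (translate φ) (translate ψ)
translate (φ ∧ᶠ ψ)     = binary _∧_ (translate φ) (translate ψ)
translate (φ ⇒ᶠ ψ)     = binary (λ p q → not p ∨ q) (translate φ) (translate ψ)
translate (¬ᶠ φ)       = negation (translate φ)
translate (∃x φ)       = existsX (translate φ)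
translate (∀x φ)       = negation (existsX (negation (translate φ)))
translate (∃U φ)       = existsU (translate φ)
translate (∀U φ)       = negation (existsU (negation (translate φ)))
translate (∃B φ)       = existsB (translate φ)
translate (∀B φ)       = negation (existsB (negation (translate φ)))

-- Satisfaction read off from types

module Correctness (em : Bool) {K n : ℕ} (g : Labelled K n) where

  Accepts : ∀ {a b c} → Sentence K a b c → (Fin a → Maybe (Fin n)) → (Fin b → Subset n) →
    (Fin c → Subset (edgeCount g)) → Bool
  Accepts φ ρx ρU ρB = accepts φ (typeOf em φ g ρx ρU ρB)

  accepts-binary : ∀ {a b c} f (φ ψ : Sentence K a b c) ρx ρU ρB →
    Accepts (binary f φ ψ) ρx ρU ρB ≡ f (Accepts φ ρx ρU ρB) (Accepts ψ ρx ρU ρB)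
  accepts-binary f φ ψ ρx ρU ρB = cong₂ (λ s t → f (accepts φ s) (accepts ψ t))
    (first-pair (typeOf em φ g ρx ρU ρB) (typeOf em ψ g ρx ρU ρB))
    (second-pair (typeOf em φ g ρx ρU ρB) (typeOf em ψ g ρx ρU ρB))

  accepts-existsU : ∀ {a b c} (φ : Sentence K a (suc b) c) ρx ρU ρB →
    Accepts (existsU φ) ρx ρU ρB ≡ any (λ S → Accepts φ ρx (S VF.∷ ρU) ρB) (allSubsets n)
  accepts-existsU φ ρx ρU ρB = trans
    (anyFin-cong (λ q → cong (_∧ accepts φ q) (read-typeSet (encode (answer em g ρx ρU ρB)) t (allSubsets n) q)))
    (any-fibres t (accepts φ) (allSubsets n))
    where
    t : Subset n → Fin (card φ)
    t S = typeOf em φ g ρx (S VF.∷ ρU) ρB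

  accepts-existsB : ∀ {a b c} (φ : Sentence K a b (suc c)) ρx ρU ρB →
    Accepts (existsB φ) ρx ρU ρB ≡ any (λ S → Accepts φ ρx ρU (S VF.∷ ρB)) (allSubsets (edgeCount g))
  accepts-existsB φ ρx ρU ρB = trans
    (anyFin-cong (λ q → cong (_∧ accepts φ q) (read-typeSet (encode (answer em g ρx ρU ρB)) t (allSubsets (edgeCount g)) q)))
    (any-fibres t (accepts φ) (allSubsets (edgeCount g)))
    where
    t : Subset (edgeCount g) → Fin (card φ)
    t S = typeOf em φ g ρx ρU (S VF.∷ ρB)

  accepts-existsX : ∀ {a b c} (φ : Sentence K (suc a) b c) ρx ρU ρB →
    Accepts (existsX φ) ρx ρU ρB ≡ any (λ u → Accepts φ (just u VF.∷ ρx) ρU ρB) (allFin n)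
  accepts-existsX φ ρx ρU ρB = begin
    Accepts (existsX φ) ρx ρU ρB
      ≡⟨ anyFin-cong (λ q → cong (_∧ h q) (read-typeSet (encode (answer em g ρx ρU ρB)) t (vertexValues n) q)) ⟩
    anyFin (λ q → any (λ v → t v ≟ᵇ q) (vertexValues n) ∧ h q)
      ≡⟨ any-fibres t h (vertexValues n) ⟩
    h (t nothing) ∨ any (h ∘ t) (List.map just (allFin n))
      ≡⟨ cong₂ _∨_ (cong (_∧ accepts φ (t nothing)) (placed-t nothing)) (any-just (allFin n)) ⟩
    any (λ u → Accepts φ (just u VF.∷ ρx) ρU ρB) (allFin n) ∎
    where
    open ≡-Reasoning
    t : Maybe (Fin n) → Fin (card φ)
    t v = typeOf em φ g (v VF.∷ ρx) ρU ρB
    h : Fin (card φ) → Bool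
    h q = placed Fin.zero (decode (info φ q)) ∧ accepts φ q
    placed-t : ∀ v → placed Fin.zero (decode (info φ (t v))) ≡ maybe′ (λ _ → true) false v
    placed-t v = placed-answer em g (v VF.∷ ρx) ρU ρB Fin.zero (decode (info φ (t v)))
      (decode-info em φ g (v VF.∷ ρx) ρU ρB)
    any-just : ∀ us → any (h ∘ t) (List.map just us) ≡ any (λ u → accepts φ (t (just u))) us
    any-just []       = refl
    any-just (u ∷ us) = cong₂ _∨_ (cong (_∧ accepts φ (t (just u))) (placed-t (just u))) (any-just us)

  Assigns : ∀ {a} → (Fin a → Maybe (Fin n)) → (Fin a → Fin n) → Set
  Assigns ρx σ = ∀ i → ρx i ≡ just (σ i)

  assigns-∷ : ∀ {a} {ρx : Fin a → Maybe (Fin n)} {σ} u → Assigns ρx σ → Assigns (just u VF.∷ ρx) (u VF.∷ σ)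
  assigns-∷ u h Fin.zero    = refl
  assigns-∷ u h (Fin.suc i) = h i

  decode-atom : ∀ {a b c} (q : Query K a b c) ρx ρU ρB → Accepts (atom q) ρx ρU ρB ≡ answer em g ρx ρU ρB q
  decode-atom q ρx ρU ρB = decode-encode (answer em g ρx ρU ρB) q

  accepts≡sat : ∀ {a b c} (φ : Form a b c) {ρx} {σ} → Assigns ρx σ → ∀ ρU ρB →
    Accepts (translate φ) ρx ρU ρB ≡ sat (underlying g) φ σ ρU ρB
  accepts≡sat (x ≐ y)      {ρx} h ρU ρB = trans (decode-atom (equal x y) ρx ρU ρB) (cong₂ (onBoth _≟ᵇ_) (h x) (h y))
  accepts≡sat (edgeA x y)  {ρx} h ρU ρB = trans (decode-atom (related Fin.zero x y) ρx ρU ρB) (cong₂ (onBoth (edge g)) (h x) (h y))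
  accepts≡sat (x ≤ₓ y)     {ρx} h ρU ρB = trans (decode-atom (below x y) ρx ρU ρB) (cong₂ (onBoth (λ u v → toℕ u ≤ᵇ toℕ v)) (h x) (h y))
  accepts≡sat (x ∈U U)     {ρx} h ρU ρB = trans (decode-atom (member x U) ρx ρU ρB) (cong (maybe′ (Vec.lookup (ρU U)) false) (h x))
  accepts≡sat (memB x y B) {ρx} h ρU ρB = trans (decode-atom (related (Fin.suc B) x y) ρx ρU ρB)
    (cong₂ (onBoth (edgeSet g (ρB B))) (h x) (h y))
  accepts≡sat (φ ∨ᶠ ψ)     {ρx} h ρU ρB = trans (accepts-binary _∨_ (translate φ) (translate ψ) ρx ρU ρB)
    (cong₂ _∨_ (accepts≡sat φ h ρU ρB) (accepts≡sat ψ h ρU ρB))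
  accepts≡sat (φ ∧ᶠ ψ)     {ρx} h ρU ρB = trans (accepts-binary _∧_ (translate φ) (translate ψ) ρx ρU ρB)
    (cong₂ _∧_ (accepts≡sat φ h ρU ρB) (accepts≡sat ψ h ρU ρB))
  accepts≡sat (φ ⇒ᶠ ψ)     {ρx} h ρU ρB = trans (accepts-binary (λ p q → not p ∨ q) (translate φ) (translate ψ) ρx ρU ρB)
    (cong₂ (λ p q → not p ∨ q) (accepts≡sat φ h ρU ρB) (accepts≡sat ψ h ρU ρB))
  accepts≡sat (¬ᶠ φ)       h ρU ρB = cong not (accepts≡sat φ h ρU ρB)
  accepts≡sat (∃x φ) {ρx} {σ} h ρU ρB = trans (accepts-existsX (translate φ) ρx ρU ρB)
    (any-cong (λ u → accepts≡sat φ (assigns-∷ {σ = σ} u h) ρU ρB) (allFin n))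
  accepts≡sat (∀x φ) {ρx} {σ} h ρU ρB = trans (cong not (trans (accepts-existsX (negation (translate φ)) ρx ρU ρB)
    (any-cong (λ u → cong not (accepts≡sat φ (assigns-∷ {σ = σ} u h) ρU ρB)) (allFin n))))
    (sym (all≡not-any _ (allFin n)))
  accepts≡sat (∃U φ) {ρx} h ρU ρB = trans (accepts-existsU (translate φ) ρx ρU ρB)
    (any-cong (λ S → accepts≡sat φ h (S VF.∷ ρU) ρB) (allSubsets n))
  accepts≡sat (∀U φ) {ρx} h ρU ρB = trans (cong not (trans (accepts-existsU (negation (translate φ)) ρx ρU ρB)
    (any-cong (λ S → cong not (accepts≡sat φ h (S VF.∷ ρU) ρB)) (allSubsets n))))
    (sym (all≡not-any _ (allSubsets n)))
  accepts≡sat (∃B φ) {ρx} h ρU ρB = trans (accepts-existsB (translate φ) ρx ρU ρB)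
    (any-cong (λ S → accepts≡sat φ h ρU (S VF.∷ ρB)) (allSubsets (edgeCount g)))
  accepts≡sat (∀B φ) {ρx} h ρU ρB = trans (cong not (trans (accepts-existsB (negation (translate φ)) ρx ρU ρB)
    (any-cong (λ S → cong not (accepts≡sat φ h ρU (S VF.∷ ρB))) (allSubsets (edgeCount g)))))
    (sym (all≡not-any _ (allSubsets (edgeCount g))))

-- How types and assignments change in one step

bools : List Bool
bools = false ∷ true ∷ []

-- Every value upstairs arises from exactly one value downstairs together with an admissible choice.
record Decomposes {A A′ C : Set} (xs : List A) (xs′ : List A′) (cs : List C)
                  (R : C → A → A′ → Set) (ok : C → A → Bool) : Set₁ where
  constructor decomposes
  field
    regroup : (M : CommutativeMonoid 0ℓ 0ℓ) →
      let open CommutativeMonoid M using (Carrier; ε) renaming (_≈_ to _≋_) in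
      (f′ : A′ → Carrier) (f : C → A → Carrier) →
      (∀ c v v′ → R c v v′ → ok c v ≡ true → f′ v′ ≋ f c v) →
      ListSum.∑ M xs′ f′ ≋ ListSum.∑ M xs (λ v → ListSum.∑ M cs (λ c → if ok c v then f c v else ε))
open Decomposes public

decomposes-any : ∀ {A A′ : Set} {xs : List A} {xs′ : List A′} {R ok} → Decomposes xs xs′ bools R ok →
  (f′ : A′ → Bool) (f : Bool → A → Bool) → (∀ c v v′ → R c v v′ → ok c v ≡ true → f′ v′ ≡ f c v) →
  any f′ xs′ ≡ any (λ v → any (λ c → ok c v ∧ f c v) bools) xs
decomposes-any {xs = xs} {xs′} {R} {ok} dec f′ f h = begin
  any f′ xs′ ≡⟨ any≡∑ f′ xs′ ⟩
  ∨Sum.∑ xs′ f′ ≡⟨ regroup dec Boolₚ.∨-commutativeMonoid f′ f h ⟩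
  ∨Sum.∑ xs (λ v → ∨Sum.∑ bools (λ c → if ok c v then f c v else false))
    ≡⟨ ∨Sum.∑-cong xs (λ v → trans (∨Sum.∑-cong bools (λ c → if-∧ (ok c v) (f c v))) (sym (any≡∑ (λ c → ok c v ∧ f c v) bools))) ⟩
  ∨Sum.∑ xs (λ v → any (λ c → ok c v ∧ f c v) bools) ≡⟨ any≡∑ (λ v → any (λ c → ok c v ∧ f c v) bools) xs ⟨
  any (λ v → any (λ c → ok c v ∧ f c v) bools) xs ∎
  where
  open ≡-Reasoning
  if-∧ : ∀ a b → (if a then b else false) ≡ a ∧ b
  if-∧ true  b = refl
  if-∧ false b = refl

-- All components are computed from answers, without access to the graph. A bit says of a variable
-- whether it takes the element being created: for a vertex variable the new vertex itself, for a
-- set variable the new vertex or edge as a member.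
record Update (K : ℕ) : Set where
  field
    okX : ∀ {a b c} → Fin a → Bool → Answers K a b c → Bool
    okU : ∀ {a b c} → Fin b → Bool → Answers K a b c → Bool
    okB : ∀ {a b c} → Fin c → Bool → Answers K a b c → Bool
    new : ∀ {a b c} → (Fin a → Bool) → (Fin b → Bool) → (Fin c → Bool) → Answers K a b c → Answers K a b c

bitℕ : Bool → ℕ
bitℕ b = if b then 1 else 0

-- Soundness of an update for a particular pair of graphs. The size equations make a step multiply
-- each monomial by a factor that depends on the bits alone, which becomes an entry of
-- `updateMatrix`. A decomposition of edge sets is demanded only under `em`: when `Link` creates
-- many edges at once, one bit cannot describe how a set of edges grows.
record Step (em : Bool) {K n n′ : ℕ} (g : Labelled K n) (g′ : Labelled K n′) (υ : Update K) : Set₁ where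
  open Update υ
  field
    RX  : Bool → Maybe (Fin n) → Maybe (Fin n′) → Set
    RU  : Bool → Subset n → Subset n′ → Set
    RB  : Bool → Subset (edgeCount g) → Subset (edgeCount g′) → Set
    okx : Bool → Maybe (Fin n) → Bool
    oku : Bool → Subset n → Bool
    okb : Bool → Subset (edgeCount g) → Bool
    decX  : Decomposes (vertexValues n) (vertexValues n′) bools RX okx
    decU  : Decomposes (allSubsets n) (allSubsets n′) bools RU oku
    decB  : em ≡ true → Decomposes (allSubsets (edgeCount g)) (allSubsets (edgeCount g′)) bools RB okb
    sizeU : ∀ {c S S′} → RU c S S′ → ∣ S′ ∣ ≡ bitℕ c ℕ.+ ∣ S ∣
    sizeB : ∀ {c S S′} → RB c S S′ → ∣ S′ ∣ ≡ bitℕ c ℕ.+ ∣ S ∣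
    okX≡  : ∀ {a b c ρx ρU ρB} (χ : Answers K a b c) → χ ≗ answer em g ρx ρU ρB → ∀ i β → okX i β χ ≡ okx β (ρx i)
    okU≡  : ∀ {a b c ρx ρU ρB} (χ : Answers K a b c) → χ ≗ answer em g ρx ρU ρB → ∀ i β → okU i β χ ≡ oku β (ρU i)
    okB≡  : em ≡ true → ∀ {a b c ρx ρU ρB} (χ : Answers K a b c) → χ ≗ answer em g ρx ρU ρB → ∀ i β → okB i β χ ≡ okb β (ρB i)
    new≡  : ∀ {a b c ρx ρU ρB ρx′ ρU′ ρB′} βx βU βB → (∀ i → RX (βx i) (ρx i) (ρx′ i)) →
      (∀ i → RU (βU i) (ρU i) (ρU′ i)) → (∀ i → RB (βB i) (ρB i) (ρB′ i)) →
      (χ : Answers K a b c) → χ ≗ answer em g ρx ρU ρB → answer em g′ ρx′ ρU′ ρB′ ≗ new βx βU βB χ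

module Transition {K : ℕ} (υ : Update K) where
  open Update υ

  -- The bits of the free variables are given from outside. For a bound variable both bits are
  -- tried, and admissibility is read from the type of the body, in which that variable is still
  -- free.
  transition : ∀ {a b c} (φ : Sentence K a b c) → (Fin a → Bool) → (Fin b → Bool) → (Fin c → Bool) →
    Fin (card φ) → Fin (card φ)
  transition (atom q)       βx βU βB s = encode (new βx βU βB (decode s))
  transition (binary f φ ψ) βx βU βB s = pair (transition φ βx βU βB (first s)) (transition ψ βx βU βB (second s))
  transition (negation φ)   βx βU βB s = transition φ βx βU βB s
  transition (existsX φ)    βx βU βB s = pair (encode (new βx βU βB (decode (first s))))
    (tabulateᵇ λ q′ → anyFin λ q → readᵇ (second s) q ∧
      any (λ β → okX Fin.zero β (decode (info φ q)) ∧ (transition φ (β VF.∷ βx) βU βB q ≟ᵇ q′)) bools)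
  transition (existsU φ)    βx βU βB s = pair (encode (new βx βU βB (decode (first s))))
    (tabulateᵇ λ q′ → anyFin λ q → readᵇ (second s) q ∧
      any (λ β → okU Fin.zero β (decode (info φ q)) ∧ (transition φ βx (β VF.∷ βU) βB q ≟ᵇ q′)) bools)
  transition (existsB φ)    βx βU βB s = pair (encode (new βx βU βB (decode (first s))))
    (tabulateᵇ λ q′ → anyFin λ q → readᵇ (second s) q ∧
      any (λ β → okB Fin.zero β (decode (info φ q)) ∧ (transition φ βx βU (β VF.∷ βB) q ≟ᵇ q′)) bools)

BFree : ∀ {K a b c} → Sentence K a b c → Set
BFree (atom q)       = ⊤
BFree (binary f φ ψ) = BFree φ × BFree ψ
BFree (negation φ)   = BFree φ
BFree (existsX φ)    = BFree φ
BFree (existsU φ)    = BFree φ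
BFree (existsB φ)    = ⊥

edgeFree⇒BFree : ∀ {K a b c} (φ : Form a b c) → EdgeFree φ → BFree (translate {K} φ)
edgeFree⇒BFree (x ≐ y)     h       = tt
edgeFree⇒BFree (edgeA x y) h       = tt
edgeFree⇒BFree (x ≤ₓ y)    h       = tt
edgeFree⇒BFree (x ∈U U)    h       = tt
edgeFree⇒BFree (φ ∨ᶠ ψ)    (h , k) = edgeFree⇒BFree φ h , edgeFree⇒BFree ψ k
edgeFree⇒BFree (φ ∧ᶠ ψ)    (h , k) = edgeFree⇒BFree φ h , edgeFree⇒BFree ψ k
edgeFree⇒BFree (φ ⇒ᶠ ψ)    (h , k) = edgeFree⇒BFree φ h , edgeFree⇒BFree ψ k
edgeFree⇒BFree (¬ᶠ φ)      h       = edgeFree⇒BFree φ h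
edgeFree⇒BFree (∃x φ)      h       = edgeFree⇒BFree φ h
edgeFree⇒BFree (∀x φ)      h       = edgeFree⇒BFree φ h
edgeFree⇒BFree (∃U φ)      h       = edgeFree⇒BFree φ h
edgeFree⇒BFree (∀U φ)      h       = edgeFree⇒BFree φ h

cons-related : ∀ {A A′ : Set} {a} {R : Bool → A → A′ → Set} {β v v′} {βs : Fin a → Bool} {vs : Fin a → A} {vs′ : Fin a → A′} →
  R β v v′ → (∀ i → R (βs i) (vs i) (vs′ i)) → ∀ i → R ((β VF.∷ βs) i) ((v VF.∷ vs) i) ((v′ VF.∷ vs′) i)
cons-related r rs Fin.zero    = r
cons-related r rs (Fin.suc i) = rs i

module StepTransition {em : Bool} {K n n′ : ℕ} {g : Labelled K n} {g′ : Labelled K n′} {υ : Update K}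
                      (st : Step em g g′ υ) where
  open Step st
  open Update υ
  open Transition υ

  decode-new : ∀ {a b c} {ρx ρU ρB ρx′ ρU′ ρB′} βx βU βB → (∀ i → RX (βx i) (ρx i) (ρx′ i)) →
    (∀ i → RU (βU i) (ρU i) (ρU′ i)) → (∀ i → RB (βB i) (ρB i) (ρB′ i)) →
    (s : Fin (tableSize K a b c)) → s ≡ encode (answer em g ρx ρU ρB) →
    encode (new βx βU βB (decode s)) ≡ encode (answer em g′ ρx′ ρU′ ρB′)
  decode-new βx βU βB rx rU rB s refl =
    encode-cong (λ q → sym (new≡ βx βU βB rx rU rB _ (decode-encode _) q))

  -- The decomposition is used in the monoid of Booleans under disjunction: a type is realised after
  -- the step iff it is the image, under an admissible bit, of one realised before.
  typeSet-step : ∀ {A A′ : Set} {m k} {xs : List A} {xs′ : List A′} {R ok} → Decomposes xs xs′ bools R ok →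
    (i : Fin m) (t : A → Fin k) (t′ : A′ → Fin k) (δ′ : Bool → Fin k → Fin k) (okq : Bool → Fin k → Bool) →
    (∀ β v → okq β (t v) ≡ ok β v) →
    (∀ β v v′ → R β v v′ → δ′ β (t v) ≡ t′ v′) →
    tabulateᵇ (λ q′ → anyFin λ q → readᵇ (second (pair i (tabulateᵇ λ q → any (λ v → t v ≟ᵇ q) xs))) q ∧
      any (λ β → okq β q ∧ (δ′ β q ≟ᵇ q′)) bools)
    ≡ tabulateᵇ (λ q′ → any (λ v′ → t′ v′ ≟ᵇ q′) xs′)
  typeSet-step {xs = xs} {xs′} {R} {ok} dec i t t′ δ′ okq okq≡ δ≡ = tabulateᵇ-cong λ q′ → begin
    (anyFin λ q → readᵇ (second (pair i (tabulateᵇ λ q → any (λ v → t v ≟ᵇ q) xs))) q ∧ h q′ q)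
      ≡⟨ anyFin-cong (λ q → cong (_∧ h q′ q) (read-typeSet i t xs q)) ⟩
    (anyFin λ q → any (λ v → t v ≟ᵇ q) xs ∧ h q′ q)
      ≡⟨ any-fibres t (h q′) xs ⟩
    any (λ v → h q′ (t v)) xs
      ≡⟨ any-cong (λ v → any-cong (λ β → cong (_∧ (δ′ β (t v) ≟ᵇ q′)) (okq≡ β v)) bools) xs ⟩
    any (λ v → any (λ β → ok β v ∧ (δ′ β (t v) ≟ᵇ q′)) bools) xs
      ≡⟨ decomposes-any {R = R} {ok = ok} dec (λ v′ → t′ v′ ≟ᵇ q′) (λ β v → δ′ β (t v) ≟ᵇ q′)
           (λ β v v′ r _ → cong (_≟ᵇ q′) (sym (δ≡ β v v′ r))) ⟨
    any (λ v′ → t′ v′ ≟ᵇ q′) xs′ ∎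
    where
    open ≡-Reasoning
    h : Fin _ → Fin _ → Bool
    h q′ q = any (λ β → okq β q ∧ (δ′ β q ≟ᵇ q′)) bools

  transition-typeOf : ∀ {a b c} (φ : Sentence K a b c) → (em ≡ false → BFree φ) →
    ∀ {ρx ρU ρB ρx′ ρU′ ρB′} βx βU βB → (∀ i → RX (βx i) (ρx i) (ρx′ i)) →
    (∀ i → RU (βU i) (ρU i) (ρU′ i)) → (∀ i → RB (βB i) (ρB i) (ρB′ i)) →
    transition φ βx βU βB (typeOf em φ g ρx ρU ρB) ≡ typeOf em φ g′ ρx′ ρU′ ρB′
  transition-typeOf (atom q) bf βx βU βB rx rU rB = decode-new βx βU βB rx rU rB _ refl
  transition-typeOf (binary f φ ψ) bf {ρx} {ρU} {ρB} βx βU βB rx rU rB = cong₂ pair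
    (trans (cong (transition φ βx βU βB) (first-pair (typeOf em φ g ρx ρU ρB) (typeOf em ψ g ρx ρU ρB)))
      (transition-typeOf φ (proj₁ ∘ bf) βx βU βB rx rU rB))
    (trans (cong (transition ψ βx βU βB) (second-pair (typeOf em φ g ρx ρU ρB) (typeOf em ψ g ρx ρU ρB)))
      (transition-typeOf ψ (proj₂ ∘ bf) βx βU βB rx rU rB))
  transition-typeOf (negation φ) bf βx βU βB rx rU rB = transition-typeOf φ bf βx βU βB rx rU rB
  transition-typeOf (existsX φ) bf {ρx} {ρU} {ρB} {ρx′} {ρU′} {ρB′} βx βU βB rx rU rB = cong₂ pair
    (decode-new βx βU βB rx rU rB _ (first-pair _ _))
    (typeSet-step {R = RX} {ok = okx} decX (encode (answer em g ρx ρU ρB)) (λ v → typeOf em φ g (v VF.∷ ρx) ρU ρB)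
      (λ v′ → typeOf em φ g′ (v′ VF.∷ ρx′) ρU′ ρB′)
      (λ β → transition φ (β VF.∷ βx) βU βB) (λ β q → okX Fin.zero β (decode (info φ q)))
      (λ β v → okX≡ _ (decode-info em φ g (v VF.∷ ρx) ρU ρB) Fin.zero β)
      (λ β v v′ r → transition-typeOf φ bf (β VF.∷ βx) βU βB (cons-related {R = RX} {vs = ρx} r rx) rU rB))
  transition-typeOf (existsU φ) bf {ρx} {ρU} {ρB} {ρx′} {ρU′} {ρB′} βx βU βB rx rU rB = cong₂ pair
    (decode-new βx βU βB rx rU rB _ (first-pair _ _))
    (typeSet-step {R = RU} {ok = oku} decU (encode (answer em g ρx ρU ρB)) (λ v → typeOf em φ g ρx (v VF.∷ ρU) ρB)
      (λ v′ → typeOf em φ g′ ρx′ (v′ VF.∷ ρU′) ρB′)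
      (λ β → transition φ βx (β VF.∷ βU) βB) (λ β q → okU Fin.zero β (decode (info φ q)))
      (λ β v → okU≡ _ (decode-info em φ g ρx (v VF.∷ ρU) ρB) Fin.zero β)
      (λ β v v′ r → transition-typeOf φ bf βx (β VF.∷ βU) βB rx (cons-related {R = RU} {vs = ρU} r rU) rB))
  transition-typeOf (existsB φ) bf {ρx} {ρU} {ρB} {ρx′} {ρU′} {ρB′} βx βU βB rx rU rB = cong₂ pair
    (decode-new βx βU βB rx rU rB _ (first-pair _ _))
    (typeSet-step {R = RB} {ok = okb} (decB em≡true) (encode (answer em g ρx ρU ρB)) (λ v → typeOf em φ g ρx ρU (v VF.∷ ρB))
      (λ v′ → typeOf em φ g′ ρx′ ρU′ (v′ VF.∷ ρB′))
      (λ β → transition φ βx βU (β VF.∷ βB)) (λ β q → okB Fin.zero β (decode (info φ q)))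
      (λ β v → okB≡ em≡true _ (decode-info em φ g ρx ρU (v VF.∷ ρB)) Fin.zero β)
      (λ β v v′ r → transition-typeOf φ (λ eq → ⊥-elim (bf eq)) βx βU (β VF.∷ βB) rx rU (cons-related {R = RB} {vs = ρB} r rB)))
    where
    em≡true : em ≡ true
    em≡true = Boolₚ.¬-not bf

allᶠ : ∀ {k} → (Fin k → Bool) → Bool
allᶠ {zero}  f = true
allᶠ {suc k} f = f Fin.zero ∧ allᶠ (f ∘ Fin.suc)

allᶠ-cong : ∀ {k} {f g : Fin k → Bool} → f ≗ g → allᶠ f ≡ allᶠ g
allᶠ-cong {zero}  eq = refl
allᶠ-cong {suc k} eq = cong₂ _∧_ (eq Fin.zero) (allᶠ-cong (eq ∘ Fin.suc))

module _ {A A′ C : Set} {xs : List A} {xs′ : List A′} {cs : List C} {R : C → A → A′ → Set} {ok : C → A → Bool} where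

  DecomposesTuples : ℕ → Set₁
  DecomposesTuples k = Decomposes (allTuples xs k) (allTuples xs′ k) (allTuples cs k)
    (λ c v v′ → ∀ i → R (c i) (v i) (v′ i)) (λ c v → allᶠ (λ i → ok (c i) (v i)))

  -- Separated from the recursion because it presupposes no decomposition of single values; in this
  -- form it serves the case `m = 0` when `em` is off.
  decomposes-tuples₀ : DecomposesTuples 0
  decomposes-tuples₀ = decomposes λ M f′ f h →
    let open CommutativeMonoid M using (∙-congʳ; identityʳ) renaming (sym to ≈-sym; trans to ≈-trans) in
    ∙-congʳ (≈-trans (h (λ ()) (λ ()) (λ ()) (λ ()) refl) (≈-sym (identityʳ _)))

  decomposes-tuples : Decomposes xs xs′ cs R ok → ∀ k → DecomposesTuples k
  decomposes-tuples dec zero    = decomposes-tuples₀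
  decomposes-tuples dec (suc k) = decomposes λ M → Regroup.regrouped M
    where
    module Regroup (M : CommutativeMonoid 0ℓ 0ℓ) where
      open CommutativeMonoid M using (Carrier; ε)
        renaming (refl to ≈-refl; sym to ≈-sym; trans to ≈-trans; reflexive to ≈-reflexive; _≈_ to _≋_)
      open ListSum M using () renaming (∑ to Σᴹ; ∑-cong to Σᴹ-cong; ∑-ε to Σᴹ-ε; ∑-swap to Σᴹ-swap; ∑-concatMap to Σᴹ-concatMap; ∑-map to Σᴹ-map)
      open import Relation.Binary.Reasoning.Setoid (CommutativeMonoid.setoid M)

      unfold : {B : Set} (zs : List B) (F : (Fin (suc k) → B) → Carrier) →
        Σᴹ (allTuples zs (suc k)) F ≋ Σᴹ zs (λ z → Σᴹ (allTuples zs k) (λ t → F (z VF.∷ t)))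
      unfold zs F = ≈-trans (Σᴹ-concatMap (λ z → List.map (z VF.∷_) (allTuples zs k)) zs F)
        (Σᴹ-cong zs (λ z → ≈-reflexive (Σᴹ-map (z VF.∷_) (allTuples zs k) F)))

      push : ∀ b (F : (Fin k → A) → (Fin k → C) → Carrier) (okT : (Fin k → C) → (Fin k → A) → Bool) →
        (if b then Σᴹ (allTuples xs k) (λ t → Σᴹ (allTuples cs k) (λ ct → if okT ct t then F t ct else ε)) else ε)
        ≋ Σᴹ (allTuples xs k) (λ t → Σᴹ (allTuples cs k) (λ ct → if b ∧ okT ct t then F t ct else ε))
      push true  F okT = ≈-refl
      push false F okT = ≈-sym (≈-trans (Σᴹ-cong (allTuples xs k) (λ t → Σᴹ-ε (allTuples cs k))) (Σᴹ-ε (allTuples xs k)))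

      regrouped : (f′ : (Fin (suc k) → A′) → Carrier) (f : (Fin (suc k) → C) → (Fin (suc k) → A) → Carrier) →
        (∀ c v v′ → (∀ i → R (c i) (v i) (v′ i)) → allᶠ (λ i → ok (c i) (v i)) ≡ true → f′ v′ ≋ f c v) →
        Σᴹ (allTuples xs′ (suc k)) f′ ≋
        Σᴹ (allTuples xs (suc k)) (λ v → Σᴹ (allTuples cs (suc k)) (λ c → if allᶠ (λ i → ok (c i) (v i)) then f c v else ε))
      regrouped f′ f h = begin
        Σᴹ (allTuples xs′ (suc k)) f′
          ≈⟨ unfold xs′ f′ ⟩
        Σᴹ xs′ (λ x′ → Σᴹ (allTuples xs′ k) (λ t′ → f′ (x′ VF.∷ t′)))
          ≈⟨ regroup dec M (λ x′ → Σᴹ (allTuples xs′ k) (λ t′ → f′ (x′ VF.∷ t′))) f₁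
               (λ c x x′ r okc → regroup (decomposes-tuples dec k) M (λ t′ → f′ (x′ VF.∷ t′)) (λ ct t → f (c VF.∷ ct) (x VF.∷ t))
                 (λ ct t t′ rs okt → h (c VF.∷ ct) (x VF.∷ t) (x′ VF.∷ t′) (λ { Fin.zero → r ; (Fin.suc i) → rs i }) (∧-intro okc okt))) ⟩
        Σᴹ xs (λ x → Σᴹ cs (λ c → if ok c x then f₁ c x else ε))
          ≈⟨ Σᴹ-cong xs (λ x → Σᴹ-cong cs (λ c → push (ok c x) (λ t ct → f (c VF.∷ ct) (x VF.∷ t)) okT)) ⟩
        Σᴹ xs (λ x → Σᴹ cs (λ c → Σᴹ (allTuples xs k) (λ t → Σᴹ (allTuples cs k) (λ ct →
          if ok c x ∧ okT ct t then f (c VF.∷ ct) (x VF.∷ t) else ε))))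
          ≈⟨ Σᴹ-cong xs (λ x → Σᴹ-swap cs (allTuples xs k) _) ⟩
        Σᴹ xs (λ x → Σᴹ (allTuples xs k) (λ t → Σᴹ cs (λ c → Σᴹ (allTuples cs k) (λ ct →
          if ok c x ∧ okT ct t then f (c VF.∷ ct) (x VF.∷ t) else ε))))
          ≈⟨ Σᴹ-cong xs (λ x → Σᴹ-cong (allTuples xs k) (λ t → unfold cs (λ c → if allᶠ (λ i → ok (c i) ((x VF.∷ t) i)) then f c (x VF.∷ t) else ε))) ⟨
        Σᴹ xs (λ x → Σᴹ (allTuples xs k) (λ t → Σᴹ (allTuples cs (suc k)) (λ c →
          if allᶠ (λ i → ok (c i) ((x VF.∷ t) i)) then f c (x VF.∷ t) else ε)))
          ≈⟨ unfold xs (λ v → Σᴹ (allTuples cs (suc k)) (λ c → if allᶠ (λ i → ok (c i) (v i)) then f c v else ε)) ⟨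
        _ ∎
        where
        okT : (Fin k → C) → (Fin k → A) → Bool
        okT ct t = allᶠ (λ i → ok (ct i) (t i))
        f₁ : C → A → Carrier
        f₁ c x = Σᴹ (allTuples xs k) (λ t → Σᴹ (allTuples cs k) (λ ct → if okT ct t then f (c VF.∷ ct) (x VF.∷ t) else ε))

∑-δ : ∀ {n} (i : Fin n) (h : Fin n → ℤ) → ∑ (allFin n) (λ q → if i ≟ᵇ q then h q else ℤ.0ℤ) ≡ h i
∑-δ {n} i h = trans (∑-tabulate id) (go n id (λ eq → eq) i)
  where
  ∑-tabulate : ∀ {k} (e : Fin k → Fin n) → ∑ (List.tabulate e) (λ q → if i ≟ᵇ q then h q else ℤ.0ℤ) ≡
    ∑ (allFin k) (λ j → if i ≟ᵇ e j then h (e j) else ℤ.0ℤ)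
  ∑-tabulate e = trans (cong (λ l → ∑ l (λ q → if i ≟ᵇ q then h q else ℤ.0ℤ)) (sym (Listₚ.map-tabulate id e)))
    (∑-map e (allFin _) _)
  go : ∀ k (e : Fin k → Fin n) → (∀ {j j′} → e j ≡ e j′ → j ≡ j′) → ∀ j →
    ∑ (allFin k) (λ j′ → if e j ≟ᵇ e j′ then h (e j′) else ℤ.0ℤ) ≡ h (e j)
  go (suc k) e inj j = trans (cong (λ z → (if e j ≟ᵇ e Fin.zero then h (e Fin.zero) else ℤ.0ℤ) ℤ.+ z) (tailSum (λ j′ → if e j ≟ᵇ e j′ then h (e j′) else ℤ.0ℤ))) (head j)
    where
    tailSum : (F : Fin (suc k) → ℤ) → ∑ (List.tabulate Fin.suc) F ≡ ∑ (allFin k) (F ∘ Fin.suc)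
    tailSum F = trans (cong (λ l → ∑ l F) (sym (Listₚ.map-tabulate id Fin.suc))) (∑-map Fin.suc (allFin k) F)
    head : ∀ j → (if e j ≟ᵇ e Fin.zero then h (e Fin.zero) else ℤ.0ℤ) ℤ.+
      ∑ (allFin k) (λ j′ → if e j ≟ᵇ e (Fin.suc j′) then h (e (Fin.suc j′)) else ℤ.0ℤ) ≡ h (e j)
    head Fin.zero rewrite ≟ᵇ-refl (e Fin.zero) = +-zeroʳ (h (e Fin.zero)) (trans
      (∑-cong (allFin k) (λ j′ → cong (λ b → if b then h (e (Fin.suc j′)) else ℤ.0ℤ)
        (≢⇒≟ᵇ (e Fin.zero) (e (Fin.suc j′)) (λ eq → case inj eq of λ ()))))
      (∑-ε (allFin k)))
    head (Fin.suc j) rewrite ≢⇒≟ᵇ (e (Fin.suc j)) (e Fin.zero) (λ eq → case inj eq of λ ()) =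
      trans (ℤₚ.+-identityˡ _) (go k (e ∘ Fin.suc) (λ eq → Finₚ.suc-injective (inj eq)) j)

if-*ˡ : ∀ b (x y : ℤ) → x ℤ.* (if b then y else ℤ.0ℤ) ≡ (if b then x ℤ.* y else ℤ.0ℤ)
if-*ˡ true  x y = refl
if-*ˡ false x y = ℤₚ.*-zeroʳ x

∑-fibres : ∀ {A : Set} {n} (t : A → Fin n) (h : Fin n → ℤ) (w : A → ℤ) (xs : List A) →
  ∑ (allFin n) (λ q → h q ℤ.* ∑ xs (λ v → if t v ≟ᵇ q then w v else ℤ.0ℤ)) ≡ ∑ xs (λ v → h (t v) ℤ.* w v)
∑-fibres {n = n} t h w xs = begin
  ∑ (allFin n) (λ q → h q ℤ.* ∑ xs (λ v → if t v ≟ᵇ q then w v else ℤ.0ℤ))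
    ≡⟨ ∑-cong (allFin n) (λ q → trans (∑-*ˡ (h q) xs (λ v → if t v ≟ᵇ q then w v else ℤ.0ℤ))
         (∑-cong xs (λ v → if-*ˡ (t v ≟ᵇ q) (h q) (w v)))) ⟩
  ∑ (allFin n) (λ q → ∑ xs (λ v → if t v ≟ᵇ q then h q ℤ.* w v else ℤ.0ℤ))
    ≡⟨ ∑-swap (allFin n) xs (λ q v → if t v ≟ᵇ q then h q ℤ.* w v else ℤ.0ℤ) ⟩
  ∑ xs (λ v → ∑ (allFin n) (λ q → if t v ≟ᵇ q then h q ℤ.* w v else ℤ.0ℤ))
    ≡⟨ ∑-cong xs (λ v → ∑-δ (t v) (λ q → h q ℤ.* w v)) ⟩
  ∑ xs (λ v → h (t v) ℤ.* w v) ∎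
  where open ≡-Reasoning

-- Generating polynomials of types

module TypePolynomials (em : Bool) (K ℓ m ℓ′ m′ : ℕ) (ℓ′≤ℓ : ℓ′ ≤ ℓ) (m′≤m : m′ ≤ m)
                       (φ : Sentence K 0 ℓ m) where

  open CFiniteSequences (ℓ′ ℕ.+ m′) using (D; ⟦_⟧; ∑ᴾ; ⟦∑ᴾ⟧)

  exponents : (Fin ℓ → ℕ) → (Fin m → ℕ) → Mono (ℓ′ ℕ.+ m′)
  exponents e f = (λ i → e (inject≤ i ℓ′≤ℓ)) VF.++ (λ i → f (inject≤ i m′≤m))

  exponents-+ : ∀ {e e′ e″ : Fin ℓ → ℕ} {f f′ f″ : Fin m → ℕ} → (∀ i → e″ i ≡ e i ℕ.+ e′ i) → (∀ i → f″ i ≡ f i ℕ.+ f′ i) →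
    ∀ i → exponents e″ f″ i ≡ exponents e f i ℕ.+ exponents e′ f′ i
  exponents-+ he hf i with Fin.splitAt ℓ′ i
  ... | inj₁ j = he (inject≤ j ℓ′≤ℓ)
  ... | inj₂ j = hf (inject≤ j m′≤m)

  guarded : Bool → Mono (ℓ′ ℕ.+ m′) → D
  guarded b e = if b then (ℤ.1ℤ , e) ∷ [] else []

  ⟦guarded⟧ : ∀ b e x → ⟦ guarded b e ⟧ x ≡ (if b then monoAt e x else ℤ.0ℤ)
  ⟦guarded⟧ true  e x = trans (ℤₚ.+-identityʳ _) (ℤₚ.*-identityˡ (monoAt e x))
  ⟦guarded⟧ false e x = refl

  module _ {n} (g : Labelled K n) where

    typeAt : (Fin ℓ → Subset n) → (Fin m → Subset (edgeCount g)) → Fin (card φ)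
    typeAt ρU ρB = typeOf em φ g (λ ()) ρU ρB

    weight : (Fin ℓ → Subset n) → (Fin m → Subset (edgeCount g)) → Mono (ℓ′ ℕ.+ m′)
    weight ρU ρB = exponents (λ i → ∣ ρU i ∣) (λ i → ∣ ρB i ∣)

    vertexTuples : List (Fin ℓ → Subset n)
    vertexTuples = allTuples (allSubsets n) ℓ

    edgeTuples : List (Fin m → Subset (edgeCount g))
    edgeTuples = allTuples (allSubsets (edgeCount g)) m

    value : Fin (card φ) → D
    value q = ∑ᴾ vertexTuples λ ρU → ∑ᴾ edgeTuples λ ρB → guarded (typeAt ρU ρB ≟ᵇ q) (weight ρU ρB)

    ⟦value⟧ : ∀ q x → ⟦ value q ⟧ x ≡
      ∑ vertexTuples λ ρU → ∑ edgeTuples λ ρB → if typeAt ρU ρB ≟ᵇ q then monoAt (weight ρU ρB) x else ℤ.0ℤ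
    ⟦value⟧ q x = trans (⟦∑ᴾ⟧ vertexTuples _ x) (∑-cong vertexTuples (λ ρU →
      trans (⟦∑ᴾ⟧ edgeTuples _ x) (∑-cong edgeTuples (λ ρB → ⟦guarded⟧ (typeAt ρU ρB ≟ᵇ q) (weight ρU ρB) x))))

    value-fibres : ∀ (h : Fin (card φ) → ℤ) x → ∑ (allFin (card φ)) (λ q → h q ℤ.* ⟦ value q ⟧ x) ≡
      ∑ vertexTuples λ ρU → ∑ edgeTuples λ ρB → h (typeAt ρU ρB) ℤ.* monoAt (weight ρU ρB) x
    value-fibres h x = begin
      ∑ (allFin (card φ)) (λ q → h q ℤ.* ⟦ value q ⟧ x)
        ≡⟨ ∑-cong (allFin (card φ)) (λ q → trans (cong (λ z → h q ℤ.* z) (⟦value⟧ q x)) (∑-*ˡ (h q) vertexTuples (inner q))) ⟩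
      ∑ (allFin (card φ)) (λ q → ∑ vertexTuples λ ρU → h q ℤ.* inner q ρU)
        ≡⟨ ∑-swap (allFin (card φ)) vertexTuples (λ q ρU → h q ℤ.* inner q ρU) ⟩
      ∑ vertexTuples (λ ρU → ∑ (allFin (card φ)) λ q → h q ℤ.* inner q ρU)
        ≡⟨ ∑-cong vertexTuples (λ ρU → ∑-fibres (typeAt ρU) h (λ ρB → monoAt (weight ρU ρB) x) edgeTuples) ⟩
      ∑ vertexTuples (λ ρU → ∑ edgeTuples λ ρB → h (typeAt ρU ρB) ℤ.* monoAt (weight ρU ρB) x) ∎
      where
      open ≡-Reasoning
      inner : Fin (card φ) → (Fin ℓ → Subset n) → ℤ
      inner q ρU = ∑ edgeTuples λ ρB → if typeAt ρU ρB ≟ᵇ q then monoAt (weight ρU ρB) x else ℤ.0ℤ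

  module _ (υ : Update K) where
    open Update υ
    open Transition υ

    choices : ∀ k → List (Fin k → Bool)
    choices k = allTuples bools k

    admissible : Fin (card φ) → (Fin ℓ → Bool) → (Fin m → Bool) → Bool
    admissible q βU βB = allᶠ (λ i → okU i (βU i) (decode (info φ q))) ∧ allᶠ (λ i → okB i (βB i) (decode (info φ q)))

    choiceWeight : (Fin ℓ → Bool) → (Fin m → Bool) → Mono (ℓ′ ℕ.+ m′)
    choiceWeight βU βB = exponents (bitℕ ∘ βU) (bitℕ ∘ βB)

    updateMatrix : Fin (card φ) → Fin (card φ) → D
    updateMatrix q′ q = ∑ᴾ (choices ℓ) λ βU → ∑ᴾ (choices m) λ βB →
      guarded (admissible q βU βB ∧ (transition φ (λ ()) βU βB q ≟ᵇ q′)) (choiceWeight βU βB)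

    ⟦updateMatrix⟧ : ∀ q′ q x → ⟦ updateMatrix q′ q ⟧ x ≡ ∑ (choices ℓ) λ βU → ∑ (choices m) λ βB →
      if admissible q βU βB ∧ (transition φ (λ ()) βU βB q ≟ᵇ q′) then monoAt (choiceWeight βU βB) x else ℤ.0ℤ
    ⟦updateMatrix⟧ q′ q x = trans (⟦∑ᴾ⟧ (choices ℓ) _ x) (∑-cong (choices ℓ) (λ βU →
      trans (⟦∑ᴾ⟧ (choices m) _ x) (∑-cong (choices m) (λ βB →
        ⟦guarded⟧ (admissible q βU βB ∧ (transition φ (λ ()) βU βB q ≟ᵇ q′)) (choiceWeight βU βB) x))))

  module _ {n n′ : ℕ} {g : Labelled K n} {g′ : Labelled K n′} {υ : Update K} (st : Step em g g′ υ)
           (bf : em ≡ false → BFree φ) (m≡0 : em ≡ false → m ≡ 0) where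
    open Step st
    open StepTransition st
    open Transition υ
    open Update υ

    private
      decUs : DecomposesTuples {xs = allSubsets n} {allSubsets n′} {bools} {RU} {oku} ℓ
      decUs = decomposes-tuples decU ℓ

      decBs : DecomposesTuples {xs = allSubsets (edgeCount g)} {allSubsets (edgeCount g′)} {bools} {RB} {okb} m
      decBs = build em refl
        where
        build : ∀ b → em ≡ b → DecomposesTuples {xs = allSubsets (edgeCount g)} {allSubsets (edgeCount g′)} {bools} {RB} {okb} m
        build true  eq = decomposes-tuples (decB eq) m
        build false eq = subst (DecomposesTuples {xs = allSubsets (edgeCount g)} {allSubsets (edgeCount g′)} {bools} {RB} {okb})
          (sym (m≡0 eq)) (decomposes-tuples₀ {xs = allSubsets (edgeCount g)} {allSubsets (edgeCount g′)} {bools} {RB} {okb})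

      admissible≡ : ∀ ρU ρB βU βB → admissible υ (typeAt g ρU ρB) βU βB ≡
        allᶠ (λ i → oku (βU i) (ρU i)) ∧ allᶠ (λ i → okb (βB i) (ρB i))
      admissible≡ ρU ρB βU βB = cong₂ _∧_
        (allᶠ-cong (λ i → okU≡ _ (decode-info em φ g (λ ()) ρU ρB) i (βU i)))
        (edgePart em refl)
        where
        edgePart : ∀ b → em ≡ b → allᶠ (λ i → okB i (βB i) (decode (info φ (typeAt g ρU ρB)))) ≡ allᶠ (λ i → okb (βB i) (ρB i))
        edgePart true  eq = allᶠ-cong (λ i → okB≡ eq _ (decode-info em φ g (λ ()) ρU ρB) i (βB i))
        -- With the flag off there are no edge-set variables, and both conjunctions are empty.
        edgePart false eq = empty m (m≡0 eq) _ _
          where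
          empty : ∀ k → k ≡ 0 → (f h : Fin k → Bool) → allᶠ f ≡ allᶠ h
          empty zero _ f h = refl

    -- Assignments after the step are regrouped by the assignment before it and the bits. The new
    -- type depends only on the old type and the bits, and the new monomial is the old one times a
    -- factor given by the bits. Collecting old assignments of equal type leaves a matrix acting on
    -- the vector of generating polynomials.
    value-step : ∀ q′ x → ⟦ value g′ q′ ⟧ x ≡ ∑ (allFin (card φ)) λ q → ⟦ updateMatrix υ q′ q ⟧ x ℤ.* ⟦ value g q ⟧ x
    value-step q′ x = trans lhs (sym rhs)
      where
      open ≡-Reasoning
      term : (Fin ℓ → Bool) → (Fin m → Bool) → (Fin ℓ → Subset n) → (Fin m → Subset (edgeCount g)) → ℤ
      term βU βB ρU ρB = if transition φ (λ ()) βU βB (typeAt g ρU ρB) ≟ᵇ q′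
        then monoAt (choiceWeight υ βU βB) x ℤ.* monoAt (weight g ρU ρB) x else ℤ.0ℤ
      oku* : (Fin ℓ → Bool) → (Fin ℓ → Subset n) → Bool
      oku* βU ρU = allᶠ (λ i → oku (βU i) (ρU i))
      okb* : (Fin m → Bool) → (Fin m → Subset (edgeCount g)) → Bool
      okb* βB ρB = allᶠ (λ i → okb (βB i) (ρB i))
      total : (Fin ℓ → Subset n) → (Fin m → Subset (edgeCount g)) → ℤ
      total ρU ρB = ∑ (choices υ ℓ) λ βU → ∑ (choices υ m) λ βB → if oku* βU ρU ∧ okb* βB ρB then term βU βB ρU ρB else ℤ.0ℤ
      push : ∀ b {F : (Fin m → Subset (edgeCount g)) → (Fin m → Bool) → ℤ} {okT : (Fin m → Bool) → (Fin m → Subset (edgeCount g)) → Bool} →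
        (if b then ∑ (edgeTuples g) (λ ρB → ∑ (choices υ m) λ βB → if okT βB ρB then F ρB βB else ℤ.0ℤ) else ℤ.0ℤ) ≡
        ∑ (edgeTuples g) (λ ρB → ∑ (choices υ m) λ βB → if b ∧ okT βB ρB then F ρB βB else ℤ.0ℤ)
      push true  = refl
      push false = sym (trans (∑-cong (edgeTuples g) (λ ρB → ∑-ε (choices υ m))) (∑-ε (edgeTuples g)))
      compare : ∀ βU ρU ρU′ → (∀ i → RU (βU i) (ρU i) (ρU′ i)) → ∀ βB ρB ρB′ → (∀ i → RB (βB i) (ρB i) (ρB′ i)) →
        (if typeAt g′ ρU′ ρB′ ≟ᵇ q′ then monoAt (weight g′ ρU′ ρB′) x else ℤ.0ℤ) ≡ term βU βB ρU ρB
      compare βU ρU ρU′ rU βB ρB ρB′ rB = cong₂ (λ b z → if b then z else ℤ.0ℤ)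
        (cong (_≟ᵇ q′) (sym (transition-typeOf φ bf (λ ()) βU βB (λ ()) rU rB)))
        (trans (monoAt-cong (exponents-+ {bitℕ ∘ βU} {λ i → ∣ ρU i ∣} {λ i → ∣ ρU′ i ∣} {bitℕ ∘ βB} {λ i → ∣ ρB i ∣} {λ i → ∣ ρB′ i ∣}
          (λ i → sizeU (rU i)) (λ i → sizeB (rB i))) x)
          (monoAt-+ (choiceWeight υ βU βB) (weight g ρU ρB) x))
      lhs : ⟦ value g′ q′ ⟧ x ≡ ∑ (vertexTuples g) λ ρU → ∑ (edgeTuples g) λ ρB → total ρU ρB
      lhs = begin
        ⟦ value g′ q′ ⟧ x
          ≡⟨ ⟦value⟧ g′ q′ x ⟩
        ∑ (vertexTuples g′) (λ ρU′ → ∑ (edgeTuples g′) λ ρB′ → if typeAt g′ ρU′ ρB′ ≟ᵇ q′ then monoAt (weight g′ ρU′ ρB′) x else ℤ.0ℤ)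
          ≡⟨ regroup decUs ℤₚ.+-0-commutativeMonoid
               (λ ρU′ → ∑ (edgeTuples g′) λ ρB′ → if typeAt g′ ρU′ ρB′ ≟ᵇ q′ then monoAt (weight g′ ρU′ ρB′) x else ℤ.0ℤ)
               (λ βU ρU → ∑ (edgeTuples g) λ ρB → ∑ (choices υ m) λ βB → if okb* βB ρB then term βU βB ρU ρB else ℤ.0ℤ)
               (λ βU ρU ρU′ rU _ → regroup decBs ℤₚ.+-0-commutativeMonoid
                 (λ ρB′ → if typeAt g′ ρU′ ρB′ ≟ᵇ q′ then monoAt (weight g′ ρU′ ρB′) x else ℤ.0ℤ)
                 (λ βB ρB → term βU βB ρU ρB)
                 (λ βB ρB ρB′ rB _ → compare βU ρU ρU′ rU βB ρB ρB′ rB)) ⟩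
        ∑ (vertexTuples g) (λ ρU → ∑ (choices υ ℓ) λ βU → if oku* βU ρU
          then (∑ (edgeTuples g) λ ρB → ∑ (choices υ m) λ βB → if okb* βB ρB then term βU βB ρU ρB else ℤ.0ℤ) else ℤ.0ℤ)
          ≡⟨ ∑-cong (vertexTuples g) (λ ρU → ∑-cong (choices υ ℓ) (λ βU →
               push (oku* βU ρU) {λ ρB βB → term βU βB ρU ρB} {okb*})) ⟩
        ∑ (vertexTuples g) (λ ρU → ∑ (choices υ ℓ) λ βU → ∑ (edgeTuples g) λ ρB → ∑ (choices υ m) λ βB →
          if oku* βU ρU ∧ okb* βB ρB then term βU βB ρU ρB else ℤ.0ℤ)
          ≡⟨ ∑-cong (vertexTuples g) (λ ρU → ∑-swap (choices υ ℓ) (edgeTuples g)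
               (λ βU ρB → ∑ (choices υ m) λ βB → if oku* βU ρU ∧ okb* βB ρB then term βU βB ρU ρB else ℤ.0ℤ)) ⟩
        ∑ (vertexTuples g) (λ ρU → ∑ (edgeTuples g) λ ρB → total ρU ρB) ∎
      combine : ∀ a b c w z → c ≡ a → (if c ∧ b then w else ℤ.0ℤ) ℤ.* z ≡ (if a then (if b then w ℤ.* z else ℤ.0ℤ) else ℤ.0ℤ)
      combine true  true  .true  w z refl = refl
      combine true  false .true  w z refl = refl
      combine false b     .false w z refl = refl
      rhs : ∑ (allFin (card φ)) (λ q → ⟦ updateMatrix υ q′ q ⟧ x ℤ.* ⟦ value g q ⟧ x) ≡
        ∑ (vertexTuples g) λ ρU → ∑ (edgeTuples g) λ ρB → total ρU ρB
      rhs = trans (value-fibres g (λ q → ⟦ updateMatrix υ q′ q ⟧ x) x)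
        (∑-cong (vertexTuples g) (λ ρU → ∑-cong (edgeTuples g) (λ ρB → begin
          ⟦ updateMatrix υ q′ (typeAt g ρU ρB) ⟧ x ℤ.* W ρU ρB
            ≡⟨ cong (λ z → z ℤ.* W ρU ρB) (⟦updateMatrix⟧ υ q′ (typeAt g ρU ρB) x) ⟩
          (∑ (choices υ ℓ) λ βU → ∑ (choices υ m) λ βB → M ρU ρB βU βB) ℤ.* W ρU ρB
            ≡⟨ ∑-*ʳ (W ρU ρB) (choices υ ℓ) (λ βU → ∑ (choices υ m) λ βB → M ρU ρB βU βB) ⟩
          ∑ (choices υ ℓ) (λ βU → (∑ (choices υ m) λ βB → M ρU ρB βU βB) ℤ.* W ρU ρB)
            ≡⟨ ∑-cong (choices υ ℓ) (λ βU → trans (∑-*ʳ (W ρU ρB) (choices υ m) (λ βB → M ρU ρB βU βB))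
                 (∑-cong (choices υ m) (λ βB → combine (oku* βU ρU ∧ okb* βB ρB)
                   (transition φ (λ ()) βU βB (typeAt g ρU ρB) ≟ᵇ q′) (admissible υ (typeAt g ρU ρB) βU βB)
                   (monoAt (choiceWeight υ βU βB) x) (W ρU ρB) (admissible≡ ρU ρB βU βB)))) ⟩
          total ρU ρB ∎)))
        where
        W : (Fin ℓ → Subset n) → (Fin m → Subset (edgeCount g)) → ℤ
        W ρU ρB = monoAt (weight g ρU ρB) x
        M : (Fin ℓ → Subset n) → (Fin m → Subset (edgeCount g)) → (Fin ℓ → Bool) → (Fin m → Bool) → ℤ
        M ρU ρB βU βB = if admissible υ (typeAt g ρU ρB) βU βB ∧ (transition φ (λ ()) βU βB (typeAt g ρU ρB) ≟ᵇ q′)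
          then monoAt (choiceWeight υ βU βB) x else ℤ.0ℤ

-- Decompositions of vertex sets and edge sets

anyFin-suc : ∀ {n} (f : Fin (suc n) → Bool) → anyFin f ≡ f Fin.zero ∨ anyFin (f ∘ Fin.suc)
anyFin-suc {n} f = cong (λ bs → f Fin.zero ∨ List.foldr _∨_ false bs)
  (trans (Listₚ.map-tabulate Fin.suc f) (sym (Listₚ.map-tabulate id (f ∘ Fin.suc))))

any-δ : ∀ {n} (h : Fin n → Bool) i → anyFin (λ q → h q ∧ (i ≟ᵇ q)) ≡ h i
any-δ h i = bool-ext to from
  where
  to : anyFin (λ q → h q ∧ (i ≟ᵇ q)) ≡ true → h i ≡ true
  to eq with anyFin-elim {f = λ q → h q ∧ (i ≟ᵇ q)} eq
  ... | q , hq with ∧-elim {h q} hq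
  ...   | hq′ , iq = trans (cong h (≟ᵇ⇒≡ i q iq)) hq′
  from : h i ≡ true → anyFin (λ q → h q ∧ (i ≟ᵇ q)) ≡ true
  from eq = anyFin-intro {f = λ q → h q ∧ (i ≟ᵇ q)} i (∧-intro eq (≟ᵇ-refl i))

chosen-∷ : ∀ {n} (e : Fin n × Fin n) es b S u v →
  chosen (e ∷ es) (b Vec.∷ S) u v ≡ (b ∧ incident e u v) ∨ chosen es S u v
chosen-∷ e es b S u v = anyFin-suc (λ i → Vec.lookup (b Vec.∷ S) i ∧ incident (List.lookup (e ∷ es) i) u v)

∣∷∣ : ∀ {n} b (S : Subset n) → ∣ b Vec.∷ S ∣ ≡ bitℕ b ℕ.+ ∣ S ∣
∣∷∣ true  S = refl
∣∷∣ false S = refl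

-- A variable carries a bit even when nothing is created for it. Admitting only `false` keeps the
-- predecessor unique; admitting both would count each value twice.
Unchanged : {A : Set} → Bool → A → A → Set
Unchanged β v v′ = β ≡ false × v′ ≡ v

module _ {A : Set} (xs : List A) where

  decomposes-unchanged : Decomposes xs xs bools Unchanged (λ β _ → not β)
  decomposes-unchanged = decomposes λ M f′ f h →
    let open CommutativeMonoid M using (∙-congˡ; identityˡ; identityʳ) renaming (sym to ≈-sym; trans to ≈-trans) in
    ListSum.∑-cong M xs (λ v → ≈-trans (h false v v (refl , refl) refl)
      (≈-sym (≈-trans (∙-congˡ (identityˡ _)) (identityʳ _))))

module SubsetSums (M : CommutativeMonoid 0ℓ 0ℓ) where
  open CommutativeMonoid M using (Carrier; _∙_; ε; ∙-cong; ∙-congˡ; ∙-congʳ; identityˡ; identityʳ; comm) public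
  open CommutativeMonoid M using () renaming (refl to ≈-refl; sym to ≈-sym; trans to ≈-trans; reflexive to ≈-reflexive; _≈_ to _≋_) public
  open ListSum M using () renaming (∑ to Σᴹ; ∑-cong to Σᴹ-cong; ∑-ε to Σᴹ-ε; ∑-++ to Σᴹ-++; ∑-map to Σᴹ-map; ∑-∙ to Σᴹ-∙) public

  ∑-allSubsets : ∀ n (F : Subset (suc n) → Carrier) → Σᴹ (allSubsets (suc n)) F ≋
    Σᴹ (allSubsets n) (λ S → F (true Vec.∷ S)) ∙ Σᴹ (allSubsets n) (λ S → F (false Vec.∷ S))
  ∑-allSubsets n F = ≈-trans (Σᴹ-++ (List.map (true Vec.∷_) (allSubsets n)) _ F)
    (∙-cong (≈-reflexive (Σᴹ-map (true Vec.∷_) (allSubsets n) F)) (≈-reflexive (Σᴹ-map (false Vec.∷_) (allSubsets n) F)))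

decomposes-subset-∷ : ∀ n → Decomposes (allSubsets n) (allSubsets (suc n)) bools (λ β S S′ → S′ ≡ β Vec.∷ S) (λ _ _ → true)
decomposes-subset-∷ n = decomposes λ M f′ f h → let open SubsetSums M in
  ≈-trans (∑-allSubsets n f′) (≈-trans (comm _ _)
    (≈-trans (≈-sym (Σᴹ-∙ (allSubsets n) (λ S → f′ (false Vec.∷ S)) (λ S → f′ (true Vec.∷ S))))
      (Σᴹ-cong (allSubsets n) (λ S → ∙-cong (h false S _ refl refl)
        (≈-trans (h true S _ refl refl) (≈-sym (identityʳ _)))))))

Pairs : ℕ → Set
Pairs n = List (Fin n × Fin n)

filterᵇ-true : {A : Set} (p : A → Bool) → ∀ x xs → p x ≡ true → List.filterᵇ p (x ∷ xs) ≡ x ∷ List.filterᵇ p xs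
filterᵇ-true p x xs eq with p x
filterᵇ-true p x xs refl | true = refl

filterᵇ-false : {A : Set} (p : A → Bool) → ∀ x xs → p x ≡ false → List.filterᵇ p (x ∷ xs) ≡ List.filterᵇ p xs
filterᵇ-false p x xs eq with p x
filterᵇ-false p x xs refl | false = refl

-- A set of edges is indexed by positions in an edge list, and the lists before and after an
-- operation differ. The sets are therefore compared through the relations they induce on vertices.
record Kept {n : ℕ} (es es′ : Pairs n) (β : Bool) (S : Subset (length es)) (S′ : Subset (length es′)) : Set where
  constructor kept
  field
    trivial : β ≡ false
    same    : ∀ u v → chosen es′ S′ u v ≡ chosen es S u v
    size    : ∣ S′ ∣ ≡ ∣ S ∣

module Filtering {n : ℕ} (keep : Fin n × Fin n → Bool) where

  dropped : (es : Pairs n) → Subset (length es) → Bool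
  dropped es S = anyFin (λ i → Vec.lookup S i ∧ not (keep (List.lookup es i)))

  dropped-∷ : ∀ e es b S → dropped (e ∷ es) (b Vec.∷ S) ≡ (b ∧ not (keep e)) ∨ dropped es S
  dropped-∷ e es b S = anyFin-suc (λ i → Vec.lookup (b Vec.∷ S) i ∧ not (keep (List.lookup (e ∷ es) i)))

  -- A set of surviving edges has as its only predecessor the same set seen among the old edges. Old
  -- sets that contain a deleted edge are ruled out instead of projected, for projection would count
  -- a surviving set several times.
  ok : (es : Pairs n) → Bool → Subset (length es) → Bool
  ok es β S = not β ∧ not (dropped es S)

  kept-∷ : ∀ (e : Fin n × Fin n) {es es′ β S S′} b → Kept es es′ β S S′ → Kept (e ∷ es) (e ∷ es′) β (b Vec.∷ S) (b Vec.∷ S′)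
  kept-∷ e {es} {es′} {S = S} {S′} b (kept t s z) = kept t
    (λ u v → trans (chosen-∷ e es′ b S′ u v) (trans (cong ((b ∧ incident e u v) ∨_) (s u v)) (sym (chosen-∷ e es b S u v))))
    (trans (∣∷∣ b S′) (trans (cong (bitℕ b ℕ.+_) z) (sym (∣∷∣ b S))))

  kept-skip : ∀ (e : Fin n × Fin n) {es es′ β S S′} → Kept es es′ β S S′ → Kept (e ∷ es) es′ β (false Vec.∷ S) S′
  kept-skip e {es} {S = S} (kept t s z) = kept t (λ u v → trans (s u v) (sym (chosen-∷ e es false S u v))) z

  DecomposesKept : Pairs n → Pairs n → Set₁
  DecomposesKept es es′ = Decomposes (allSubsets (length es)) (allSubsets (length es′)) bools (Kept es es′) (ok es)

  decomposes-keep : ∀ e {es es′} → keep e ≡ true → DecomposesKept es es′ → DecomposesKept (e ∷ es) (e ∷ es′)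
  decomposes-keep e {es} {es′} eq dec = decomposes λ M f′ f h → let open SubsetSums M in
    ≈-trans (∑-allSubsets _ f′) (≈-trans (∙-cong (part M f′ f h true) (part M f′ f h false))
      (≈-sym (∑-allSubsets _ (λ S → Σᴹ bools (λ β → if ok (e ∷ es) β S then f β S else ε)))))
    where
    ok-∷ : ∀ b β S → ok (e ∷ es) β (b Vec.∷ S) ≡ ok es β S
    ok-∷ b β S = cong (λ z → not β ∧ not z) (trans (dropped-∷ e es b S)
      (cong (_∨ dropped es S) (trans (cong (λ z → b ∧ not z) eq) (Boolₚ.∧-zeroʳ b))))
    part : (M : CommutativeMonoid 0ℓ 0ℓ) → let open SubsetSums M in
      (f′ : Subset (suc (length es′)) → Carrier) (f : Bool → Subset (suc (length es)) → Carrier) →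
      (∀ β S S′ → Kept (e ∷ es) (e ∷ es′) β S S′ → ok (e ∷ es) β S ≡ true → f′ S′ ≋ f β S) → ∀ b →
      Σᴹ (allSubsets (length es′)) (λ S′ → f′ (b Vec.∷ S′)) ≋
      Σᴹ (allSubsets (length es)) (λ S → Σᴹ bools (λ β → if ok (e ∷ es) β (b Vec.∷ S) then f β (b Vec.∷ S) else ε))
    part M f′ f h b = let open SubsetSums M in ≈-trans
      (regroup dec M (λ S′ → f′ (b Vec.∷ S′)) (λ β S → f β (b Vec.∷ S))
        (λ β S S′ k o → h β (b Vec.∷ S) (b Vec.∷ S′) (kept-∷ e b k) (trans (ok-∷ b β S) o)))
      (Σᴹ-cong (allSubsets (length es)) (λ S → Σᴹ-cong bools (λ β →
        ≈-reflexive (cong (λ z → if z then f β (b Vec.∷ S) else ε) (sym (ok-∷ b β S))))))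

  decomposes-drop : ∀ e {es es′} → keep e ≡ false → DecomposesKept es es′ → DecomposesKept (e ∷ es) es′
  decomposes-drop e {es} {es′} eq dec = decomposes λ M f′ f h → let open SubsetSums M in
    ≈-trans (regroup dec M f′ (λ β S → f β (false Vec.∷ S))
        (λ β S S′ k o → h β (false Vec.∷ S) S′ (kept-skip e k) (trans (ok-false β S) o)))
      (≈-trans (≈-sym (identityˡ _)) (≈-trans (∙-cong
        (≈-trans (≈-sym (Σᴹ-ε (allSubsets (length es)))) (Σᴹ-cong (allSubsets (length es)) (λ S →
          ≈-sym (≈-trans (Σᴹ-cong bools (λ β → ≈-reflexive (cong (λ z → if z then f β (true Vec.∷ S) else ε) (ok-true β S)))) (Σᴹ-ε bools)))))
        (Σᴹ-cong (allSubsets (length es)) (λ S → Σᴹ-cong bools (λ β →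
          ≈-reflexive (cong (λ z → if z then f β (false Vec.∷ S) else ε) (sym (ok-false β S)))))))
      (≈-sym (∑-allSubsets _ (λ S → Σᴹ bools (λ β → if ok (e ∷ es) β S then f β S else ε))))))
    where
    ok-false : ∀ β S → ok (e ∷ es) β (false Vec.∷ S) ≡ ok es β S
    ok-false β S = cong (λ z → not β ∧ not z) (dropped-∷ e es false S)
    ok-true : ∀ β S → ok (e ∷ es) β (true Vec.∷ S) ≡ false
    ok-true β S = trans (cong (λ z → not β ∧ not z) (trans (dropped-∷ e es true S) (cong (λ z → not z ∨ dropped es S) eq)))
      (Boolₚ.∧-zeroʳ (not β))

  decomposes-filter : ∀ es → DecomposesKept es (List.filterᵇ keep es)
  decomposes-filter [] = decomposes λ M f′ f h → let open SubsetSums M in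
    ∙-congʳ (≈-trans (h false Vec.[] Vec.[] (kept refl (λ u v → refl) refl) refl)
      (≈-sym (≈-trans (∙-congˡ (identityˡ _)) (identityʳ _))))
  decomposes-filter (e ∷ es) = branch (keep e) refl
    where
    branch : ∀ b → keep e ≡ b → DecomposesKept (e ∷ es) (List.filterᵇ keep (e ∷ es))
    branch true  eq = subst (DecomposesKept (e ∷ es)) (sym (filterᵇ-true keep e es eq)) (decomposes-keep e eq (decomposes-filter es))
    branch false eq = subst (DecomposesKept (e ∷ es)) (sym (filterᵇ-false keep e es eq)) (decomposes-drop e eq (decomposes-filter es))

-- Edges are listed in lexicographic order, so a new edge may land anywhere in the list.
data Inserts {A : Set} (e : A) : List A → List A → Set where
  here  : ∀ {es} → Inserts e es (e ∷ es)
  there : ∀ {x es es′} → Inserts e es es′ → Inserts e (x ∷ es) (x ∷ es′)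

record Extended {n : ℕ} (e : Fin n × Fin n) (es es′ : Pairs n) (β : Bool) (S : Subset (length es)) (S′ : Subset (length es′)) : Set where
  constructor extended
  field
    same : ∀ u v → chosen es′ S′ u v ≡ chosen es S u v ∨ (β ∧ incident e u v)
    size : ∣ S′ ∣ ≡ bitℕ β ℕ.+ ∣ S ∣

extended-∷ : ∀ {n} {e : Fin n × Fin n} x {es es′ β S S′} b → Extended e es es′ β S S′ →
  Extended e (x ∷ es) (x ∷ es′) β (b Vec.∷ S) (b Vec.∷ S′)
extended-∷ {e = e} x {es} {es′} {β} {S} {S′} b (extended s z) = extended
  (λ u v → trans (chosen-∷ x es′ b S′ u v) (trans (cong ((b ∧ incident x u v) ∨_) (s u v))
    (trans (sym (Boolₚ.∨-assoc (b ∧ incident x u v) (chosen es S u v) (β ∧ incident e u v)))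
      (cong (_∨ (β ∧ incident e u v)) (sym (chosen-∷ x es b S u v))))))
  (trans (∣∷∣ b S′) (trans (cong (bitℕ b ℕ.+_) z) (trans (ℕ-swap (bitℕ b) (bitℕ β) ∣ S ∣) (cong (bitℕ β ℕ.+_) (sym (∣∷∣ b S))))))
  where
  ℕ-swap : ∀ a b c → a ℕ.+ (b ℕ.+ c) ≡ b ℕ.+ (a ℕ.+ c)
  ℕ-swap a b c = trans (sym (ℕₚ.+-assoc a b c)) (trans (cong (ℕ._+ c) (ℕₚ.+-comm a b)) (ℕₚ.+-assoc b a c))

decomposes-insert : ∀ {n} {e : Fin n × Fin n} {es es′} → Inserts e es es′ →
  Decomposes (allSubsets (length es)) (allSubsets (length es′)) bools (Extended e es es′) (λ _ _ → true)
decomposes-insert {e = e} {es} here = decomposes λ M f′ f h →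
  regroup (decomposes-subset-∷ (length es)) M f′ f
    (λ β S S′ eq _ → h β S S′ (subst (Extended e es (e ∷ es) β S) (sym eq) (extended
      (λ u v → trans (chosen-∷ e es β S u v) (Boolₚ.∨-comm (β ∧ incident e u v) _)) (∣∷∣ β S))) refl)
decomposes-insert {e = e} (there {x} {es} {es′} ins) = decomposes λ M f′ f h → let open SubsetSums M in
  ≈-trans (∑-allSubsets _ f′) (≈-trans
    (∙-cong (part M f′ f h true) (part M f′ f h false))
    (≈-sym (∑-allSubsets _ (λ S → Σᴹ bools (λ β → f β S)))))
  where
  part : (M : CommutativeMonoid 0ℓ 0ℓ) → let open SubsetSums M in
    (f′ : Subset (suc (length es′)) → Carrier) (f : Bool → Subset (suc (length es)) → Carrier) →
    (∀ β S S′ → Extended e (x ∷ es) (x ∷ es′) β S S′ → true ≡ true → f′ S′ ≋ f β S) → ∀ b →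
    Σᴹ (allSubsets (length es′)) (λ S′ → f′ (b Vec.∷ S′)) ≋ Σᴹ (allSubsets (length es)) (λ S → Σᴹ bools (λ β → f β (b Vec.∷ S)))
  part M f′ f h b = regroup (decomposes-insert ins) M (λ S′ → f′ (b Vec.∷ S′)) (λ β S → f β (b Vec.∷ S))
    (λ β S S′ k o → h β (b Vec.∷ S) (b Vec.∷ S′) (extended-∷ x b k) refl)

suc² : ∀ {n} → Fin n × Fin n → Fin (suc n) × Fin (suc n)
suc² e = Fin.suc (proj₁ e) , Fin.suc (proj₂ e)

record Lifted {n : ℕ} (es : Pairs n) (es′ : Pairs (suc n)) (β : Bool) (S : Subset (length es)) (S′ : Subset (length es′)) : Set where
  constructor lifted
  field
    trivial : β ≡ false
    isolated : ∀ v → chosen es′ S′ Fin.zero v ≡ false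
    same     : ∀ u v → chosen es′ S′ (Fin.suc u) (Fin.suc v) ≡ chosen es S u v
    size     : ∣ S′ ∣ ≡ ∣ S ∣

lifted-∷ : ∀ {n} (e : Fin n × Fin n) {es es′ β S S′} b → Lifted es es′ β S S′ →
  Lifted (e ∷ es) (suc² e ∷ es′) β (b Vec.∷ S) (b Vec.∷ S′)
lifted-∷ e {es} {es′} {S = S} {S′} b (lifted t i s z) = lifted t
  (λ v → trans (chosen-∷ (suc² e) es′ b S′ Fin.zero v) (trans (cong₂ _∨_
    (trans (cong (b ∧_) (Boolₚ.∧-zeroʳ (Fin.suc (proj₁ e) ≟ᵇ v))) (Boolₚ.∧-zeroʳ b)) (i v)) refl))
  (λ u v → trans (chosen-∷ (suc² e) es′ b S′ (Fin.suc u) (Fin.suc v)) (trans (cong₂ (λ p q → (b ∧ p) ∨ q)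
    (cong₂ _∨_ (cong₂ _∧_ (≟ᵇ-suc (proj₁ e) u) (≟ᵇ-suc (proj₂ e) v)) (cong₂ _∧_ (≟ᵇ-suc (proj₁ e) v) (≟ᵇ-suc (proj₂ e) u)))
    (s u v)) (sym (chosen-∷ e es b S u v))))
  (trans (∣∷∣ b S′) (trans (cong (bitℕ b ℕ.+_) z) (sym (∣∷∣ b S))))

decomposes-lift : ∀ {n} (es : Pairs n) → Decomposes (allSubsets (length es)) (allSubsets (length (List.map suc² es))) bools
  (Lifted es (List.map suc² es)) (λ β _ → not β)
decomposes-lift [] = decomposes λ M f′ f h → let open SubsetSums M in
  ∙-congʳ (≈-trans (h false Vec.[] Vec.[] (lifted refl (λ v → refl) (λ u v → refl) refl) refl)
    (≈-sym (≈-trans (∙-congˡ (identityˡ _)) (identityʳ _))))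
decomposes-lift (e ∷ es) = decomposes λ M f′ f h → let open SubsetSums M in
  ≈-trans (∑-allSubsets _ f′) (≈-trans
    (∙-cong (part M f′ f h true) (part M f′ f h false))
    (≈-sym (∑-allSubsets _ (λ S → Σᴹ bools (λ β → if not β then f β S else ε)))))
  where
  part : (M : CommutativeMonoid 0ℓ 0ℓ) → let open SubsetSums M in
    (f′ : Subset (suc (length (List.map suc² es))) → Carrier) (f : Bool → Subset (suc (length es)) → Carrier) →
    (∀ β S S′ → Lifted (e ∷ es) (suc² e ∷ List.map suc² es) β S S′ → not β ≡ true → f′ S′ ≋ f β S) → ∀ b →
    Σᴹ (allSubsets (length (List.map suc² es))) (λ S′ → f′ (b Vec.∷ S′)) ≋
    Σᴹ (allSubsets (length es)) (λ S → Σᴹ bools (λ β → if not β then f β (b Vec.∷ S) else ε))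
  part M f′ f h b = regroup (decomposes-lift es) M (λ S′ → f′ (b Vec.∷ S′)) (λ β S → f β (b Vec.∷ S))
    (λ β S S′ k o → h β (b Vec.∷ S) (b Vec.∷ S′) (lifted-∷ e b k) o)

-- Edge lists of modified graphs

filterᵇ-∧ : {A : Set} {p p′ k : A → Bool} → (∀ x → p′ x ≡ p x ∧ k x) →
  ∀ xs → List.filterᵇ p′ xs ≡ List.filterᵇ k (List.filterᵇ p xs)
filterᵇ-∧ eq [] = refl
filterᵇ-∧ {p = p} {p′} {k} eq (x ∷ xs) = branch (p x) (k x) refl refl
  where
  branch : ∀ a b → p x ≡ a → k x ≡ b → List.filterᵇ p′ (x ∷ xs) ≡ List.filterᵇ k (List.filterᵇ p (x ∷ xs))
  branch true true px kx = trans (filterᵇ-true p′ x xs (trans (eq x) (cong₂ _∧_ px kx)))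
    (trans (cong (x ∷_) (filterᵇ-∧ eq xs))
      (sym (trans (cong (List.filterᵇ k) (filterᵇ-true p x xs px)) (filterᵇ-true k x _ kx))))
  branch true false px kx = trans (filterᵇ-false p′ x xs (trans (eq x) (cong₂ _∧_ px kx)))
    (trans (filterᵇ-∧ eq xs)
      (sym (trans (cong (List.filterᵇ k) (filterᵇ-true p x xs px)) (filterᵇ-false k x _ kx))))
  branch false b px kx = trans (filterᵇ-false p′ x xs (trans (eq x) (cong (_∧ k x) px)))
    (trans (filterᵇ-∧ eq xs) (sym (cong (List.filterᵇ k) (filterᵇ-false p x xs px))))

filterᵇ-cong : {A : Set} {p p′ : A → Bool} → ∀ {xs} → All (λ x → p′ x ≡ p x) xs → List.filterᵇ p′ xs ≡ List.filterᵇ p xs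
filterᵇ-cong []                              = refl
filterᵇ-cong {p = p} {p′} {x ∷ xs} (eq ∷ eqs) = branch (p x) refl
  where
  branch : ∀ b → p x ≡ b → List.filterᵇ p′ (x ∷ xs) ≡ List.filterᵇ p (x ∷ xs)
  branch true  px = trans (filterᵇ-true p′ x xs (trans eq px)) (trans (cong (x ∷_) (filterᵇ-cong eqs)) (sym (filterᵇ-true p x xs px)))
  branch false px = trans (filterᵇ-false p′ x xs (trans eq px)) (trans (filterᵇ-cong eqs) (sym (filterᵇ-false p x xs px)))

filterᵇ-inserts : {A : Set} {p p′ : A → Bool} {e : A} → p e ≡ false → p′ e ≡ true → (∀ x → x ≢ e → p′ x ≡ p x) →
  ∀ {xs} → e ∈ xs → Unique xs → Inserts e (List.filterᵇ p xs) (List.filterᵇ p′ xs)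
filterᵇ-inserts {p = p} {p′} {e} pe p′e agree {_ ∷ xs} (here refl) (fresh ∷ _) =
  subst₂ (Inserts e) (trans (filterᵇ-cong (All.map (λ {x} e≢x → agree x (e≢x ∘ sym)) fresh)) (sym (filterᵇ-false p e xs pe)))
    (sym (filterᵇ-true p′ e xs p′e)) here
filterᵇ-inserts {p = p} {p′} {e} pe p′e agree {x ∷ xs} (there e∈) (fresh ∷ uniq) = branch (p x) refl
  where
  x≢e : x ≢ e
  x≢e refl = All.lookup fresh e∈ refl
  rest : Inserts e (List.filterᵇ p xs) (List.filterᵇ p′ xs)
  rest = filterᵇ-inserts pe p′e agree e∈ uniq
  branch : ∀ b → p x ≡ b → Inserts e (List.filterᵇ p (x ∷ xs)) (List.filterᵇ p′ (x ∷ xs))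
  branch true  px = subst₂ (Inserts e) (sym (filterᵇ-true p x xs px)) (sym (filterᵇ-true p′ x xs (trans (agree x x≢e) px))) (there rest)
  branch false px = subst₂ (Inserts e) (sym (filterᵇ-false p x xs px)) (sym (filterᵇ-false p′ x xs (trans (agree x x≢e) px))) rest

filterᵇ-++ : {A : Set} (p : A → Bool) → ∀ xs ys → List.filterᵇ p (xs List.++ ys) ≡ List.filterᵇ p xs List.++ List.filterᵇ p ys
filterᵇ-++ p []       ys = refl
filterᵇ-++ p (x ∷ xs) ys = branch (p x) refl
  where
  branch : ∀ b → p x ≡ b → List.filterᵇ p (x ∷ xs List.++ ys) ≡ List.filterᵇ p (x ∷ xs) List.++ List.filterᵇ p ys
  branch true  px = trans (filterᵇ-true p x _ px) (trans (cong (x ∷_) (filterᵇ-++ p xs ys)) (cong (List._++ List.filterᵇ p ys) (sym (filterᵇ-true p x xs px))))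
  branch false px = trans (filterᵇ-false p x _ px) (trans (filterᵇ-++ p xs ys) (cong (List._++ List.filterᵇ p ys) (sym (filterᵇ-false p x xs px))))

filterᵇ-map : {A B : Set} {p : A → Bool} {p′ : B → Bool} (h : A → B) → (∀ x → p′ (h x) ≡ p x) →
  ∀ xs → List.filterᵇ p′ (List.map h xs) ≡ List.map h (List.filterᵇ p xs)
filterᵇ-map h eq [] = refl
filterᵇ-map {p = p} {p′} h eq (x ∷ xs) = branch (p x) refl
  where
  branch : ∀ b → p x ≡ b → List.filterᵇ p′ (h x ∷ List.map h xs) ≡ List.map h (List.filterᵇ p (x ∷ xs))
  branch true  px = trans (filterᵇ-true p′ (h x) _ (trans (eq x) px)) (trans (cong (h x ∷_) (filterᵇ-map h eq xs)) (cong (List.map h) (sym (filterᵇ-true p x xs px))))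
  branch false px = trans (filterᵇ-false p′ (h x) _ (trans (eq x) px)) (trans (filterᵇ-map h eq xs) (cong (List.map h) (sym (filterᵇ-false p x xs px))))

filterᵇ-none : {A : Set} {p : A → Bool} → (∀ x → p x ≡ false) → ∀ xs → List.filterᵇ p xs ≡ []
filterᵇ-none eq []       = refl
filterᵇ-none {p = p} eq (x ∷ xs) = trans (filterᵇ-false p x xs (eq x)) (filterᵇ-none eq xs)

isEdge : ∀ {n} → (Fin n → Fin n → Bool) → Fin n × Fin n → Bool
isEdge adjacent e = (suc (toℕ (proj₁ e)) ≤ᵇ toℕ (proj₂ e)) ∧ adjacent (proj₁ e) (proj₂ e)

-- For the adjacency of a graph this unfolds to `edges`, so the list lemmas apply directly to
-- `edgeCount` and `edgeSet`.
edgesOf : ∀ {n} → (Fin n → Fin n → Bool) → Pairs n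
edgesOf {n} adjacent = List.filterᵇ (isEdge adjacent) (cartesianProduct (allFin n) (allFin n))

edgesOf-filter : ∀ {n} {R R′ : Fin n → Fin n → Bool} {keep : Fin n × Fin n → Bool} →
  (∀ u v → R′ u v ≡ R u v ∧ keep (u , v)) → edgesOf R′ ≡ List.filterᵇ keep (edgesOf R)
edgesOf-filter {n} {R} {R′} {keep} eq = filterᵇ-∧
  (λ e → trans (cong ((suc (toℕ (proj₁ e)) ≤ᵇ toℕ (proj₂ e)) ∧_) (eq (proj₁ e) (proj₂ e)))
    (sym (Boolₚ.∧-assoc (suc (toℕ (proj₁ e)) ≤ᵇ toℕ (proj₂ e)) (R (proj₁ e) (proj₂ e)) (keep e))))
  (cartesianProduct (allFin n) (allFin n))

≤ᵇ-true : ∀ {m n} → (m ≤ᵇ n) ≡ true → m ≤ n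
≤ᵇ-true {m} {n} eq = ℕₚ.≤ᵇ⇒≤ m n (subst Bool.T (sym eq) tt)

≤ᵇ-intro : ∀ {m n} → m ≤ n → (m ≤ᵇ n) ≡ true
≤ᵇ-intro {m} {n} le = T-true (m ≤ᵇ n) (ℕₚ.≤⇒≤ᵇ le)
  where
  T-true : ∀ b → Bool.T b → b ≡ true
  T-true true _ = refl

-- An edge is listed once, with its smaller endpoint first. The reversed pair satisfies the new
-- adjacency as well but fails the test on the order, so exactly one entry appears.
edgesOf-insert : ∀ {n} {R R′ : Fin n → Fin n → Bool} (u₀ v₀ : Fin n) → toℕ u₀ < toℕ v₀ → R u₀ v₀ ≡ false →
  (∀ u v → R′ u v ≡ R u v ∨ incident (u₀ , v₀) u v) → Inserts (u₀ , v₀) (edgesOf R) (edgesOf R′)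
edgesOf-insert {n} {R} {R′} u₀ v₀ u₀<v₀ new eq = filterᵇ-inserts before after agree
  (∈-cartesianProduct⁺ (∈-allFin u₀) (∈-allFin v₀))
  (Uniqueₚ.cartesianProduct⁺ (Uniqueₚ.allFin⁺ n) (Uniqueₚ.allFin⁺ n))
  where
  before : isEdge R (u₀ , v₀) ≡ false
  before = trans (cong ((suc (toℕ u₀) ≤ᵇ toℕ v₀) ∧_) new) (Boolₚ.∧-zeroʳ _)
  after : isEdge R′ (u₀ , v₀) ≡ true
  after = ∧-intro (≤ᵇ-intro u₀<v₀) (trans (eq u₀ v₀) (∨-introʳ {R u₀ v₀} (∨-introˡ (∧-intro (≟ᵇ-refl u₀) (≟ᵇ-refl v₀)))))
  agree : ∀ e → e ≢ (u₀ , v₀) → isEdge R′ e ≡ isEdge R e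
  agree (u , v) e≢ = bool-ext to from
    where
    to : isEdge R′ (u , v) ≡ true → isEdge R (u , v) ≡ true
    to h with ∧-elim {suc (toℕ u) ≤ᵇ toℕ v} h
    ... | u<v , r with ∨-elim {R u v} (trans (sym (eq u v)) r)
    ...   | inj₁ old = ∧-intro u<v old
    ...   | inj₂ inc with ∨-elim {(u₀ ≟ᵇ u) ∧ (v₀ ≟ᵇ v)} inc
    ...     | inj₁ i = ⊥-elim (e≢ (sym (cong₂ _,_ (≟ᵇ⇒≡ u₀ u (proj₁ (∧-elim i))) (≟ᵇ⇒≡ v₀ v (proj₂ (∧-elim {u₀ ≟ᵇ u} i))))))
    ...     | inj₂ i = ⊥-elim (ℕₚ.<-asym u₀<v₀ (subst₂ (λ a b → toℕ a < toℕ b)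
                (sym (≟ᵇ⇒≡ v₀ u (proj₂ (∧-elim {u₀ ≟ᵇ v} i)))) (sym (≟ᵇ⇒≡ u₀ v (proj₁ (∧-elim i)))) (≤ᵇ-true u<v)))
    from : isEdge R (u , v) ≡ true → isEdge R′ (u , v) ≡ true
    from h with ∧-elim {suc (toℕ u) ≤ᵇ toℕ v} h
    ... | u<v , r = ∧-intro u<v (trans (eq u v) (∨-introˡ r))

≤ᵇ-suc : ∀ m n → (suc m ≤ᵇ suc n) ≡ (m ≤ᵇ n)
≤ᵇ-suc zero    n = refl
≤ᵇ-suc (suc m) n = refl

edgesOf-lift : ∀ {n} {R : Fin n → Fin n → Bool} {R′ : Fin (suc n) → Fin (suc n) → Bool} →
  (∀ v → R′ Fin.zero v ≡ false) → (∀ u v → R′ (Fin.suc u) (Fin.suc v) ≡ R u v) →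
  edgesOf R′ ≡ List.map suc² (edgesOf R)
edgesOf-lift {n} {R} {R′} isolated lift = trans
  (cong (λ us → List.filterᵇ (isEdge R′) (cartesianProduct us us)) allFin-suc)
  (trans (filterᵇ-++ (isEdge R′) (List.map (Fin.zero ,_) all′) _)
    (cong₂ List._++_ firstRow (rows (allFin n))))
  where
  all′ : List (Fin (suc n))
  all′ = Fin.zero ∷ List.map Fin.suc (allFin n)
  allFin-suc : allFin (suc n) ≡ all′
  allFin-suc = cong (Fin.zero ∷_) (sym (Listₚ.map-tabulate id Fin.suc))
  firstRow : List.filterᵇ (isEdge R′) (List.map (Fin.zero ,_) all′) ≡ []
  firstRow = trans (filterᵇ-map {p = λ v → isEdge R′ (Fin.zero , v)} {p′ = isEdge R′} (Fin.zero ,_) (λ _ → refl) all′)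
    (cong (List.map (Fin.zero ,_)) (filterᵇ-none (λ v → trans (cong ((1 ≤ᵇ toℕ v) ∧_) (isolated v)) (Boolₚ.∧-zeroʳ _)) all′))
  isEdge-suc : ∀ u v → isEdge R′ (Fin.suc u , Fin.suc v) ≡ isEdge R (u , v)
  isEdge-suc u v = cong₂ _∧_ (≤ᵇ-suc (suc (toℕ u)) (toℕ v)) (lift u v)
  row : ∀ u vs → List.filterᵇ (isEdge R′) (List.map (Fin.suc u ,_) (Fin.zero ∷ List.map Fin.suc vs)) ≡
    List.map suc² (List.filterᵇ (isEdge R) (List.map (u ,_) vs))
  row u vs = trans (cong (List.filterᵇ (isEdge R′)) (trans (sym (Listₚ.map-∘ vs)) (Listₚ.map-∘ vs)))
    (filterᵇ-map suc² (λ e → isEdge-suc (proj₁ e) (proj₂ e)) (List.map (u ,_) vs))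
  rows : ∀ us → List.filterᵇ (isEdge R′) (cartesianProduct (List.map Fin.suc us) all′) ≡
    List.map suc² (List.filterᵇ (isEdge R) (cartesianProduct us (allFin n)))
  rows []       = refl
  rows (u ∷ us) = trans (filterᵇ-++ (isEdge R′) (List.map (Fin.suc u ,_) all′) _)
    (trans (cong₂ List._++_ (row u (allFin n)) (rows us))
      (trans (sym (Listₚ.map-++ suc² (List.filterᵇ (isEdge R) (List.map (u ,_) (allFin n))) _))
        (cong (List.map suc²) (sym (filterᵇ-++ (isEdge R) (List.map (u ,_) (allFin n)) _)))))

-- Answers after an operation, computed from answers before it

onBoth-elim : ∀ {n} {R : Fin n → Fin n → Bool} mx my → onBoth R mx my ≡ true →
  Σ (Fin n) λ u → Σ (Fin n) λ v → mx ≡ just u × my ≡ just v × R u v ≡ true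
onBoth-elim (just u) (just v) eq = u , v , refl , refl , eq

maybe-elim : ∀ {A : Set} {h : A → Bool} m → maybe′ h false m ≡ true → Σ A λ u → m ≡ just u × h u ≡ true
maybe-elim (just u) eq = u , refl , eq

onBoth-cong : ∀ {n} {R R′ : Fin n → Fin n → Bool} → (∀ u v → R u v ≡ R′ u v) → ∀ mx my → onBoth R mx my ≡ onBoth R′ mx my
onBoth-cong h (just u) (just v) = h u v
onBoth-cong h (just u) nothing  = refl
onBoth-cong h nothing  my       = refl

joins : ∀ {K n} → Bool → (Fin n → Fin K) → (Fin n → Fin n → Bool) → Fin K → Fin K → Bool
joins em lb R p q = em ∧ anyFin λ u → anyFin λ v → R u v ∧ ((lb u ≟ᵇ p) ∧ (lb v ≟ᵇ q))

module _ {K n : ℕ} {em : Bool} {lb : Fin n → Fin K} {R : Fin n → Fin n → Bool} where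

  joins-intro : em ≡ true → ∀ u v → R u v ≡ true → joins em lb R (lb u) (lb v) ≡ true
  joins-intro em≡ u v r = ∧-intro em≡ (anyFin-intro {f = λ u′ → anyFin λ v′ → R u′ v′ ∧ ((lb u′ ≟ᵇ lb u) ∧ (lb v′ ≟ᵇ lb v))} u
    (anyFin-intro {f = λ v′ → R u v′ ∧ ((lb u ≟ᵇ lb u) ∧ (lb v′ ≟ᵇ lb v))} v
      (∧-intro r (∧-intro (≟ᵇ-refl (lb u)) (≟ᵇ-refl (lb v))))))

  joins-elim : ∀ {p q} → joins em lb R p q ≡ true →
    em ≡ true × Σ (Fin n) λ u → Σ (Fin n) λ v → R u v ≡ true × lb u ≡ p × lb v ≡ q
  joins-elim {p} {q} eq with ∧-elim {em} eq
  ... | em≡ , h with anyFin-elim {f = λ u → anyFin λ v → R u v ∧ ((lb u ≟ᵇ p) ∧ (lb v ≟ᵇ q))} h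
  ...   | u , hu with anyFin-elim {f = λ v → R u v ∧ ((lb u ≟ᵇ p) ∧ (lb v ≟ᵇ q))} hu
  ...     | v , huv with ∧-elim {R u v} huv
  ...       | r , labels with ∧-elim {lb u ≟ᵇ p} labels
  ...         | lu , lv = em≡ , u , v , r , ≟ᵇ⇒≡ (lb u) p lu , ≟ᵇ⇒≡ (lb v) q lv

anyPair : ∀ {K} → (Fin K → Fin K → Bool) → Bool
anyPair J = anyFin λ p → anyFin λ q → J p q

anyPair-intro : ∀ {K} {J : Fin K → Fin K → Bool} p q → J p q ≡ true → anyPair J ≡ true
anyPair-intro {J = J} p q eq = anyFin-intro {f = λ p → anyFin (J p)} p (anyFin-intro {f = J p} q eq)

anyPair-elim : ∀ {K} {J : Fin K → Fin K → Bool} → anyPair J ≡ true → Σ (Fin K) λ p → Σ (Fin K) λ q → J p q ≡ true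
anyPair-elim {J = J} eq with anyFin-elim {f = λ p → anyFin (J p)} eq
... | p , hp with anyFin-elim {f = J p} hp
...   | q , hpq = p , q , hpq

-- Label pairs joined by an edge once the edges outside k are deleted and the labels are mapped by f.
joinedImage : ∀ {K} → (Fin K → Fin K) → (Fin K → Fin K → Bool) → (Fin K → Fin K → Bool) → Fin K → Fin K → Bool
joinedImage f k J p q = anyPair λ p′ q′ → ((f p′ ≟ᵇ p) ∧ (f q′ ≟ᵇ q)) ∧ (J p′ q′ ∧ k p′ q′)

-- A transition sees a decoded table, which agrees with the answers of the graph only pointwise;
-- hence the separate `χ` and the equation `eq`.
module Answered {em : Bool} {K n a b c : ℕ} (g : Labelled K n) (ρx : Fin a → Maybe (Fin n)) (ρU : Fin b → Subset n)
                (ρB : Fin c → Subset (edgeCount g)) (χ : Answers K a b c) (eq : χ ≗ answer em g ρx ρU ρB) where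

  labelOf : (Fin K → Bool) → Fin a → Bool
  labelOf h x = anyFin λ q → h q ∧ χ (labelled x q)

  labelOf≡ : ∀ h x → labelOf h x ≡ maybe′ (h ∘ lab g) false (ρx x)
  labelOf≡ h x = trans (anyFin-cong (λ q → cong (h q ∧_) (eq (labelled x q)))) (value (ρx x))
    where
    value : ∀ m → anyFin (λ q → h q ∧ maybe′ (λ u → lab g u ≟ᵇ q) false m) ≡ maybe′ (h ∘ lab g) false m
    value (just u) = any-δ h (lab g u)
    value nothing  = bool-ext (λ t → ⊥-elim (none (anyFin-elim {f = λ q → h q ∧ false} t))) (λ ())
      where
      none : Σ _ (λ q → h q ∧ false ≡ true) → ⊥
      none (q , t) = case proj₂ (∧-elim {h q} t) of λ ()

  labelPair : (Fin K → Fin K → Bool) → Fin a → Fin a → Bool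
  labelPair P x y = anyPair λ p q → (χ (labelled x p) ∧ χ (labelled y q)) ∧ P p q

  labelPair≡ : ∀ P x y → labelPair P x y ≡ onBoth (λ u v → P (lab g u) (lab g v)) (ρx x) (ρx y)
  labelPair≡ P x y = bool-ext to from
    where
    to : labelPair P x y ≡ true → onBoth (λ u v → P (lab g u) (lab g v)) (ρx x) (ρx y) ≡ true
    to h with anyPair-elim {J = λ p q → (χ (labelled x p) ∧ χ (labelled y q)) ∧ P p q} h
    ... | p , q , hpq with ∧-elim {χ (labelled x p) ∧ χ (labelled y q)} hpq
    ...   | ls , Ppq with ∧-elim {χ (labelled x p)} ls
    ...     | lx , ly with maybe-elim (ρx x) (trans (sym (eq (labelled x p))) lx) | maybe-elim (ρx y) (trans (sym (eq (labelled y q))) ly)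
    ...       | u , xu , lu | v , yv , lv = trans (cong₂ (onBoth (λ u v → P (lab g u) (lab g v))) xu yv)
      (trans (cong₂ P (≟ᵇ⇒≡ (lab g u) p lu) (≟ᵇ⇒≡ (lab g v) q lv)) Ppq)
    from : onBoth (λ u v → P (lab g u) (lab g v)) (ρx x) (ρx y) ≡ true → labelPair P x y ≡ true
    from h with onBoth-elim (ρx x) (ρx y) h
    ... | u , v , xu , yv , Puv = anyPair-intro {J = λ p q → (χ (labelled x p) ∧ χ (labelled y q)) ∧ P p q} (lab g u) (lab g v)
      (∧-intro (∧-intro (trans (eq (labelled x (lab g u))) (trans (cong (maybe′ (λ u′ → lab g u′ ≟ᵇ lab g u) false) xu) (≟ᵇ-refl (lab g u))))
                        (trans (eq (labelled y (lab g v))) (trans (cong (maybe′ (λ u′ → lab g u′ ≟ᵇ lab g v) false) yv) (≟ᵇ-refl (lab g v))))) Puv)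

  presentImage≡ : ∀ (f : Fin K → Fin K) p → anyFin (λ p′ → (f p′ ≟ᵇ p) ∧ χ (present p′)) ≡ anyFin (λ u → f (lab g u) ≟ᵇ p)
  presentImage≡ f p = bool-ext to from
    where
    to : anyFin (λ p′ → (f p′ ≟ᵇ p) ∧ χ (present p′)) ≡ true → anyFin (λ u → f (lab g u) ≟ᵇ p) ≡ true
    to h with anyFin-elim {f = λ p′ → (f p′ ≟ᵇ p) ∧ χ (present p′)} h
    ... | p′ , h′ with ∧-elim {f p′ ≟ᵇ p} h′
    ...   | fp , pr with anyFin-elim {f = λ u → lab g u ≟ᵇ p′} (trans (sym (eq (present p′))) pr)
    ...     | u , lu = anyFin-intro {f = λ u → f (lab g u) ≟ᵇ p} u (trans (cong (λ z → f z ≟ᵇ p) (≟ᵇ⇒≡ (lab g u) p′ lu)) fp)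
    from : anyFin (λ u → f (lab g u) ≟ᵇ p) ≡ true → anyFin (λ p′ → (f p′ ≟ᵇ p) ∧ χ (present p′)) ≡ true
    from h with anyFin-elim {f = λ u → f (lab g u) ≟ᵇ p} h
    ... | u , fu = anyFin-intro {f = λ p′ → (f p′ ≟ᵇ p) ∧ χ (present p′)} (lab g u)
      (∧-intro fu (trans (eq (present (lab g u))) (anyFin-intro {f = λ u′ → lab g u′ ≟ᵇ lab g u} u (≟ᵇ-refl (lab g u)))))

  joinedImage≡ : ∀ (f : Fin K → Fin K) k r p q → joinedImage f k (λ p q → χ (joined r p q)) p q ≡
    joins em (f ∘ lab g) (λ u v → relation em g ρB r u v ∧ k (lab g u) (lab g v)) p q
  joinedImage≡ f k r p q = bool-ext to from
    where
    R : Fin n → Fin n → Bool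
    R = relation em g ρB r
    to : joinedImage f k (λ p q → χ (joined r p q)) p q ≡ true → joins em (f ∘ lab g) (λ u v → R u v ∧ k (lab g u) (lab g v)) p q ≡ true
    to h with anyPair-elim {J = λ p′ q′ → ((f p′ ≟ᵇ p) ∧ (f q′ ≟ᵇ q)) ∧ (χ (joined r p′ q′) ∧ k p′ q′)} h
    ... | p′ , q′ , h′ with ∧-elim {(f p′ ≟ᵇ p) ∧ (f q′ ≟ᵇ q)} h′
    ...   | fs , jk with ∧-elim {f p′ ≟ᵇ p} fs | ∧-elim {χ (joined r p′ q′)} jk
    ...     | fp , fq | j , kpq with joins-elim {lb = lab g} {R = R} (trans (sym (eq (joined r p′ q′))) j)
    ...       | em≡ , u , v , ruv , refl , refl =
      subst₂ (λ s t → joins em (f ∘ lab g) (λ u v → R u v ∧ k (lab g u) (lab g v)) s t ≡ true)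
        (≟ᵇ⇒≡ (f p′) p fp) (≟ᵇ⇒≡ (f q′) q fq)
        (joins-intro {lb = f ∘ lab g} {R = λ u v → R u v ∧ k (lab g u) (lab g v)} em≡ u v (∧-intro ruv kpq))
    from : joins em (f ∘ lab g) (λ u v → R u v ∧ k (lab g u) (lab g v)) p q ≡ true → joinedImage f k (λ p q → χ (joined r p q)) p q ≡ true
    from h with joins-elim {lb = f ∘ lab g} {R = λ u v → R u v ∧ k (lab g u) (lab g v)} h
    ... | em≡ , u , v , rk , refl , refl with ∧-elim {R u v} rk
    ...   | ruv , kuv = anyPair-intro {J = λ p′ q′ → ((f p′ ≟ᵇ f (lab g u)) ∧ (f q′ ≟ᵇ f (lab g v))) ∧ (χ (joined r p′ q′) ∧ k p′ q′)}
      (lab g u) (lab g v) (∧-intro (∧-intro (≟ᵇ-refl (f (lab g u))) (≟ᵇ-refl (f (lab g v))))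
        (∧-intro (trans (eq (joined r (lab g u) (lab g v))) (joins-intro {lb = lab g} {R = R} em≡ u v ruv)) kuv))

  module Unmoved (g′ : Labelled K n) (ρx′ : Fin a → Maybe (Fin n)) (ρU′ : Fin b → Subset n)
                 (ρx≡ : ∀ x → ρx′ x ≡ ρx x) (ρU≡ : ∀ U → ρU′ U ≡ ρU U) where

    equal≡ : ∀ x y → onBoth _≟ᵇ_ (ρx′ x) (ρx′ y) ≡ χ (equal x y)
    equal≡ x y = trans (cong₂ (onBoth _≟ᵇ_) (ρx≡ x) (ρx≡ y)) (sym (eq (equal x y)))

    below≡ : ∀ x y → onBoth (λ u v → toℕ u ≤ᵇ toℕ v) (ρx′ x) (ρx′ y) ≡ χ (below x y)
    below≡ x y = trans (cong₂ (onBoth (λ u v → toℕ u ≤ᵇ toℕ v)) (ρx≡ x) (ρx≡ y)) (sym (eq (below x y)))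

    member≡ : ∀ x U → maybe′ (Vec.lookup (ρU′ U)) false (ρx′ x) ≡ χ (member x U)
    member≡ x U = trans (cong₂ (λ S → maybe′ (Vec.lookup S) false) (ρU≡ U) (ρx≡ x)) (sym (eq (member x U)))

    related≡ : ∀ {R R′ : Fin n → Fin n → Bool} → (∀ u v → R′ u v ≡ R u v) → ∀ x y → onBoth R′ (ρx′ x) (ρx′ y) ≡ onBoth R (ρx x) (ρx y)
    related≡ {R} {R′} h x y = trans (cong₂ (onBoth R′) (ρx≡ x) (ρx≡ y)) (onBoth-cong h (ρx x) (ρx y))

    module _ (lab≡ : ∀ u → lab g′ u ≡ lab g u) where

      labelled≡ : ∀ x p → maybe′ (λ u → lab g′ u ≟ᵇ p) false (ρx′ x) ≡ χ (labelled x p)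
      labelled≡ x p = trans (cong (maybe′ (λ u → lab g′ u ≟ᵇ p) false) (ρx≡ x)) (trans (relabelled (ρx x)) (sym (eq (labelled x p))))
        where
        relabelled : ∀ v → maybe′ (λ u → lab g′ u ≟ᵇ p) false v ≡ maybe′ (λ u → lab g u ≟ᵇ p) false v
        relabelled (just u) = cong (_≟ᵇ p) (lab≡ u)
        relabelled nothing  = refl

      present≡ : ∀ p → anyFin (λ u → lab g′ u ≟ᵇ p) ≡ χ (present p)
      present≡ p = trans (anyFin-cong (λ u → cong (_≟ᵇ p) (lab≡ u))) (sym (eq (present p)))

joins-cong : ∀ {K n em} {lb lb′ : Fin n → Fin K} {R R′ : Fin n → Fin n → Bool} → (∀ u → lb u ≡ lb′ u) → (∀ u v → R u v ≡ R′ u v) →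
  ∀ p q → joins em lb R p q ≡ joins em lb′ R′ p q
joins-cong {em = em} hl hR p q = cong (em ∧_) (anyFin-cong (λ u → anyFin-cong (λ v →
  cong₂ _∧_ (hR u v) (cong₂ _∧_ (cong (_≟ᵇ p) (hl u)) (cong (_≟ᵇ q) (hl v))))))

module _ {n : ℕ} where

  onBoth-∧not : (R R′ : Fin n → Fin n → Bool) → ∀ mx my →
    onBoth (λ u v → R u v ∧ not (R′ u v)) mx my ≡ onBoth R mx my ∧ not (onBoth R′ mx my)
  onBoth-∧not R R′ (just u) (just v) = refl
  onBoth-∧not R R′ (just u) nothing  = refl
  onBoth-∧not R R′ nothing  my       = refl

  onBoth-∨ : (R R′ : Fin n → Fin n → Bool) → ∀ mx my →
    onBoth (λ u v → R u v ∨ R′ u v) mx my ≡ onBoth R mx my ∨ onBoth R′ mx my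
  onBoth-∨ R R′ (just u) (just v) = refl
  onBoth-∨ R R′ (just u) nothing  = refl
  onBoth-∨ R R′ nothing  my       = refl

  onBoth-∧ᶜ : ∀ b (R : Fin n → Fin n → Bool) → ∀ mx my → onBoth (λ u v → b ∧ R u v) mx my ≡ b ∧ onBoth R mx my
  onBoth-∧ᶜ b R (just u) (just v) = refl
  onBoth-∧ᶜ b R (just u) nothing  = sym (Boolₚ.∧-zeroʳ b)
  onBoth-∧ᶜ b R nothing  my       = sym (Boolₚ.∧-zeroʳ b)

-- Covers ρ (no pair in P) and δ (f the identity).
module Prune {K : ℕ} (f : Fin K → Fin K) (P : Fin K → Fin K → Bool) (P-sym : ∀ p q → P p q ≡ P q p) where

  -- Pairs in `P` are taken out of the adjacency only: an admissible edge set contains no deleted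
  -- edge, so its relation stays as it is.
  keepLabels : ∀ {c} → Fin (suc c) → Fin K → Fin K → Bool
  keepLabels Fin.zero    p q = not (P p q)
  keepLabels (Fin.suc _) p q = true

  newAnswer : ∀ {a b c} → Answers K a b c → Answers K a b c
  newAnswer χ (labelled x p)           = anyFin λ q → (f q ≟ᵇ p) ∧ χ (labelled x q)
  newAnswer χ (related Fin.zero x y)   = χ (related Fin.zero x y) ∧
    not (anyPair λ p q → (χ (labelled x p) ∧ χ (labelled y q)) ∧ P p q)
  newAnswer χ (joined r p q)           = joinedImage f (keepLabels r) (λ p q → χ (joined r p q)) p q
  newAnswer χ (present p)              = anyFin λ p′ → (f p′ ≟ᵇ p) ∧ χ (present p′)
  newAnswer χ q                        = χ q

  update : Update K
  update = record
    { okX = λ _ β _ → not β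
    ; okU = λ _ β _ → not β
    -- Deletion is decided by the labels of the two ends, so `joined` reveals whether a set contains
    -- an edge about to disappear.
    ; okB = λ i β χ → not β ∧ not (anyPair λ p q → χ (joined (Fin.suc i) p q) ∧ P p q)
    ; new = λ _ _ _ → newAnswer }

  module _ {em : Bool} {n : ℕ} (g g′ : Labelled K n)
           (edge≡ : ∀ u v → edge g′ u v ≡ edge g u v ∧ not (P (lab g u) (lab g v)))
           (lab≡ : ∀ u → lab g′ u ≡ f (lab g u)) where

    keepEdge : Fin n × Fin n → Bool
    keepEdge e = not (P (lab g (proj₁ e)) (lab g (proj₂ e)))

    open Filtering keepEdge

    es : Pairs n
    es = edgesOf (edge g)

    es′ : Pairs n
    es′ = edgesOf (edge g′)

    decB : Decomposes (allSubsets (length es)) (allSubsets (length es′)) bools (Kept es es′) (ok es)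
    decB = subst (DecomposesKept es) (sym (edgesOf-filter edge≡)) (decomposes-filter es)

    lookup-chosen : ∀ i S → Vec.lookup S i ≡ true →
      chosen es S (proj₁ (List.lookup es i)) (proj₂ (List.lookup es i)) ≡ true
    lookup-chosen i S h = anyFin-intro {f = λ j → Vec.lookup S j ∧ incident (List.lookup es j) _ _} i
      (∧-intro h (∨-introˡ (∧-intro (≟ᵇ-refl (proj₁ (List.lookup es i))) (≟ᵇ-refl (proj₂ (List.lookup es i))))))

    dropped≡ : em ≡ true → ∀ S →
      (anyPair λ p q → joins em (lab g) (edgeSet g S) p q ∧ P p q) ≡ dropped es S
    dropped≡ em≡ S = bool-ext to from
      where
      to : (anyPair λ p q → joins em (lab g) (edgeSet g S) p q ∧ P p q) ≡ true → dropped es S ≡ true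
      to h with anyPair-elim {J = λ p q → joins em (lab g) (edgeSet g S) p q ∧ P p q} h
      ... | p , q , h′ with ∧-elim {joins em (lab g) (edgeSet g S) p q} h′
      ...   | j , Ppq with joins-elim {lb = lab g} {R = edgeSet g S} j
      ...     | _ , u , v , ch , refl , refl with anyFin-elim {f = λ i → Vec.lookup S i ∧ incident (List.lookup es i) u v} ch
      ...       | i , h″ with ∧-elim {Vec.lookup S i} h″
      ...         | Si , inc = anyFin-intro {f = λ i → Vec.lookup S i ∧ not (keepEdge (List.lookup es i))} i
        (∧-intro Si (trans (Boolₚ.not-involutive _) (orient (∨-elim {(proj₁ (List.lookup es i) ≟ᵇ u) ∧ (proj₂ (List.lookup es i) ≟ᵇ v)} inc))))
        where
        a = proj₁ (List.lookup es i)
        b = proj₂ (List.lookup es i)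
        -- The listed edge may meet the pair in either orientation, which is where the symmetry of
        -- `P` enters.
        orient : (a ≟ᵇ u) ∧ (b ≟ᵇ v) ≡ true ⊎ (a ≟ᵇ v) ∧ (b ≟ᵇ u) ≡ true → P (lab g a) (lab g b) ≡ true
        orient (inj₁ o) = trans (cong₂ (λ s t → P (lab g s) (lab g t)) (≟ᵇ⇒≡ a u (proj₁ (∧-elim o))) (≟ᵇ⇒≡ b v (proj₂ (∧-elim {a ≟ᵇ u} o)))) Ppq
        orient (inj₂ o) = trans (cong₂ (λ s t → P (lab g s) (lab g t)) (≟ᵇ⇒≡ a v (proj₁ (∧-elim o))) (≟ᵇ⇒≡ b u (proj₂ (∧-elim {a ≟ᵇ v} o))))
          (trans (P-sym _ _) Ppq)
      from : dropped es S ≡ true → (anyPair λ p q → joins em (lab g) (edgeSet g S) p q ∧ P p q) ≡ true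
      from h with anyFin-elim {f = λ i → Vec.lookup S i ∧ not (keepEdge (List.lookup es i))} h
      ... | i , h′ with ∧-elim {Vec.lookup S i} h′
      ...   | Si , d = anyPair-intro {J = λ p q → joins em (lab g) (edgeSet g S) p q ∧ P p q}
        (lab g (proj₁ (List.lookup es i))) (lab g (proj₂ (List.lookup es i)))
        (∧-intro (joins-intro {lb = lab g} {R = edgeSet g S} em≡ _ _ (lookup-chosen i S Si)) (trans (sym (Boolₚ.not-involutive _)) d))

    step : Step em g g′ update
    step = record
      { RX = Unchanged ; RU = Unchanged ; RB = Kept es es′
      ; okx = λ β _ → not β ; oku = λ β _ → not β ; okb = ok es
      ; decX = decomposes-unchanged (vertexValues n) ; decU = decomposes-unchanged (allSubsets n) ; decB = λ _ → decB
      ; sizeU = λ { (refl , refl) → refl } ; sizeB = λ { (kept refl _ z) → z }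
      ; okX≡ = λ χ eq i β → refl ; okU≡ = λ χ eq i β → refl
      ; okB≡ = λ em≡ {_} {_} {_} {ρx} {ρU} {ρB} χ eq i β → cong (λ z → not β ∧ not z)
          (trans (anyFin-cong (λ p → anyFin-cong (λ q → cong (_∧ P p q) (eq (joined (Fin.suc i) p q))))) (dropped≡ em≡ (ρB i)))
      ; new≡ = new≡ }
      where
      new≡ : ∀ {a b c} {ρx : Fin a → Maybe (Fin n)} {ρU : Fin b → Subset n} {ρB : Fin c → Subset (length es)}
        {ρx′ : Fin a → Maybe (Fin n)} {ρU′ : Fin b → Subset n} {ρB′ : Fin c → Subset (length es′)} βx βU βB → (∀ i → Unchanged (βx i) (ρx i) (ρx′ i)) → (∀ i → Unchanged (βU i) (ρU i) (ρU′ i)) → (∀ i → Kept es es′ (βB i) (ρB i) (ρB′ i)) →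
        (χ : Answers K a b c) → χ ≗ answer em g ρx ρU ρB → answer em g′ ρx′ ρU′ ρB′ ≗ newAnswer χ
      new≡ {ρx = ρx} {ρU} {ρB} {ρx′} {ρU′} {ρB′} βx βU βB rx rU rB χ eq = go
        where
        open Answered {em} g ρx ρU ρB χ eq
        ρx≡ : ∀ x → ρx′ x ≡ ρx x
        ρx≡ x = proj₂ (rx x)
        open Unmoved g′ ρx′ ρU′ ρx≡ (λ U → proj₂ (rU U))
        relation≡ : ∀ r u v → relation em g′ ρB′ r u v ≡ relation em g ρB r u v ∧ keepLabels r (lab g u) (lab g v)
        relation≡ Fin.zero    u v = edge≡ u v
        relation≡ (Fin.suc i) u v = trans (Kept.same (rB i) u v) (sym (Boolₚ.∧-identityʳ _))
        go : answer em g′ ρx′ ρU′ ρB′ ≗ newAnswer χ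
        go (labelled x p) = trans (cong (maybe′ (λ u → lab g′ u ≟ᵇ p) false) (ρx≡ x)) (trans (relabelled (ρx x)) (sym (labelOf≡ (λ q → f q ≟ᵇ p) x)))
          where
          relabelled : ∀ m → maybe′ (λ u → lab g′ u ≟ᵇ p) false m ≡ maybe′ (λ u → f (lab g u) ≟ᵇ p) false m
          relabelled (just u) = cong (_≟ᵇ p) (lab≡ u)
          relabelled nothing  = refl
        go (equal x y)   = equal≡ x y
        go (below x y)   = below≡ x y
        go (member x U)  = member≡ x U
        go (related Fin.zero x y) = trans (related≡ edge≡ x y)
          (trans (onBoth-∧not (edge g) (λ u v → P (lab g u) (lab g v)) (ρx x) (ρx y))
            (cong₂ (λ s t → s ∧ not t) (sym (eq (related Fin.zero x y))) (sym (labelPair≡ P x y))))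
        go (related (Fin.suc i) x y) = trans (related≡ (Kept.same (rB i)) x y) (sym (eq (related (Fin.suc i) x y)))
        go (joined r p q) = trans (joins-cong lab≡ (relation≡ r) p q) (sym (joinedImage≡ f (keepLabels r) r p q))
        go (present p) = trans (anyFin-cong (λ u → cong (_≟ᵇ p) (lab≡ u))) (sym (presentImage≡ f p))

-- The new vertex is the least one, so the rank labels of the old vertices change by f.
module Adjoin {K : ℕ} (f : Fin K → Fin K) (κ : Fin K) where

  newAnswer : ∀ {a b c} → (Fin a → Bool) → (Fin b → Bool) → Answers K a b c → Answers K a b c
  newAnswer βx βU χ (labelled x p)  = (βx x ∧ (κ ≟ᵇ p)) ∨ (anyFin λ q → (f q ≟ᵇ p) ∧ χ (labelled x q))
  newAnswer βx βU χ (equal x y)     = (βx x ∧ βx y) ∨ χ (equal x y)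
  -- The new vertex is below itself and below every vertex assigned before; no older vertex is below
  -- it.
  newAnswer βx βU χ (below x y)     = (βx x ∧ (βx y ∨ placed y χ)) ∨ χ (below x y)
  newAnswer βx βU χ (member x U)    = (βx x ∧ βU U) ∨ χ (member x U)
  newAnswer βx βU χ (related r x y) = χ (related r x y)
  newAnswer βx βU χ (joined r p q)  = joinedImage f (λ _ _ → true) (λ p q → χ (joined r p q)) p q
  newAnswer βx βU χ (present p)     = (κ ≟ᵇ p) ∨ (anyFin λ p′ → (f p′ ≟ᵇ p) ∧ χ (present p′))

  update : Update K
  update = record
    { okX = λ i β χ → not β ∨ not (placed i χ)
    ; okU = λ _ _ _ → true
    ; okB = λ _ β _ → not β
    ; new = λ βx βU _ → newAnswer βx βU }

  -- A variable receives its vertex at the moment that vertex is created and keeps it from then on,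
  -- so each value after the step has exactly one predecessor and bit.
  data Placement {n : ℕ} : Bool → Maybe (Fin n) → Maybe (Fin (suc n)) → Set where
    stays : ∀ m → Placement false m (Maybe.map Fin.suc m)
    takes : Placement true nothing (just Fin.zero)

  unplaced : {A : Set} → Maybe A → Bool
  unplaced = not ∘ maybe′ (λ _ → true) false

  decX : ∀ n → Decomposes (vertexValues n) (vertexValues (suc n)) bools Placement (λ β m → not β ∨ unplaced m)
  decX n = decomposes λ M f′ h eq → let open SubsetSums M in
    ≈-trans (∙-cong (eq false nothing _ (stays nothing) refl)
      (≈-trans (≈-reflexive (cong (λ us → Σᴹ (List.map just us) f′) {x = allFin (suc n)}
          (cong (Fin.zero ∷_) (sym (Listₚ.map-tabulate id Fin.suc)))))
        (∙-cong (eq true nothing _ takes refl) (≈-trans (≈-reflexive (trans (Σᴹ-map just (List.map Fin.suc (allFin n)) f′)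
          (Σᴹ-map Fin.suc (allFin n) (λ u → f′ (just u)))))
          (Σᴹ-cong (allFin n) (λ u → eq false (just u) _ (stays (just u)) refl))))))
    (≈-trans (≈-sym (CommutativeMonoid.assoc M _ _ _)) (∙-cong (∙-congˡ (≈-sym (identityʳ _)))
      (≈-trans (Σᴹ-cong (allFin n) (λ u → ≈-sym (≈-trans (∙-congˡ (identityˡ _)) (identityʳ _))))
        (≈-sym (≈-reflexive (Σᴹ-map just (allFin n) _))))))

  module _ {em : Bool} {n : ℕ} (g : Labelled K n) (g′ : Labelled K (suc n))
           (isolated : ∀ v → edge g′ Fin.zero v ≡ false)
           (edge≡ : ∀ u v → edge g′ (Fin.suc u) (Fin.suc v) ≡ edge g u v)
           (lab-zero : lab g′ Fin.zero ≡ κ)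
           (lab≡ : ∀ u → lab g′ (Fin.suc u) ≡ f (lab g u)) where

    es : Pairs n
    es = edgesOf (edge g)

    es′ : Pairs (suc n)
    es′ = edgesOf (edge g′)

    decB : Decomposes (allSubsets (length es)) (allSubsets (length es′)) bools (Lifted es es′) (λ β _ → not β)
    decB = subst (λ es′ → Decomposes (allSubsets (length es)) (allSubsets (length es′)) bools (Lifted es es′) (λ β _ → not β))
      (sym (edgesOf-lift isolated edge≡)) (decomposes-lift es)

    step : Step em g g′ update
    step = record
      { RX = Placement ; RU = λ β S S′ → S′ ≡ β Vec.∷ S ; RB = Lifted es es′
      ; okx = λ β m → not β ∨ unplaced m ; oku = λ _ _ → true ; okb = λ β _ → not β
      ; decX = decX n ; decU = decomposes-subset-∷ n ; decB = λ _ → decB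
      ; sizeU = λ { {β} {S} refl → ∣∷∣ β S } ; sizeB = λ { (lifted refl _ _ z) → z }
      ; okX≡ = λ {_} {_} {_} {ρx} {ρU} {ρB} χ eq i β → cong (λ z → not β ∨ not z) (placed-answer em g ρx ρU ρB i χ eq)
      ; okU≡ = λ χ eq i β → refl
      ; okB≡ = λ em≡ χ eq i β → refl
      ; new≡ = new≡ }
      where
      new≡ : ∀ {a b c} {ρx : Fin a → Maybe (Fin n)} {ρU : Fin b → Subset n} {ρB : Fin c → Subset (length es)}
        {ρx′ : Fin a → Maybe (Fin (suc n))} {ρU′ : Fin b → Subset (suc n)} {ρB′ : Fin c → Subset (length es′)} βx βU βB →
        (∀ i → Placement (βx i) (ρx i) (ρx′ i)) → (∀ i → ρU′ i ≡ βU i Vec.∷ ρU i) → (∀ i → Lifted es es′ (βB i) (ρB i) (ρB′ i)) →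
        (χ : Answers K a b c) → χ ≗ answer em g ρx ρU ρB → answer em g′ ρx′ ρU′ ρB′ ≗ newAnswer βx βU χ
      new≡ {ρx = ρx} {ρU} {ρB} {ρx′} {ρU′} {ρB′} βx βU βB rx rU rB χ eq = go
        where
        open Answered {em} g ρx ρU ρB χ eq
        relation-zero : ∀ r v → relation em g′ ρB′ r Fin.zero v ≡ false
        relation-zero Fin.zero    v = isolated v
        relation-zero (Fin.suc i) v = Lifted.isolated (rB i) v
        relation-sym : ∀ r u v → relation em g′ ρB′ r u v ≡ relation em g′ ρB′ r v u
        relation-sym Fin.zero    u v = edge-sym g′ u v
        relation-sym (Fin.suc i) u v = chosen-sym es′ (ρB′ i) u v
        relation≡ : ∀ r u v → relation em g′ ρB′ r (Fin.suc u) (Fin.suc v) ≡ relation em g ρB r u v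
        relation≡ Fin.zero    u v = edge≡ u v
        relation≡ (Fin.suc i) u v = Lifted.same (rB i) u v
        joins-suc : ∀ R p q → (∀ v → R Fin.zero v ≡ false) → (∀ u → R (Fin.suc u) Fin.zero ≡ false) →
          joins em (lab g′) R p q ≡ joins em (lab g′ ∘ Fin.suc) (λ u v → R (Fin.suc u) (Fin.suc v)) p q
        joins-suc R p q z₁ z₂ = cong (em ∧_) (trans (anyFin-suc (λ u → anyFin λ v → R u v ∧ ((lab g′ u ≟ᵇ p) ∧ (lab g′ v ≟ᵇ q))))
          (cong₂ _∨_ (trans (anyFin-cong (λ v → cong (_∧ ((lab g′ Fin.zero ≟ᵇ p) ∧ (lab g′ v ≟ᵇ q))) (z₁ v))) (none n))
            (anyFin-cong (λ u → trans (anyFin-suc (λ v → R (Fin.suc u) v ∧ ((lab g′ (Fin.suc u) ≟ᵇ p) ∧ (lab g′ v ≟ᵇ q))))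
              (cong (λ b → (b ∧ ((lab g′ (Fin.suc u) ≟ᵇ p) ∧ (lab g′ Fin.zero ≟ᵇ q))) ∨
                anyFin (λ v → R (Fin.suc u) (Fin.suc v) ∧ ((lab g′ (Fin.suc u) ≟ᵇ p) ∧ (lab g′ (Fin.suc v) ≟ᵇ q)))) (z₂ u))))))
          where
          none : ∀ k → anyFin {suc k} (λ _ → false) ≡ false
          none k = bool-ext (λ h → case proj₂ (anyFin-elim {f = λ (_ : Fin (suc k)) → false} h) of λ ()) (λ ())
        relatedTo : ∀ r x y → onBoth (relation em g′ ρB′ r) (ρx′ x) (ρx′ y) ≡ onBoth (relation em g ρB r) (ρx x) (ρx y)
        relatedTo r x y with ρx x | ρx′ x | βx x | rx x | ρx y | ρx′ y | βx y | rx y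
        ... | _ | _ | _ | stays (just u) | _ | _ | _ | stays (just v) = relation≡ r u v
        ... | _ | _ | _ | stays (just u) | _ | _ | _ | stays nothing  = refl
        ... | _ | _ | _ | stays nothing  | _ | _ | _ | _              = refl
        ... | _ | _ | _ | stays (just u) | _ | _ | _ | takes          = trans (relation-sym r (Fin.suc u) Fin.zero) (relation-zero r (Fin.suc u))
        ... | _ | _ | _ | takes          | _ | _ | _ | stays (just v) = relation-zero r (Fin.suc v)
        ... | _ | _ | _ | takes          | _ | _ | _ | stays nothing  = refl
        ... | _ | _ | _ | takes          | _ | _ | _ | takes          = relation-zero r Fin.zero
        go : answer em g′ ρx′ ρU′ ρB′ ≗ newAnswer βx βU χ
        go (labelled x p) = trans (relabelled (rx x)) (cong ((βx x ∧ (κ ≟ᵇ p)) ∨_) (sym (labelOf≡ (λ q → f q ≟ᵇ p) x)))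
          where
          relabelled : ∀ {β m m′} → Placement β m m′ → maybe′ (λ u → lab g′ u ≟ᵇ p) false m′ ≡
            (β ∧ (κ ≟ᵇ p)) ∨ maybe′ (λ u → f (lab g u) ≟ᵇ p) false m
          relabelled (stays (just u)) = cong (_≟ᵇ p) (lab≡ u)
          relabelled (stays nothing)  = refl
          relabelled takes            = trans (cong (_≟ᵇ p) lab-zero) (sym (Boolₚ.∨-identityʳ _))
        go (equal x y) = trans (both (rx x) (rx y)) (cong ((βx x ∧ βx y) ∨_) (sym (eq (equal x y))))
          where
          both : ∀ {β₁ m₁ m₁′ β₂ m₂ m₂′} → Placement β₁ m₁ m₁′ → Placement β₂ m₂ m₂′ → onBoth _≟ᵇ_ m₁′ m₂′ ≡ (β₁ ∧ β₂) ∨ onBoth _≟ᵇ_ m₁ m₂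
          both (stays (just u)) (stays (just v)) = ≟ᵇ-suc u v
          both (stays (just u)) (stays nothing)  = refl
          both (stays nothing)  _                = refl
          both (stays (just u)) takes            = refl
          both takes            (stays (just v)) = refl
          both takes            (stays nothing)  = refl
          both takes            takes            = refl
        go (below x y) = trans (both (rx x) (rx y)) (cong₂ (λ s t → (βx x ∧ (βx y ∨ s)) ∨ t)
          (sym (placed-answer em g ρx ρU ρB y χ eq)) (sym (eq (below x y))))
          where
          _⊑_ : ∀ {k} → Fin k → Fin k → Bool
          u ⊑ v = toℕ u ≤ᵇ toℕ v
          both : ∀ {β₁ m₁ m₁′ β₂ m₂ m₂′} → Placement β₁ m₁ m₁′ → Placement β₂ m₂ m₂′ →
            onBoth _⊑_ m₁′ m₂′ ≡ (β₁ ∧ (β₂ ∨ maybe′ (λ _ → true) false m₂)) ∨ onBoth _⊑_ m₁ m₂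
          both (stays (just u)) (stays (just v)) = ≤ᵇ-suc (toℕ u) (toℕ v)
          both (stays (just u)) (stays nothing)  = refl
          both (stays nothing)  _                = refl
          both (stays (just u)) takes            = refl
          both takes            (stays (just v)) = refl
          both takes            (stays nothing)  = refl
          both takes            takes            = refl
        go (member x U) = trans (cong (λ S → maybe′ (Vec.lookup S) false (ρx′ x)) (rU U))
          (trans (mem (rx x)) (cong ((βx x ∧ βU U) ∨_) (sym (eq (member x U)))))
          where
          mem : ∀ {β m m′} → Placement β m m′ → maybe′ (Vec.lookup (βU U Vec.∷ ρU U)) false m′ ≡ (β ∧ βU U) ∨ maybe′ (Vec.lookup (ρU U)) false m
          mem (stays (just u)) = refl
          mem (stays nothing)  = refl
          mem takes            = sym (Boolₚ.∨-identityʳ _)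
        go (related r x y) = trans (relatedTo r x y) (sym (eq (related r x y)))
        go (joined r p q) = trans (joins-suc (relation em g′ ρB′ r) p q (relation-zero r)
            (λ u → trans (relation-sym r (Fin.suc u) Fin.zero) (relation-zero r (Fin.suc u))))
          (trans (joins-cong lab≡ (λ u v → trans (relation≡ r u v) (sym (Boolₚ.∧-identityʳ _))) p q)
            (sym (joinedImage≡ f (λ _ _ → true) r p q)))
        go (present p) = trans (anyFin-suc (λ u → lab g′ u ≟ᵇ p)) (cong₂ _∨_ (cong (_≟ᵇ p) lab-zero)
          (trans (anyFin-cong (λ u → cong (_≟ᵇ p) (lab≡ u))) (sym (presentImage≡ f p))))

-- The size condition of ηᵇ, as the absence of vertices with a bad rank label.
module Guard {K : ℕ} (bad : Fin K → Bool) where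

  enabled : ∀ {n} → Labelled K n → Bool
  enabled g = not (anyFin λ u → bad (lab g u))

  enabledAnswer : ∀ {a b c} → Answers K a b c → Bool
  enabledAnswer χ = not (anyFin λ p → bad p ∧ χ (present p))

  enabledAnswer≡ : ∀ {em n a b c} (g : Labelled K n) (ρx : Fin a → Maybe (Fin n)) (ρU : Fin b → Subset n)
    (ρB : Fin c → Subset (edgeCount g)) (χ : Answers K a b c) → χ ≗ answer em g ρx ρU ρB → enabledAnswer χ ≡ enabled g
  enabledAnswer≡ g ρx ρU ρB χ eq = cong not (bool-ext to from)
    where
    to : (anyFin λ p → bad p ∧ χ (present p)) ≡ true → (anyFin λ u → bad (lab g u)) ≡ true
    to h with anyFin-elim {f = λ p → bad p ∧ χ (present p)} h
    ... | p , h′ with ∧-elim {bad p} h′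
    ...   | bp , pr with anyFin-elim {f = λ u → lab g u ≟ᵇ p} (trans (sym (eq (present p))) pr)
    ...     | u , lu = anyFin-intro {f = λ u → bad (lab g u)} u (trans (cong bad (≟ᵇ⇒≡ (lab g u) p lu)) bp)
    from : (anyFin λ u → bad (lab g u)) ≡ true → (anyFin λ p → bad p ∧ χ (present p)) ≡ true
    from h with anyFin-elim {f = λ u → bad (lab g u)} h
    ... | u , bu = anyFin-intro {f = λ p → bad p ∧ χ (present p)} (lab g u)
      (∧-intro bu (trans (eq (present (lab g u))) (anyFin-intro {f = λ u′ → lab g u′ ≟ᵇ lab g u} u (≟ᵇ-refl (lab g u)))))

-- Without edge sets, edges between arbitrarily large classes can be added at once.
module Link {K : ℕ} (bad : Fin K → Bool) (P : Fin K → Fin K → Bool) where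
  open Guard bad

  newAnswer : ∀ {a b c} → Answers K a b c → Answers K a b c
  -- The two classes may coincide, so equal vertices are excluded to avoid loops, as in `addEdges`.
  newAnswer χ (related Fin.zero x y) = χ (related Fin.zero x y) ∨ (enabledAnswer χ ∧
    ((anyPair λ p q → (χ (labelled x p) ∧ χ (labelled y q)) ∧ P p q) ∧ not (χ (equal x y))))
  newAnswer χ q = χ q

  update : Update K
  update = record
    { okX = λ _ β _ → not β ; okU = λ _ β _ → not β ; okB = λ _ β _ → not β
    ; new = λ _ _ _ → newAnswer }

  module _ {n : ℕ} (g g′ : Labelled K n)
           (edge≡ : ∀ u v → edge g′ u v ≡ edge g u v ∨ (enabled g ∧ (P (lab g u) (lab g v) ∧ not (u ≟ᵇ v))))
           (lab≡ : ∀ u → lab g′ u ≡ lab g u) where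

    es : Pairs n
    es = edgesOf (edge g)

    es′ : Pairs n
    es′ = edgesOf (edge g′)

    step : Step false g g′ update
    step = record
      { RX = Unchanged ; RU = Unchanged ; RB = Kept es es′
      ; okx = λ β _ → not β ; oku = λ β _ → not β ; okb = λ β _ → not β
      ; decX = decomposes-unchanged (vertexValues n) ; decU = decomposes-unchanged (allSubsets n) ; decB = λ ()
      ; sizeU = λ { (refl , refl) → refl } ; sizeB = λ { (kept refl _ z) → z }
      ; okX≡ = λ χ eq i β → refl ; okU≡ = λ χ eq i β → refl ; okB≡ = λ _ χ eq i β → refl
      ; new≡ = new≡ }
      where
      new≡ : ∀ {a b c} {ρx : Fin a → Maybe (Fin n)} {ρU : Fin b → Subset n} {ρB : Fin c → Subset (length es)}
        {ρx′ : Fin a → Maybe (Fin n)} {ρU′ : Fin b → Subset n} {ρB′ : Fin c → Subset (length es′)} βx βU βB →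
        (∀ i → Unchanged (βx i) (ρx i) (ρx′ i)) → (∀ i → Unchanged (βU i) (ρU i) (ρU′ i)) → (∀ i → Kept es es′ (βB i) (ρB i) (ρB′ i)) →
        (χ : Answers K a b c) → χ ≗ answer false g ρx ρU ρB → answer false g′ ρx′ ρU′ ρB′ ≗ newAnswer χ
      new≡ {ρx = ρx} {ρU} {ρB} {ρx′} {ρU′} {ρB′} βx βU βB rx rU rB χ eq = go
        where
        open Answered {false} g ρx ρU ρB χ eq
        open Unmoved g′ ρx′ ρU′ (λ x → proj₂ (rx x)) (λ U → proj₂ (rU U))
        go : answer false g′ ρx′ ρU′ ρB′ ≗ newAnswer χ
        go (labelled x p) = labelled≡ lab≡ x p
        go (equal x y)    = equal≡ x y
        go (below x y)    = below≡ x y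
        go (member x U)   = member≡ x U
        go (related Fin.zero x y) = begin
          onBoth (edge g′) (ρx′ x) (ρx′ y)
            ≡⟨ related≡ edge≡ x y ⟩
          onBoth (λ u v → edge g u v ∨ (enabled g ∧ (P (lab g u) (lab g v) ∧ not (u ≟ᵇ v)))) (ρx x) (ρx y)
            ≡⟨ onBoth-∨ (edge g) (λ u v → enabled g ∧ (P (lab g u) (lab g v) ∧ not (u ≟ᵇ v))) (ρx x) (ρx y) ⟩
          onBoth (edge g) (ρx x) (ρx y) ∨ onBoth (λ u v → enabled g ∧ (P (lab g u) (lab g v) ∧ not (u ≟ᵇ v))) (ρx x) (ρx y)
            ≡⟨ cong (onBoth (edge g) (ρx x) (ρx y) ∨_) (trans
                 (onBoth-∧ᶜ (enabled g) (λ u v → P (lab g u) (lab g v) ∧ not (u ≟ᵇ v)) (ρx x) (ρx y))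
                 (cong (enabled g ∧_) (onBoth-∧not (λ u v → P (lab g u) (lab g v)) _≟ᵇ_ (ρx x) (ρx y)))) ⟩
          onBoth (edge g) (ρx x) (ρx y) ∨ (enabled g ∧ (onBoth (λ u v → P (lab g u) (lab g v)) (ρx x) (ρx y) ∧ not (onBoth _≟ᵇ_ (ρx x) (ρx y))))
            ≡⟨ cong₂ _∨_ (sym (eq (related Fin.zero x y))) (cong₂ _∧_ (sym (enabledAnswer≡ {false} g ρx ρU ρB χ eq))
                 (cong₂ (λ s t → s ∧ not t) (sym (labelPair≡ P x y)) (sym (eq (equal x y))))) ⟩
          newAnswer χ (related Fin.zero x y) ∎
          where open ≡-Reasoning
        go (related (Fin.suc i) x y) = trans (related≡ (Kept.same (rB i)) x y) (sym (eq (related (Fin.suc i) x y)))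
        go (joined r p q) = sym (eq (joined r p q))
        go (present p)    = present≡ lab≡ p

unorderedPair : ∀ {K} → Fin K → Fin K → Fin K → Fin K → Bool
unorderedPair p q s t = ((s ≟ᵇ p) ∧ (t ≟ᵇ q)) ∨ ((s ≟ᵇ q) ∧ (t ≟ᵇ p))

unorderedPair-elim : ∀ {K} (p q s t : Fin K) → unorderedPair p q s t ≡ true → (s ≡ p × t ≡ q) ⊎ (s ≡ q × t ≡ p)
unorderedPair-elim p q s t h with ∨-elim {(s ≟ᵇ p) ∧ (t ≟ᵇ q)} h
... | inj₁ o = inj₁ (≟ᵇ⇒≡ s p (proj₁ (∧-elim o)) , ≟ᵇ⇒≡ t q (proj₂ (∧-elim {s ≟ᵇ p} o)))
... | inj₂ o = inj₂ (≟ᵇ⇒≡ s q (proj₁ (∧-elim o)) , ≟ᵇ⇒≡ t p (proj₂ (∧-elim {s ≟ᵇ q} o)))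

unorderedPair-introˡ : ∀ {K} (p q : Fin K) → unorderedPair p q p q ≡ true
unorderedPair-introˡ p q = ∨-introˡ (∧-intro (≟ᵇ-refl p) (≟ᵇ-refl q))

unorderedPair-introʳ : ∀ {K} (p q : Fin K) → unorderedPair p q q p ≡ true
unorderedPair-introʳ p q = ∨-introʳ {(q ≟ᵇ p) ∧ (p ≟ᵇ q)} (∧-intro (≟ᵇ-refl q) (≟ᵇ-refl p))

-- With edge sets, edges are added one at a time, between two singleton classes, so that one bit per edge set
-- records how it is extended.
module LinkOne {K : ℕ} (bad : Fin K → Bool) (p₀ q₀ : Fin K) where
  open Guard bad

  -- When the guard holds, each of the two labels is carried by at most one vertex. So `present`
  -- says whether the ends of the edge exist, and `joined` whether this very edge is already there.
  creates : ∀ {a b c} → Answers K a b c → Bool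
  creates χ = enabledAnswer χ ∧ ((χ (present p₀) ∧ χ (present q₀)) ∧ not (χ (joined Fin.zero p₀ q₀)))

  selected : ∀ {c} → (Fin c → Bool) → Fin (suc c) → Bool
  selected βB Fin.zero    = true
  selected βB (Fin.suc i) = βB i

  newAnswer : ∀ {a b c} → (Fin c → Bool) → Answers K a b c → Answers K a b c
  newAnswer βB χ (related r x y) = χ (related r x y) ∨ ((selected βB r ∧ creates χ) ∧
    (anyPair λ p q → (χ (labelled x p) ∧ χ (labelled y q)) ∧ unorderedPair p₀ q₀ p q))
  newAnswer βB χ (joined r p q)  = χ (joined r p q) ∨ ((selected βB r ∧ creates χ) ∧ unorderedPair p₀ q₀ p q)
  newAnswer βB χ q               = χ q

  update : Update K
  update = record
    { okX = λ _ β _ → not β ; okU = λ _ β _ → not β ; okB = λ _ β χ → not β ∨ creates χ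
    ; new = λ _ _ βB → newAnswer βB }

  module _ {n : ℕ} (g g′ : Labelled K n) (p₀≢q₀ : p₀ ≢ q₀)
           (unique : enabled g ≡ true → ∀ {u v} → lab g u ≡ p₀ ⊎ lab g u ≡ q₀ → lab g u ≡ lab g v → u ≡ v)
           (edge≡ : ∀ u v → edge g′ u v ≡ edge g u v ∨ (enabled g ∧ unorderedPair p₀ q₀ (lab g u) (lab g v)))
           (lab≡ : ∀ u → lab g′ u ≡ lab g u) where

    es : Pairs n
    es = edgesOf (edge g)

    es′ : Pairs n
    es′ = edgesOf (edge g′)

    linked : Fin n → Fin n → Bool
    linked u v = unorderedPair p₀ q₀ (lab g u) (lab g v)

    inhabited : Fin K → Bool
    inhabited p = anyFin λ u → lab g u ≟ᵇ p

    fresh : Bool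
    fresh = enabled g ∧ ((inhabited p₀ ∧ inhabited q₀) ∧ not (joins true (lab g) (edge g) p₀ q₀))

    creates≡ : ∀ {a b c} (ρx : Fin a → Maybe (Fin n)) (ρU : Fin b → Subset n) (ρB : Fin c → Subset (edgeCount g)) (χ : Answers K a b c) →
      χ ≗ answer true g ρx ρU ρB → creates χ ≡ fresh
    creates≡ ρx ρU ρB χ eq = cong₂ _∧_ (enabledAnswer≡ {true} g ρx ρU ρB χ eq)
      (cong₂ _∧_ (cong₂ _∧_ (eq (present p₀)) (eq (present q₀))) (cong not (eq (joined Fin.zero p₀ q₀))))

    -- If an edge already joins the two labels, uniqueness identifies its ends with `u` and `v`, up
    -- to order; then `u` and `v` are adjacent beforehand and adding the edge has no effect.
    edge-fresh : ∀ u v → edge g′ u v ≡ edge g u v ∨ (fresh ∧ linked u v)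
    edge-fresh u v = trans (edge≡ u v) (bool-ext to from)
      where
      Old = joins true (lab g) (edge g) p₀ q₀
      to : edge g u v ∨ (enabled g ∧ linked u v) ≡ true → edge g u v ∨ (fresh ∧ linked u v) ≡ true
      to h with ∨-elim {edge g u v} h
      ... | inj₁ e = ∨-introˡ e
      ... | inj₂ h′ with ∧-elim {enabled g} h′
      ...   | en , l = decide Old refl
        where
        ends : inhabited p₀ ≡ true × inhabited q₀ ≡ true
        ends with unorderedPair-elim p₀ q₀ (lab g u) (lab g v) l
        ... | inj₁ (lu , lv) = anyFin-intro {f = λ u → lab g u ≟ᵇ p₀} u (≡⇒≟ᵇ lu) , anyFin-intro {f = λ u → lab g u ≟ᵇ q₀} v (≡⇒≟ᵇ lv)
        ... | inj₂ (lu , lv) = anyFin-intro {f = λ u → lab g u ≟ᵇ p₀} v (≡⇒≟ᵇ lv) , anyFin-intro {f = λ u → lab g u ≟ᵇ q₀} u (≡⇒≟ᵇ lu)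
        decide : ∀ b → Old ≡ b → edge g u v ∨ (fresh ∧ linked u v) ≡ true
        decide false old = ∨-introʳ {edge g u v} (∧-intro (∧-intro en (∧-intro (∧-intro (proj₁ ends) (proj₂ ends)) (cong not old))) l)
        decide true  old with joins-elim {lb = lab g} {R = edge g} old
        ... | _ , a , b , eab , la , lb with unorderedPair-elim p₀ q₀ (lab g u) (lab g v) l
        ...   | inj₁ (lu , lv) = ∨-introˡ (subst₂ (λ s t → edge g s t ≡ true)
                  (unique en (inj₁ la) (trans la (sym lu))) (unique en (inj₂ lb) (trans lb (sym lv))) eab)
        ...   | inj₂ (lu , lv) = ∨-introˡ (trans (edge-sym g u v) (subst₂ (λ s t → edge g s t ≡ true)
                  (unique en (inj₁ la) (trans la (sym lv))) (unique en (inj₂ lb) (trans lb (sym lu))) eab))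
      from : edge g u v ∨ (fresh ∧ linked u v) ≡ true → edge g u v ∨ (enabled g ∧ linked u v) ≡ true
      from h with ∨-elim {edge g u v} h
      ... | inj₁ e = ∨-introˡ e
      ... | inj₂ h′ with ∧-elim {fresh} h′
      ...   | fr , l = ∨-introʳ {edge g u v} (∧-intro (proj₁ (∧-elim {enabled g} fr)) l)

    record Grown (β : Bool) (S : Subset (length es)) (S′ : Subset (length es′)) : Set where
      constructor grown
      field
        same : ∀ u v → chosen es′ S′ u v ≡ chosen es S u v ∨ ((β ∧ fresh) ∧ linked u v)
        size : ∣ S′ ∣ ≡ bitℕ β ℕ.+ ∣ S ∣

    DecomposesGrown : Set₁
    DecomposesGrown = Decomposes (allSubsets (length es)) (allSubsets (length es′)) bools Grown (λ β _ → not β ∨ fresh)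

    decB : DecomposesGrown
    decB = decide fresh refl
      where
      decide : ∀ b → fresh ≡ b → DecomposesGrown
      -- No edge is created, so the edge list stays the same; this is expressed as filtering by the
      -- constantly true predicate.
      decide false stale = decomposes λ M f′ f h → let open SubsetSums M in
        ≈-trans (regroup (subst (λ es′ → Decomposes (allSubsets (length es)) (allSubsets (length es′)) bools (Kept es es′) (Filtering.ok (λ _ → true) es))
            (sym (edgesOf-filter {R = edge g} {edge g′} {λ _ → true} (λ u v → trans (edge-fresh u v) (trans
              (cong (λ z → edge g u v ∨ (z ∧ linked u v)) stale) (trans (Boolₚ.∨-identityʳ (edge g u v)) (sym (Boolₚ.∧-identityʳ (edge g u v))))))))
            (Filtering.decomposes-filter (λ _ → true) es)) M f′ f
            (λ { β S S′ (kept refl s z) _ → h false S S′ (grown (λ u v → trans (s u v) (sym (Boolₚ.∨-identityʳ _))) z) refl }))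
          (Σᴹ-cong (allSubsets (length es)) (λ S → Σᴹ-cong bools (λ β → ≈-reflexive (cong (λ z → if z then f β S else ε)
            (trans (cong (λ z → not β ∧ not z) (nothing-dropped S)) (trans (Boolₚ.∧-identityʳ (not β))
              (sym (trans (cong (not β ∨_) stale) (Boolₚ.∨-identityʳ (not β))))))))))
        where
        nothing-dropped : ∀ S → Filtering.dropped (λ _ → true) es S ≡ false
        nothing-dropped S = bool-ext
          (λ t → case (let (i , d) = anyFin-elim {f = λ i → Vec.lookup S i ∧ false} t in proj₂ (∧-elim {Vec.lookup S i} d)) of λ ())
          (λ ())
      decide true fr with ∧-elim {enabled g} fr
      ... | en , rest with ∧-elim {inhabited p₀ ∧ inhabited q₀} rest
      ...   | inh , notOld with anyFin-elim {f = λ u → lab g u ≟ᵇ p₀} (proj₁ (∧-elim {inhabited p₀} inh))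
                              | anyFin-elim {f = λ u → lab g u ≟ᵇ q₀} (proj₂ (∧-elim {inhabited p₀} inh))
      ...     | u₀ , lu | v₀ , lv = orient (ℕₚ.<-cmp (toℕ u₀) (toℕ v₀))
        where
        lu₀ : lab g u₀ ≡ p₀
        lu₀ = ≟ᵇ⇒≡ (lab g u₀) p₀ lu
        lv₀ : lab g v₀ ≡ q₀
        lv₀ = ≟ᵇ⇒≡ (lab g v₀) q₀ lv
        Incident : Fin n → Fin n → Set
        Incident a b = ∀ u v → linked u v ≡ incident (a , b) u v
        sameU : ∀ u → (lab g u ≟ᵇ p₀) ≡ (u₀ ≟ᵇ u)
        sameU u = bool-ext (λ t → ≡⇒≟ᵇ (unique en (inj₁ lu₀) (trans lu₀ (sym (≟ᵇ⇒≡ _ _ t)))))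
          (λ t → ≡⇒≟ᵇ (trans (cong (lab g) (sym (≟ᵇ⇒≡ u₀ u t))) lu₀))
        sameV : ∀ u → (lab g u ≟ᵇ q₀) ≡ (v₀ ≟ᵇ u)
        sameV u = bool-ext (λ t → ≡⇒≟ᵇ (unique en (inj₂ lv₀) (trans lv₀ (sym (≟ᵇ⇒≡ _ _ t)))))
          (λ t → ≡⇒≟ᵇ (trans (cong (lab g) (sym (≟ᵇ⇒≡ v₀ u t))) lv₀))
        inc : Incident u₀ v₀
        inc u v = cong₂ _∨_ (cong₂ _∧_ (sameU u) (sameV v)) (trans (Boolₚ.∧-comm (lab g u ≟ᵇ q₀) _) (cong₂ _∧_ (sameU v) (sameV u)))
        inc′ : Incident v₀ u₀
        inc′ u v = trans (inc u v) (trans (cong₂ _∨_ (Boolₚ.∧-comm (u₀ ≟ᵇ u) _) (Boolₚ.∧-comm (u₀ ≟ᵇ v) _))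
          (Boolₚ.∨-comm ((v₀ ≟ᵇ v) ∧ (u₀ ≟ᵇ u)) _))
        absent : edge g u₀ v₀ ≡ false
        absent = Boolₚ.¬-not λ e → true≢false (subst₂ (λ s t → joins true (lab g) (edge g) s t ≡ true) lu₀ lv₀
          (joins-intro {lb = lab g} {R = edge g} refl u₀ v₀ e)) (not-true notOld)
        between : ∀ a b → toℕ a < toℕ b → edge g a b ≡ false → Incident a b → DecomposesGrown
        between a b a<b none i = decomposes λ M f′ f h → let open SubsetSums M in
          ≈-trans (regroup (decomposes-insert (edgesOf-insert a b a<b none (λ u v → trans (edge-fresh u v)
              (cong (edge g u v ∨_) (trans (cong (_∧ linked u v) fr) (i u v)))))) M f′ f
            (λ { β S S′ (extended s z) _ → h β S S′ (grown (λ u v → trans (s u v) (cong (chosen es S u v ∨_)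
              (cong₂ _∧_ (sym (trans (cong (β ∧_) fr) (Boolₚ.∧-identityʳ β))) (sym (i u v))))) z) (allowed β) }))
            (Σᴹ-cong (allSubsets (length es)) (λ S → Σᴹ-cong bools (λ β →
              ≈-reflexive (cong (λ z → if z then f β S else ε) (sym (allowed β))))))
          where
          allowed : ∀ β → not β ∨ fresh ≡ true
          allowed β = trans (cong (not β ∨_) fr) (Boolₚ.∨-zeroʳ (not β))
        -- The edge is listed with its smaller end first, whichever of the two labels that end
        -- carries. Equality is impossible because the labels differ.
        orient : Tri (toℕ u₀ < toℕ v₀) (toℕ u₀ ≡ toℕ v₀) (toℕ v₀ < toℕ u₀) → DecomposesGrown
        orient (tri< u<v _ _) = between u₀ v₀ u<v absent inc
        orient (tri≈ _ u≡v _) = ⊥-elim (p₀≢q₀ (trans (sym lu₀) (trans (cong (lab g) (Finₚ.toℕ-injective u≡v)) lv₀)))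
        orient (tri> _ _ v<u) = between v₀ u₀ v<u (trans (edge-sym g v₀ u₀) absent) inc′

    step : Step true g g′ update
    step = record
      { RX = Unchanged ; RU = Unchanged ; RB = Grown
      ; okx = λ β _ → not β ; oku = λ β _ → not β ; okb = λ β _ → not β ∨ fresh
      ; decX = decomposes-unchanged (vertexValues n) ; decU = decomposes-unchanged (allSubsets n) ; decB = λ _ → decB
      ; sizeU = λ { (refl , refl) → refl } ; sizeB = Grown.size
      ; okX≡ = λ χ eq i β → refl ; okU≡ = λ χ eq i β → refl
      ; okB≡ = λ _ {_} {_} {_} {ρx} {ρU} {ρB} χ eq i β → cong (not β ∨_) (creates≡ ρx ρU ρB χ eq)
      ; new≡ = new≡ }
      where
      new≡ : ∀ {a b c} {ρx : Fin a → Maybe (Fin n)} {ρU : Fin b → Subset n} {ρB : Fin c → Subset (length es)}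
        {ρx′ : Fin a → Maybe (Fin n)} {ρU′ : Fin b → Subset n} {ρB′ : Fin c → Subset (length es′)} βx βU βB →
        (∀ i → Unchanged (βx i) (ρx i) (ρx′ i)) → (∀ i → Unchanged (βU i) (ρU i) (ρU′ i)) → (∀ i → Grown (βB i) (ρB i) (ρB′ i)) →
        (χ : Answers K a b c) → χ ≗ answer true g ρx ρU ρB → answer true g′ ρx′ ρU′ ρB′ ≗ newAnswer βB χ
      new≡ {ρx = ρx} {ρU} {ρB} {ρx′} {ρU′} {ρB′} βx βU βB rx rU rB χ eq = go
        where
        open Answered {true} g ρx ρU ρB χ eq
        open Unmoved g′ ρx′ ρU′ (λ x → proj₂ (rx x)) (λ U → proj₂ (rU U))
        relation≡ : ∀ r u v → relation true g′ ρB′ r u v ≡ relation true g ρB r u v ∨ ((selected βB r ∧ fresh) ∧ linked u v)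
        relation≡ Fin.zero    u v = edge-fresh u v
        relation≡ (Fin.suc i) u v = Grown.same (rB i) u v
        joins-linked : ∀ R s p q → (s ≡ true → inhabited p₀ ≡ true × inhabited q₀ ≡ true) →
          joins true (lab g) (λ u v → R u v ∨ (s ∧ linked u v)) p q ≡ joins true (lab g) R p q ∨ (s ∧ unorderedPair p₀ q₀ p q)
        joins-linked R s p q ends = bool-ext to from
          where
          R′ : Fin n → Fin n → Bool
          R′ u v = R u v ∨ (s ∧ linked u v)
          to : joins true (lab g) R′ p q ≡ true → joins true (lab g) R p q ∨ (s ∧ unorderedPair p₀ q₀ p q) ≡ true
          to h with joins-elim {lb = lab g} {R = R′} h
          ... | _ , u , v , r , refl , refl with ∨-elim {R u v} r
          ...   | inj₁ old = ∨-introˡ (joins-intro {lb = lab g} {R = R} refl u v old)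
          ...   | inj₂ sl  = ∨-introʳ {joins true (lab g) R p q} sl
          from : joins true (lab g) R p q ∨ (s ∧ unorderedPair p₀ q₀ p q) ≡ true → joins true (lab g) R′ p q ≡ true
          from h with ∨-elim {joins true (lab g) R p q} h
          from h | inj₁ j with joins-elim {lb = lab g} {R = R} j
          ...   | _ , u , v , r , refl , refl = joins-intro {lb = lab g} {R = R′} refl u v (∨-introˡ r)
          from h | inj₂ sl with ∧-elim {s} sl
          ...   | s≡ , l with anyFin-elim {f = λ u → lab g u ≟ᵇ p₀} (proj₁ (ends s≡)) | anyFin-elim {f = λ u → lab g u ≟ᵇ q₀} (proj₂ (ends s≡))
          ...     | u₀ , lu | v₀ , lv with unorderedPair-elim p₀ q₀ p q l
          ...       | inj₁ (refl , refl) = subst₂ (λ a b → joins true (lab g) R′ a b ≡ true) (≟ᵇ⇒≡ _ _ lu) (≟ᵇ⇒≡ _ _ lv)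
                        (joins-intro {lb = lab g} {R = R′} refl u₀ v₀ (∨-introʳ {R u₀ v₀} (∧-intro s≡
                          (subst₂ (λ a b → unorderedPair p₀ q₀ a b ≡ true) (sym (≟ᵇ⇒≡ _ _ lu)) (sym (≟ᵇ⇒≡ _ _ lv)) (unorderedPair-introˡ p₀ q₀)))))
          ...       | inj₂ (refl , refl) = subst₂ (λ a b → joins true (lab g) R′ a b ≡ true) (≟ᵇ⇒≡ _ _ lv) (≟ᵇ⇒≡ _ _ lu)
                        (joins-intro {lb = lab g} {R = R′} refl v₀ u₀ (∨-introʳ {R v₀ u₀} (∧-intro s≡
                          (subst₂ (λ a b → unorderedPair p₀ q₀ a b ≡ true) (sym (≟ᵇ⇒≡ _ _ lv)) (sym (≟ᵇ⇒≡ _ _ lu)) (unorderedPair-introʳ p₀ q₀)))))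
        ends : ∀ r → selected βB r ∧ fresh ≡ true → inhabited p₀ ≡ true × inhabited q₀ ≡ true
        ends r h = ∧-elim (proj₁ (∧-elim {inhabited p₀ ∧ inhabited q₀} (proj₂ (∧-elim {enabled g} (proj₂ (∧-elim {selected βB r} h))))))
        creates≡′ : creates χ ≡ fresh
        creates≡′ = creates≡ ρx ρU ρB χ eq
        go : answer true g′ ρx′ ρU′ ρB′ ≗ newAnswer βB χ
        go (labelled x p) = labelled≡ lab≡ x p
        go (equal x y)    = equal≡ x y
        go (below x y)    = below≡ x y
        go (member x U)   = member≡ x U
        go (related r x y) = begin
          onBoth (relation true g′ ρB′ r) (ρx′ x) (ρx′ y)
            ≡⟨ related≡ (relation≡ r) x y ⟩
          onBoth (λ u v → relation true g ρB r u v ∨ ((selected βB r ∧ fresh) ∧ linked u v)) (ρx x) (ρx y)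
            ≡⟨ onBoth-∨ (relation true g ρB r) (λ u v → (selected βB r ∧ fresh) ∧ linked u v) (ρx x) (ρx y) ⟩
          onBoth (relation true g ρB r) (ρx x) (ρx y) ∨ onBoth (λ u v → (selected βB r ∧ fresh) ∧ linked u v) (ρx x) (ρx y)
            ≡⟨ cong₂ _∨_ (sym (eq (related r x y))) (trans (onBoth-∧ᶜ (selected βB r ∧ fresh) linked (ρx x) (ρx y))
                 (cong₂ (λ s t → (selected βB r ∧ s) ∧ t) (sym creates≡′) (sym (labelPair≡ (unorderedPair p₀ q₀) x y)))) ⟩
          newAnswer βB χ (related r x y) ∎
          where open ≡-Reasoning
        go (joined r p q) = trans (joins-cong lab≡ (relation≡ r) p q)
          (trans (joins-linked (relation true g ρB r) (selected βB r ∧ fresh) p q (ends r))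
            (cong₂ (λ s t → s ∨ ((selected βB r ∧ t) ∧ unorderedPair p₀ q₀ p q)) (sym (eq (joined r p q))) (sym creates≡′)))
        go (present p)    = present≡ lab≡ p

-- Refinement of the labels by capped ranks

opaque
  functionSize : ℕ → ℕ → ℕ
  functionSize m n = n ℕ.^ m

  tabulateᶠ : ∀ {m n} → (Fin m → Fin n) → Fin (functionSize m n)
  tabulateᶠ = Fin.funToFin

  readᶠ : ∀ {m n} → Fin (functionSize m n) → Fin m → Fin n
  readᶠ = Fin.finToFun

  readᶠ-tabulateᶠ : ∀ {m n} (f : Fin m → Fin n) i → readᶠ (tabulateᶠ f) i ≡ f i
  readᶠ-tabulateᶠ = Finₚ.finToFun-funToFin

  tabulateᶠ-cong : ∀ {m n} {f g : Fin m → Fin n} → f ≗ g → tabulateᶠ f ≡ tabulateᶠ g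
  tabulateᶠ-cong = funToFin-cong

rank : ∀ {n} → (Fin n → Bool) → Fin n → ℕ
rank A Fin.zero    = 0
rank A (Fin.suc u) = bitℕ (A Fin.zero) ℕ.+ rank (A ∘ Fin.suc) u

count : ∀ {n} → (Fin n → Bool) → ℕ
count {zero}  A = 0
count {suc n} A = bitℕ (A Fin.zero) ℕ.+ count (A ∘ Fin.suc)

rank-cong : ∀ {n} {A B : Fin n → Bool} → A ≗ B → ∀ u → rank A u ≡ rank B u
rank-cong eq Fin.zero    = refl
rank-cong eq (Fin.suc u) = cong₂ (λ b r → bitℕ b ℕ.+ r) (eq Fin.zero) (rank-cong (eq ∘ Fin.suc) u)

rank-injective : ∀ {n} (A : Fin n → Bool) u v → A u ≡ true → A v ≡ true → rank A u ≡ rank A v → u ≡ v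
rank-injective A Fin.zero    Fin.zero    Au Av eq = refl
rank-injective A Fin.zero    (Fin.suc v) Au Av eq rewrite Au = case eq of λ ()
rank-injective A (Fin.suc u) Fin.zero    Au Av eq rewrite Av = case eq of λ ()
rank-injective A (Fin.suc u) (Fin.suc v) Au Av eq =
  cong Fin.suc (rank-injective (A ∘ Fin.suc) u v Au Av (ℕₚ.+-cancelˡ-≡ (bitℕ (A Fin.zero)) _ _ eq))

rank<count : ∀ {n} (A : Fin n → Bool) u → A u ≡ true → rank A u < count A
rank<count A Fin.zero    Au rewrite Au = s≤s z≤n
rank<count A (Fin.suc u) Au = ℕₚ.+-monoʳ-< (bitℕ (A Fin.zero)) (rank<count (A ∘ Fin.suc) u Au)

-- The greatest member of A has rank count A − 1.
count≤ : ∀ {n} (A : Fin n → Bool) t → (∀ u → A u ≡ true → rank A u < t) → count A ≤ t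
count≤ {zero}  A t h = z≤n
count≤ {suc n} A t h with A Fin.zero in A0
... | false = count≤ (A ∘ Fin.suc) t (λ u Au → subst (λ z → bitℕ z ℕ.+ rank (A ∘ Fin.suc) u < t) A0 (h (Fin.suc u) Au))
... | true = above t (h Fin.zero A0) (λ u Au → subst (λ z → bitℕ z ℕ.+ rank (A ∘ Fin.suc) u < t) A0 (h (Fin.suc u) Au))
  where
  above : ∀ t → 0 < t → (∀ u → A (Fin.suc u) ≡ true → suc (rank (A ∘ Fin.suc) u) < t) → suc (count (A ∘ Fin.suc)) ≤ t
  above (suc t) _ h′ = s≤s (count≤ (A ∘ Fin.suc) t (λ u Au → ℕₚ.≤-pred (h′ u Au)))

module RankLabels (k b : ℕ) where

  cap : ℕ → Fin (suc b)
  cap r = Fin.fromℕ< (s≤s (ℕₚ.m⊓n≤n r b))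

  toℕ-cap : ∀ r → toℕ (cap r) ≡ r ℕ.⊓ b
  toℕ-cap r = Finₚ.toℕ-fromℕ< (s≤s (ℕₚ.m⊓n≤n r b))

  -- Once the cap is reached further additions keep it reached, and below the cap nothing has been
  -- lost. Capped ranks can thus be updated without the true ranks.
  cap-+ : ∀ a r → cap (a ℕ.+ toℕ (cap r)) ≡ cap (a ℕ.+ r)
  cap-+ a r = Finₚ.toℕ-injective (trans (toℕ-cap _) (trans (cong (λ z → (a ℕ.+ z) ℕ.⊓ b) (toℕ-cap r))
    (trans (absorb (ℕₚ.≤-total r b)) (sym (toℕ-cap _)))))
    where
    absorb : r ≤ b ⊎ b ≤ r → (a ℕ.+ (r ℕ.⊓ b)) ℕ.⊓ b ≡ (a ℕ.+ r) ℕ.⊓ b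
    absorb (inj₁ r≤b) = cong (λ z → (a ℕ.+ z) ℕ.⊓ b) (ℕₚ.m≤n⇒m⊓n≡m r≤b)
    absorb (inj₂ b≤r) = trans (cong (λ z → (a ℕ.+ z) ℕ.⊓ b) (ℕₚ.m≥n⇒m⊓n≡n b≤r))
      (trans (ℕₚ.m≥n⇒m⊓n≡n (ℕₚ.m≤n+m b a)) (sym (ℕₚ.m≥n⇒m⊓n≡n (ℕₚ.≤-trans b≤r (ℕₚ.m≤n+m r a)))))

  K : ℕ
  K = pairSize k (functionSize (powerSize k) (suc b))

  coarse : Fin K → Fin k
  coarse = first

  rankIn : Fin K → Fin (powerSize k) → Fin (suc b)
  rankIn p = readᶠ (second p)

  refinedLabel : Fin k → (Fin (powerSize k) → Fin (suc b)) → Fin K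
  refinedLabel l ranks = pair l (tabulateᶠ ranks)

  -- The ranks are taken in every union of classes, capped at b; in a union with at most b members they identify u.
  refine : ∀ {n} → (Fin n → Fin k) → Fin n → Fin K
  refine lb u = refinedLabel (lb u) (λ s → cap (rank (readᵇ s ∘ lb) u))

  coarse-refine : ∀ {n} (lb : Fin n → Fin k) u → coarse (refine lb u) ≡ lb u
  coarse-refine lb u = first-pair (lb u) _

  rankIn-refine : ∀ {n} (lb : Fin n → Fin k) u (A : Fin k → Bool) → rankIn (refine lb u) (tabulateᵇ A) ≡ cap (rank (A ∘ lb) u)
  rankIn-refine lb u A = trans (cong (λ z → readᶠ z (tabulateᵇ A)) (second-pair (lb u) _))
    (trans (readᶠ-tabulateᶠ _ (tabulateᵇ A)) (cong cap (rank-cong (λ v → readᵇ-tabulateᵇ A (lb v)) u)))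

  -- The rank in a union of classes after relabelling is the old rank in the preimage of that union,
  -- again a union of classes. Ranks in single classes would not be closed under this, because
  -- relabelling merges classes.
  moveLabel : (Fin k → Fin k) → Fin K → Fin K
  moveLabel mv p = refinedLabel (mv (coarse p)) (λ s → rankIn p (tabulateᵇ (readᵇ s ∘ mv)))

  refine-move : ∀ {n} (mv : Fin k → Fin k) (lb : Fin n → Fin k) u → refine (mv ∘ lb) u ≡ moveLabel mv (refine lb u)
  refine-move mv lb u = cong₂ pair (cong mv (sym (coarse-refine lb u)))
    (tabulateᶠ-cong (λ s → sym (rankIn-refine lb u (readᵇ s ∘ mv))))

  shiftLabel : Fin k → Fin K → Fin K
  shiftLabel i p = refinedLabel (coarse p) (λ s → cap (bitℕ (readᵇ s i) ℕ.+ toℕ (rankIn p s)))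

  refine-shift : ∀ {n} i (lb : Fin (suc n) → Fin k) → lb Fin.zero ≡ i → ∀ u → refine lb (Fin.suc u) ≡ shiftLabel i (refine (lb ∘ Fin.suc) u)
  refine-shift i lb refl u = cong₂ pair (sym (coarse-refine (lb ∘ Fin.suc) u)) (tabulateᶠ-cong (λ s →
    trans (sym (cap-+ (bitℕ (readᵇ s i)) _)) (cong (λ z → cap (bitℕ (readᵇ s i) ℕ.+ toℕ z))
      (sym (trans (cong (λ z → readᶠ z s) (second-pair (lb (Fin.suc u)) _)) (readᶠ-tabulateᶠ _ s))))))

  newLabel : Fin k → Fin K
  newLabel i = refinedLabel i (λ _ → cap 0)

  refined : (G : KGraph k) → Labelled K (N (graph G))
  refined G = record
    { edge = adj (graph G) ; edge-sym = adj-sym (graph G) ; edge-irr = adj-irrefl (graph G) ; lab = refine (label G) }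

  among : Fin k → Fin k → Fin k → Bool
  among i j l = (l ≟ᵇ i) ∨ (l ≟ᵇ j)

  -- The union of two classes has more than t vertices iff one of them has rank at least t.
  overflows : ℕ → Fin k → Fin k → Fin K → Bool
  overflows t i j p = among i j (coarse p) ∧ (t ≤ᵇ toℕ (rankIn p (tabulateᵇ (among i j))))

  -- The cap lies at or above `t`, so it does not affect a comparison with `t`.
  overflows-refine : ∀ {n} t i j (lb : Fin n → Fin k) → t ≤ b → ∀ u →
    overflows t i j (refine lb u) ≡ among i j (lb u) ∧ (t ≤ᵇ rank (among i j ∘ lb) u)
  overflows-refine t i j lb t≤b u = cong₂ _∧_ (cong (among i j) (coarse-refine lb u))
    (trans (cong (λ z → t ≤ᵇ toℕ z) (rankIn-refine lb u (among i j))) (trans (cong (t ≤ᵇ_) (toℕ-cap _))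
      (bool-ext (λ h → ≤ᵇ-intro (ℕₚ.≤-trans (≤ᵇ-true {t} h) (ℕₚ.m⊓n≤m (rank (among i j ∘ lb) u) b)))
                (λ h → ≤ᵇ-intro (ℕₚ.⊓-glb (≤ᵇ-true {t} h) t≤b)))))

  countLab≡count : ∀ (G : KGraph k) i j → countLab G i j ≡ count (among i j ∘ label G)
  countLab≡count G i j = go (N (graph G)) (label G)
    where
    weight : Fin k → ℕ
    weight l = bitℕ (among i j l)
    go : ∀ n (lb : Fin n → Fin k) → ℕSum.sum (List.map (weight ∘ lb) (allFin n)) ≡ count (among i j ∘ lb)
    go zero    lb = refl
    go (suc n) lb = cong (weight (lb Fin.zero) ℕ.+_) (trans
      (cong ℕSum.sum (trans (Listₚ.map-tabulate Fin.suc (weight ∘ lb)) (sym (Listₚ.map-tabulate id (weight ∘ lb ∘ Fin.suc)))))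
      (go n (lb ∘ Fin.suc)))

  enabled≡ : ∀ (G : KGraph k) t i j → t ≤ b → Guard.enabled (overflows t i j) (refined G) ≡ (countLab G i j ≤ᵇ t)
  enabled≡ G t i j t≤b = bool-ext to from
    where
    A : Fin (N (graph G)) → Bool
    A = among i j ∘ label G
    full : Fin (N (graph G)) → Bool
    full u = overflows t i j (refine (label G) u)
    to : not (anyFin full) ≡ true → (countLab G i j ≤ᵇ t) ≡ true
    to h = ≤ᵇ-intro (subst (_≤ t) (sym (countLab≡count G i j)) (count≤ A t λ u Au →
      ℕₚ.≰⇒> λ t≤r → true≢false (anyFin-intro {f = full} u
        (trans (overflows-refine t i j (label G) t≤b u) (∧-intro Au (≤ᵇ-intro t≤r)))) (not-true h)))
    from : (countLab G i j ≤ᵇ t) ≡ true → not (anyFin full) ≡ true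
    from h = not-intro λ f → case anyFin-elim {f = full} f of λ { (u , ov) →
      let (Au , t≤r) = ∧-elim {A u} (trans (sym (overflows-refine t i j (label G) t≤b u)) ov) in
      ℕₚ.<⇒≱ (rank<count A u Au) (ℕₚ.≤-trans (subst (_≤ t) (countLab≡count G i j) (≤ᵇ-true h)) (≤ᵇ-true t≤r)) }

  -- Supplies the uniqueness assumption of `LinkOne`. If the guard holds, the union has at most `t`
  -- members; their ranks are below `b`, survive the cap, and differ from each other.
  refine-unique : ∀ (G : KGraph k) t i j → t ≤ b → Guard.enabled (overflows t i j) (refined G) ≡ true → ∀ {u v} →
    among i j (coarse (refine (label G) u)) ≡ true → refine (label G) u ≡ refine (label G) v → u ≡ v
  refine-unique G t i j t≤b en {u} {v} au eq = rank-injective A u v Au Av ranks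
    where
    A : Fin (N (graph G)) → Bool
    A = among i j ∘ label G
    Au : A u ≡ true
    Au = trans (cong (among i j) (sym (coarse-refine (label G) u))) au
    Av : A v ≡ true
    Av = trans (cong (among i j) (trans (sym (coarse-refine (label G) v)) (cong coarse (sym eq)))) au
    small : ∀ w → A w ≡ true → rank A w ≤ b
    small w Aw = ℕₚ.≤-trans (ℕₚ.<⇒≤ (rank<count A w Aw)) (ℕₚ.≤-trans
      (subst (_≤ t) (countLab≡count G i j) (≤ᵇ-true (trans (sym (enabled≡ G t i j t≤b)) en))) t≤b)
    uncapped : ∀ w → A w ≡ true → toℕ (rankIn (refine (label G) w) (tabulateᵇ (among i j))) ≡ rank A w
    uncapped w Aw = trans (cong toℕ (rankIn-refine (label G) w (among i j))) (trans (toℕ-cap _) (ℕₚ.m≤n⇒m⊓n≡m (small w Aw)))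
    ranks : rank A u ≡ rank A v
    ranks = trans (sym (uncapped u Au)) (trans (cong (λ p → toℕ (rankIn p (tabulateᵇ (among i j)))) eq) (uncapped v Av))

-- Graph operations as chains of steps

data Chain (em : Bool) {K : ℕ} : List (Update K) → ∀ {n n′} → Labelled K n → Labelled K n′ → Set₁ where
  []  : ∀ {n} {g : Labelled K n} → Chain em [] g g
  _∷_ : ∀ {n n′ n″ υ υs} {g : Labelled K n} {g′ : Labelled K n′} {g″ : Labelled K n″} →
    Step em g g′ υ → Chain em υs g′ g″ → Chain em (υ ∷ υs) g g″

_++ᶜ_ : ∀ {em K υs υs′ n n′ n″} {g : Labelled K n} {g′ : Labelled K n′} {g″ : Labelled K n″} →
  Chain em υs g g′ → Chain em υs′ g′ g″ → Chain em (υs List.++ υs′) g g″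
[]       ++ᶜ d = d
(s ∷ c) ++ᶜ d = s ∷ (c ++ᶜ d)

threshold : ∀ {k} → BasicOp k → ℕ
threshold (ηᵇ t i j) = t
threshold _          = 0

maxThreshold : ∀ {k} → ElemOp k → ℕ
maxThreshold []       = 0
maxThreshold (o ∷ os) = threshold o ℕ.⊔ maxThreshold os

module Operations (k b : ℕ) where
  open RankLabels k b

  noLabels : Fin K → Bool
  noLabels _ = false

  noPairs : Fin K → Fin K → Bool
  noPairs _ _ = false

  between : Fin k → Fin k → Fin K → Fin K → Bool
  between i j p q = unorderedPair i j (coarse p) (coarse q)

  unorderedPair-comm : ∀ {n} (i j s t : Fin n) → unorderedPair i j s t ≡ unorderedPair i j t s
  unorderedPair-comm i j s t = trans (Boolₚ.∨-comm ((s ≟ᵇ i) ∧ (t ≟ᵇ j)) _)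
    (cong₂ _∨_ (Boolₚ.∧-comm (s ≟ᵇ j) _) (Boolₚ.∧-comm (s ≟ᵇ i) _))

  between-sym : ∀ i j p q → between i j p q ≡ between i j q p
  between-sym i j p q = unorderedPair-comm i j (coarse p) (coarse q)

  -- When the guard holds, labels in the union determine vertices, so demanding distinct labels
  -- excludes exactly the loops.
  distinctPair : Fin k → Fin k → Fin K × Fin K → Bool
  distinctPair i j e = between i j (proj₁ e) (proj₂ e) ∧ not (proj₁ e ≟ᵇ proj₂ e)

  -- Every pair of labels is listed in both orders. At its second occurrence the edge is already
  -- present, `creates` fails, and the step changes nothing.
  distinctPairs : Fin k → Fin k → List (Fin K × Fin K)
  distinctPairs i j = List.filter (λ e → Boolₚ.T? (distinctPair i j e)) (cartesianProduct (allFin K) (allFin K))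

  redirect : Fin k → Fin k → Fin k → Fin k
  redirect i j l = if l ≟ᵇ i then j else l

  updates : Bool → BasicOp k → List (Update K)
  updates em    (Add i)      = Adjoin.update (shiftLabel i) (newLabel i) ∷ []
  updates em    (ρ i j)      = Prune.update (moveLabel (redirect i j)) noPairs (λ _ _ → refl) ∷ []
  updates em    (δ i j)      = Prune.update id (between i j) (between-sym i j) ∷ []
  updates em    (η i j)      = Link.update noLabels (between i j) ∷ []
  updates false (ηᵇ t i j)   = Link.update (overflows t i j) (between i j) ∷ []
  updates true  (ηᵇ t i j)   = List.map (λ e → LinkOne.update (overflows t i j) (proj₁ e) (proj₂ e)) (distinctPairs i j)
    -- A trivial update at the end: the graph built edge by edge agrees with the intended one only
    -- pointwise, and a step that changes nothing passes from one to the other.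
    List.++ (Prune.update id noPairs (λ _ _ → refl) ∷ [])

  module _ (G : KGraph k) where

    private
      n : ℕ
      n = N (graph G)

    between-refined : ∀ i j u v → between i j (refine (label G) u) (refine (label G) v) ≡ pairLab G i j u v
    between-refined i j u v = cong₂ (unorderedPair i j) (coarse-refine (label G) u) (coarse-refine (label G) v)

    linkOne : (bad : Fin K → Bool) (p q : Fin K) → p ≢ q → (g : Labelled K n) → Labelled K n
    linkOne bad p q p≢q g = record
      { edge     = λ u v → edge g u v ∨ (Guard.enabled bad g ∧ unorderedPair p q (lab g u) (lab g v))
      ; edge-sym = λ u v → cong₂ _∨_ (edge-sym g u v) (cong (Guard.enabled bad g ∧_) (unorderedPair-comm p q (lab g u) (lab g v)))
      ; edge-irr = λ u → trans (cong (_∨ (Guard.enabled bad g ∧ unorderedPair p q (lab g u) (lab g u))) (edge-irr g u))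
          (Boolₚ.¬-not λ h → case unorderedPair-elim p q (lab g u) (lab g u) (proj₂ (∧-elim {Guard.enabled bad g} h)) of λ where
            (inj₁ (s , t)) → p≢q (trans (sym s) t)
            (inj₂ (s , t)) → p≢q (trans (sym t) s))
      ; lab      = lab g }

    linkAll : (bad : Fin K → Bool) (ps : List (Fin K × Fin K)) → All (λ e → proj₁ e ≢ proj₂ e) ps → Labelled K n → Labelled K n
    linkAll bad []             []         g = g
    linkAll bad ((p , q) ∷ ps) (p≢q ∷ hs) g = linkAll bad ps hs (linkOne bad p q p≢q g)

    linkAll-lab : ∀ bad ps hs g u → lab (linkAll bad ps hs g) u ≡ lab g u
    linkAll-lab bad []             []         g u = refl
    linkAll-lab bad ((p , q) ∷ ps) (p≢q ∷ hs) g u = linkAll-lab bad ps hs (linkOne bad p q p≢q g) u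

    linkAll-edge : ∀ bad ps hs g u v → edge (linkAll bad ps hs g) u v ≡
      edge g u v ∨ (Guard.enabled bad g ∧ any (λ e → unorderedPair (proj₁ e) (proj₂ e) (lab g u) (lab g v)) ps)
    linkAll-edge bad []             []         g u v = sym (trans (cong (edge g u v ∨_) (Boolₚ.∧-zeroʳ _)) (Boolₚ.∨-identityʳ _))
    linkAll-edge bad ((p , q) ∷ ps) (p≢q ∷ hs) g u v = trans (linkAll-edge bad ps hs (linkOne bad p q p≢q g) u v)
      (trans (Boolₚ.∨-assoc (edge g u v) _ _) (cong (edge g u v ∨_) (sym (Boolₚ.∧-distribˡ-∨ (Guard.enabled bad g) _ _))))

    -- A single link alters no label, so the guard and the uniqueness of labels hold for the rest of
    -- the list exactly as at the start.
    linkAll-chain : ∀ bad ps hs g →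
      (Guard.enabled bad g ≡ true → ∀ {e} → e ∈ ps → ∀ {u v} → lab g u ≡ proj₁ e ⊎ lab g u ≡ proj₂ e → lab g u ≡ lab g v → u ≡ v) →
      Chain true (List.map (λ e → LinkOne.update bad (proj₁ e) (proj₂ e)) ps) g (linkAll bad ps hs g)
    linkAll-chain bad []             []         g unique = []
    linkAll-chain bad ((p , q) ∷ ps) (p≢q ∷ hs) g unique =
      LinkOne.step bad p q g (linkOne bad p q p≢q g) p≢q (λ en → unique en (here refl)) (λ u v → refl) (λ u → refl)
      ∷ linkAll-chain bad ps hs (linkOne bad p q p≢q g) (λ en e∈ → unique en (there e∈))

    distinctPairs-distinct : ∀ i j → All (λ e → proj₁ e ≢ proj₂ e) (distinctPairs i j)
    distinctPairs-distinct i j = All.map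
      (λ {e} h p≡q → true≢false (≡⇒≟ᵇ p≡q) (not-true (proj₂ (∧-elim {between i j (proj₁ e) (proj₂ e)} (T⇒true h)))))
      (Allₚ.all-filter (λ e → Boolₚ.T? (distinctPair i j e)) (cartesianProduct (allFin K) (allFin K)))
      where
      T⇒true : ∀ {c} → Bool.T c → c ≡ true
      T⇒true {true} _ = refl

    between⇒among : ∀ i j p q → between i j p q ≡ true → among i j (coarse p) ≡ true × among i j (coarse q) ≡ true
    between⇒among i j p q h with unorderedPair-elim i j (coarse p) (coarse q) h
    ... | inj₁ (s , t) = ∨-introˡ (≡⇒≟ᵇ s) , ∨-introʳ {coarse q ≟ᵇ i} (≡⇒≟ᵇ t)
    ... | inj₂ (s , t) = ∨-introʳ {coarse p ≟ᵇ i} (≡⇒≟ᵇ s) , ∨-introˡ (≡⇒≟ᵇ t)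

    boundedLink : ∀ t i j → t ≤ b → Chain true (updates true (ηᵇ t i j)) (refined G) (refined (applyBasic (ηᵇ t i j) G))
    boundedLink t i j t≤b = decide (countLab G i j ≤ᵇ t) refl
      where
      bad : Fin K → Bool
      bad = overflows t i j
      ps : List (Fin K × Fin K)
      ps = distinctPairs i j
      hs : All (λ e → proj₁ e ≢ proj₂ e) ps
      hs = distinctPairs-distinct i j
      linked : Labelled K n
      linked = linkAll bad ps hs (refined G)
      en≡ : Guard.enabled bad (refined G) ≡ (countLab G i j ≤ᵇ t)
      en≡ = enabled≡ G t i j t≤b
      pairOf : ∀ {e} → e ∈ ps → distinctPair i j e ≡ true
      pairOf {e} e∈ = T⇒true (proj₂ (∈-filter⁻ (λ e → Boolₚ.T? (distinctPair i j e)) {xs = cartesianProduct (allFin K) (allFin K)} e∈))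
        where
        T⇒true : ∀ {c} → Bool.T c → c ≡ true
        T⇒true {true} _ = refl
      chain : Chain true (List.map (λ e → LinkOne.update bad (proj₁ e) (proj₂ e)) ps) (refined G) linked
      chain = linkAll-chain bad ps hs (refined G) λ en {e} e∈ {u} {v} l eq → refine-unique G t i j t≤b en
        (let (a , a′) = between⇒among i j (proj₁ e) (proj₂ e) (proj₁ (∧-elim {between i j (proj₁ e) (proj₂ e)} (pairOf e∈))) in
          [ (λ h → trans (cong (among i j ∘ coarse) h) a) , (λ h → trans (cong (among i j ∘ coarse) h) a′) ] l) eq
      R : Fin n → Fin K
      R = refine (label G)
      selected≡ : Guard.enabled bad (refined G) ≡ true → ∀ u v →
        any (λ e → unorderedPair (proj₁ e) (proj₂ e) (R u) (R v)) ps ≡ pairLab G i j u v ∧ not (u ≟ᵇ v)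
      selected≡ en u v = bool-ext to from
        where
        to : any (λ e → unorderedPair (proj₁ e) (proj₂ e) (R u) (R v)) ps ≡ true → pairLab G i j u v ∧ not (u ≟ᵇ v) ≡ true
        to h with any-elim {f = λ e → unorderedPair (proj₁ e) (proj₂ e) (R u) (R v)} ps h
        ... | (p , q) , e∈ , s with ∧-elim {between i j p q} (pairOf e∈) | unorderedPair-elim p q (R u) (R v) s
        ...   | bt , p≠q | inj₁ (refl , refl) = ∧-intro (trans (sym (between-refined i j u v)) bt)
                  (not-intro λ u≡v → true≢false (≡⇒≟ᵇ (cong R (≟ᵇ⇒≡ u v u≡v))) (not-true p≠q))
        ...   | bt , p≠q | inj₂ (refl , refl) = ∧-intro (trans (sym (between-refined i j u v)) (trans (between-sym i j (R u) (R v)) bt))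
                  (not-intro λ u≡v → true≢false (≡⇒≟ᵇ (cong R (sym (≟ᵇ⇒≡ u v u≡v)))) (not-true p≠q))
        from : pairLab G i j u v ∧ not (u ≟ᵇ v) ≡ true → any (λ e → unorderedPair (proj₁ e) (proj₂ e) (R u) (R v)) ps ≡ true
        from h with ∧-elim {pairLab G i j u v} h
        ... | pl , u≠v = any-intro {f = λ e → unorderedPair (proj₁ e) (proj₂ e) (R u) (R v)}
          (∈-filter⁺ (λ e → Boolₚ.T? (distinctPair i j e)) (∈-cartesianProduct⁺ (∈-allFin (R u)) (∈-allFin (R v)))
            (subst Bool.T (sym (∧-intro bt distinct)) tt))
          (unorderedPair-introˡ (R u) (R v))
          where
          bt : between i j (R u) (R v) ≡ true
          bt = trans (between-refined i j u v) pl
          distinct : not (R u ≟ᵇ R v) ≡ true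
          distinct = not-intro λ e → true≢false
            (≡⇒≟ᵇ (refine-unique G t i j t≤b en (proj₁ (between⇒among i j (R u) (R v) bt)) (≟ᵇ⇒≡ (R u) (R v) e))) (not-true u≠v)
      finish : ∀ (g′ : Labelled K n) → (∀ u v → edge g′ u v ≡ edge linked u v) → (∀ u → lab g′ u ≡ R u) →
        Chain true (updates true (ηᵇ t i j)) (refined G) g′
      finish g′ he hl = chain ++ᶜ (Prune.step id noPairs (λ _ _ → refl) linked g′
        (λ u v → trans (he u v) (sym (Boolₚ.∧-identityʳ _)))
        (λ u → trans (hl u) (sym (linkAll-lab bad ps hs (refined G) u))) ∷ [])
      decide : ∀ c → (countLab G i j ≤ᵇ t) ≡ c →
        Chain true (updates true (ηᵇ t i j)) (refined G) (refined (if c then addEdges i j G else G))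
      decide true eq = finish (refined (addEdges i j G))
        (λ u v → sym (trans (linkAll-edge bad ps hs (refined G) u v) (cong (adj (graph G) u v ∨_)
          (cong₂ _∧_ {x = Guard.enabled bad (refined G)} (trans en≡ eq) (selected≡ (trans en≡ eq) u v)))))
        (λ u → refl)
      decide false eq = finish (refined G)
        (λ u v → sym (trans (linkAll-edge bad ps hs (refined G) u v)
          (trans (cong (λ z → adj (graph G) u v ∨ (z ∧ any (λ e → unorderedPair (proj₁ e) (proj₂ e) (R u) (R v)) ps)) (trans en≡ eq))
            (Boolₚ.∨-identityʳ _))))
        (λ u → refl)

    unboundedLink : ∀ t i j → t ≤ b → Chain false (updates false (ηᵇ t i j)) (refined G) (refined (applyBasic (ηᵇ t i j) G))
    unboundedLink t i j t≤b = decide (countLab G i j ≤ᵇ t) refl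
      where
      guarded≡ : ∀ c → (countLab G i j ≤ᵇ t) ≡ c → ∀ u v →
        Guard.enabled (overflows t i j) (refined G) ∧ (between i j (refine (label G) u) (refine (label G) v) ∧ not (u ≟ᵇ v)) ≡
        c ∧ (pairLab G i j u v ∧ not (u ≟ᵇ v))
      guarded≡ c eq u v = cong₂ (λ s t → s ∧ (t ∧ not (u ≟ᵇ v))) (trans (enabled≡ G t i j t≤b) eq) (between-refined i j u v)
      decide : ∀ c → (countLab G i j ≤ᵇ t) ≡ c →
        Chain false (updates false (ηᵇ t i j)) (refined G) (refined (if c then addEdges i j G else G))
      decide true eq = Link.step (overflows t i j) (between i j) (refined G) (refined (addEdges i j G))
        (λ u v → cong (adj (graph G) u v ∨_) (sym (guarded≡ true eq u v))) (λ u → refl) ∷ []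
      decide false eq = Link.step (overflows t i j) (between i j) (refined G) (refined G)
        (λ u v → sym (trans (cong (adj (graph G) u v ∨_) (guarded≡ false eq u v)) (Boolₚ.∨-identityʳ _))) (λ u → refl) ∷ []

    none-bad : Guard.enabled noLabels (refined G) ≡ true
    none-bad = not-intro λ h → case proj₂ (anyFin-elim {n} {f = λ _ → false} h) of λ ()

    basicChain : ∀ em (o : BasicOp k) → (em ≡ true → BoundedOp o) → threshold o ≤ b →
      Chain em (updates em o) (refined G) (refined (applyBasic o G))
    basicChain em (Add i) bd le = Adjoin.step (shiftLabel i) (newLabel i) (refined G) (refined (addVertex i G))
      (λ v → refl) (λ u v → refl) refl (λ u → refine-shift i (label (addVertex i G)) refl u) ∷ []
    basicChain em (ρ i j) bd le = Prune.step (moveLabel (redirect i j)) noPairs (λ _ _ → refl) (refined G) (refined (relabel i j G))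
      (λ u v → sym (Boolₚ.∧-identityʳ _)) (λ u → refine-move (redirect i j) (label G) u) ∷ []
    basicChain em (δ i j) bd le = Prune.step id (between i j) (between-sym i j) (refined G) (refined (removeEdges i j G))
      (λ u v → cong (λ z → adj (graph G) u v ∧ not z) (sym (between-refined i j u v))) (λ u → refl) ∷ []
    basicChain true (η i j) bd le = ⊥-elim (bd refl)
    basicChain false (η i j) bd le = Link.step noLabels (between i j) (refined G) (refined (addEdges i j G))
      (λ u v → cong (adj (graph G) u v ∨_) (sym (cong₂ (λ s t → s ∧ (t ∧ not (u ≟ᵇ v))) none-bad (between-refined i j u v)))) (λ u → refl) ∷ []
    basicChain true  (ηᵇ t i j) bd le = boundedLink t i j le
    basicChain false (ηᵇ t i j) bd le = unboundedLink t i j le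

  elemUpdates : Bool → ElemOp k → List (Update K)
  elemUpdates em = concatMap (updates em)

  elemChain : ∀ em (os : ElemOp k) → (em ≡ true → BoundedElem os) → maxThreshold os ≤ b → ∀ G →
    Chain em (elemUpdates em os) (refined G) (refined (applyElem os G))
  elemChain em []       bd le G = []
  elemChain em (o ∷ os) bd le G = basicChain G em o (proj₁ ∘ bd) (ℕₚ.m⊔n≤o⇒m≤o (threshold o) _ le)
    ++ᶜ elemChain em os (proj₂ ∘ bd) (ℕₚ.m⊔n≤o⇒n≤o (threshold o) _ le) (applyBasic o G)

-- Bi-iterative families

module Family (p : MSOLPoly) (invariant : IsGraphPolynomial p) (Gs : ℕ → Graph) (B : BiIteration) (realises : Realises B Gs)
              (em : Bool) (edgeFree : em ≡ false → IsMSOLG p) (bounded : em ≡ true → AllBounded B) where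

  private
    h f l cap : ℕ
    h   = maxThreshold (H B)
    f   = maxThreshold (F B)
    l   = maxThreshold (L B)
    -- One cap for all three operations, so that they share their labels and types and their
    -- matrices can be multiplied.
    cap = h ℕ.⊔ (f ℕ.⊔ l)

  open RankLabels (k B) cap using (K; refined)
  open Operations (k B) cap using (elemUpdates; elemChain)

  φ : Sentence K 0 (ℓ p) (m p)
  φ = translate (Φ p)

  bFree : em ≡ false → BFree φ
  bFree eq = edgeFree⇒BFree (Φ p) (proj₂ (edgeFree eq))

  open CFiniteSequences (nVars p) using (D; ⟦_⟧; ∑ᴾ; ⟦∑ᴾ⟧)
  open TypePolynomials em K (ℓ p) (m p) (ℓ' p) (m' p) (ℓ'≤ℓ p) (m'≤m p) φ

  open CFiniteSequences (nVars p) using (module MatrixRecurrence)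
  open MatrixRecurrence (allFin (card φ))

  identity : Matrix
  identity q′ q = if q′ ≟ᵇ q then 1ᴾ else 0ᴾ

  maps-identity : ∀ v → Maps identity v v
  maps-identity v q′ x = sym (trans (∑-cong (allFin (card φ)) (λ q → entry (q′ ≟ᵇ q) q)) (∑-δ q′ (λ q → ⟦ v q ⟧ x)))
    where
    entry : ∀ b q → ⟦ if b then 1ᴾ else 0ᴾ ⟧ x ℤ.* ⟦ v q ⟧ x ≡ (if b then ⟦ v q ⟧ x else ℤ.0ℤ)
    entry true  q = trans (cong (λ z → z ℤ.* ⟦ v q ⟧ x) (evalAt-1 x)) (ℤₚ.*-identityˡ _)
    entry false q = refl

  chainMatrix : List (Update K) → Matrix
  chainMatrix []       = identity
  chainMatrix (υ ∷ υs) = chainMatrix υs · updateMatrix υ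

  maps-chain : ∀ {υs n n′} {g : Labelled K n} {g′ : Labelled K n′} → Chain em υs g g′ → Maps (chainMatrix υs) (value g) (value g′)
  maps-chain {g = g} []                  = maps-identity (value g)
  maps-chain {υ ∷ υs} {g = g} {g″} (_∷_ {g′ = g′} s c) = maps-· {chainMatrix υs} {updateMatrix υ} {value g} {value g′} {value g″}
    (value-step s bFree (λ eq → proj₁ (edgeFree eq))) (maps-chain c)

  elemMatrix : ElemOp (k B) → Matrix
  elemMatrix os = chainMatrix (elemUpdates em os)

  maps-elem : ∀ os → (em ≡ true → BoundedElem os) → maxThreshold os ≤ cap → ∀ G →
    Maps (elemMatrix os) (value (refined G)) (value (refined (applyElem os G)))
  maps-elem os bd le G = maps-chain (elemChain em os bd le G)

  stepMatrix : ℕ → Matrix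
  stepMatrix n = elemMatrix (H B) · iterate (elemMatrix (F B)) (elemMatrix (L B)) n

  vector : ℕ → Fin (card φ) → D
  vector n = value (refined (family B n))

  maps-iterate : ∀ G n → Maps (iterate (elemMatrix (F B)) (elemMatrix (L B)) n) (value (refined G))
    (value (refined (iterElem n (F B) (applyElem (L B) G))))
  maps-iterate G zero = maps-elem (L B) (proj₂ ∘ proj₂ ∘ bounded) (ℕₚ.≤-trans (ℕₚ.m≤n⊔m f l) (ℕₚ.m≤n⊔m h (f ℕ.⊔ l))) G
  maps-iterate G (suc n) = maps-· {elemMatrix (F B)} {iterate (elemMatrix (F B)) (elemMatrix (L B)) n} {value (refined G)}
    {value (refined G′)} {value (refined (applyElem (F B) G′))} (maps-iterate G n)
    (maps-elem (F B) (proj₁ ∘ proj₂ ∘ bounded) (ℕₚ.≤-trans (ℕₚ.m≤m⊔n f l) (ℕₚ.m≤n⊔m h (f ℕ.⊔ l))) G′)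
    where
    G′ : KGraph (k B)
    G′ = iterElem n (F B) (applyElem (L B) G)

  maps-step : ∀ n → Maps (stepMatrix n) (vector n) (vector (suc n))
  maps-step n = maps-· {elemMatrix (H B)} {iterate (elemMatrix (F B)) (elemMatrix (L B)) n} {vector n}
    {value (refined G′)} {vector (suc n)} (maps-iterate (family B n) n)
    (maps-elem (H B) (proj₁ ∘ bounded) (ℕₚ.m≤m⊔n h (f ℕ.⊔ l)) G′)
    where
    G′ : KGraph (k B)
    G′ = iterElem n (F B) (applyElem (L B) (family B n))

  accepted : Fin (card φ) → D
  accepted q = if accepts φ q then 1ᴾ else 0ᴾ

  eval≡ : ∀ n x → ⟦ eval p (Gs n) ⟧ x ≡ ∑ (allFin (card φ)) (λ q → ⟦ accepted q ⟧ x ℤ.* ⟦ vector n q ⟧ x)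
  eval≡ n x = begin
    ⟦ eval p (Gs n) ⟧ x
      -- The formula may refer to the order of vertices. Invariance replaces the given graph by the
      -- constructed one, whose order puts new vertices below old ones.
      ≡⟨ ≈ᴾ⇒≈ᴱ (eval p (Gs n)) (eval p (graph (family B n))) (invariant (Gs n) (graph (family B n)) (realises n)) x ⟩
    ⟦ eval p (graph (family B n)) ⟧ x
      ≡⟨ ⟦∑ᴾ⟧ (vertexTuples g) _ x ⟩
    ∑ (vertexTuples g) (λ ρU → ⟦ ∑ᴾ (edgeTuples g) (λ ρB → guarded (sat (graph (family B n)) (Φ p) (λ ()) ρU ρB) (weight g ρU ρB)) ⟧ x)
      ≡⟨ ∑-cong (vertexTuples g) (λ ρU → trans (⟦∑ᴾ⟧ (edgeTuples g) _ x) (∑-cong (edgeTuples g) (λ ρB → term ρU ρB))) ⟩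
    ∑ (vertexTuples g) (λ ρU → ∑ (edgeTuples g) λ ρB → ⟦ accepted (typeAt g ρU ρB) ⟧ x ℤ.* monoAt (weight g ρU ρB) x)
      ≡⟨ value-fibres g (λ q → ⟦ accepted q ⟧ x) x ⟨
    ∑ (allFin (card φ)) (λ q → ⟦ accepted q ⟧ x ℤ.* ⟦ vector n q ⟧ x) ∎
    where
    open ≡-Reasoning
    g : Labelled K (N (graph (family B n)))
    g = refined (family B n)
    indicator : ∀ c e → ⟦ guarded c e ⟧ x ≡ ⟦ if c then 1ᴾ else 0ᴾ ⟧ x ℤ.* monoAt e x
    indicator true  e = trans (⟦guarded⟧ true e x) (sym (trans (cong (λ z → z ℤ.* monoAt e x) (evalAt-1 x)) (ℤₚ.*-identityˡ _)))
    indicator false e = refl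
    term : ∀ ρU ρB → ⟦ guarded (sat (graph (family B n)) (Φ p) (λ ()) ρU ρB) (weight g ρU ρB) ⟧ x ≡
      ⟦ accepted (typeAt g ρU ρB) ⟧ x ℤ.* monoAt (weight g ρU ρB) x
    term ρU ρB = trans (cong (λ c → ⟦ guarded c (weight g ρU ρB) ⟧ x) (sym (Correctness.accepts≡sat em g (Φ p) (λ ()) ρU ρB)))
      (indicator (accepts φ (typeAt g ρU ρB)) (weight g ρU ρB))

  conclusion : C2Finite (λ n → fromPoly (eval p (Gs n)))
  conclusion = matrixRecurrence⇒C2Finite stepMatrix
    (recognisable-iterate (elemMatrix (H B)) (elemMatrix (F B)) (elemMatrix (L B)))
    vector maps-step accepted (λ n → eval p (Gs n)) eval≡

theorem7p1 : (p : MSOLPoly) → IsGraphPolynomial p →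
    (Gs : ℕ → Graph) → BiIterativelyConstructible Gs →
    IsMSOLG p ⊎ BoundedBiIterativelyConstructible Gs →
    C2Finite (λ n → fromPoly (eval p (Gs n)))
theorem7p1 p invariant Gs (B , realises) (inj₁ msolG) =
  Family.conclusion p invariant Gs B realises false (λ _ → msolG) (λ ())
theorem7p1 p invariant Gs _ (inj₂ (B , realises , bounded)) =
  Family.conclusion p invariant Gs B realises true (λ ()) (λ _ → bounded)
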